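{- Let $a,b,c\in\mathbb{Q}$ with $abc\neq 0$ and $4ac-b^2\neq 0$, and let $\mathcal{E}_1$ be the elliptic curve over $\mathbb{Q}$ \[\mathcal{E}_1:\ Y^2=X^3+27a^2b^2c^2(3ac-b^2)X+27a^3b^4c^3(9ac-2b^2).\] If $b^2\neq kac$ for each $k\in\{ -1,1,3\}$, then $\mathcal{E}_1(\mathbb{Q})$ has positive rank. If $b^2=kac$ for some $k\in\{ -1,1,3\}$, then $\mathcal{E}_1(\mathbb{Q})$ has rank $0$. -}

module Defs where

open import Data.Nat using (ℕ; zero; suc)
open import Data.Integer using (+_)
open import Data.Rational using (ℚ; 0ℚ; 1ℚ; _+_; _*_; _-_; -_; 1/_; ≢-nonZero; _/_)
open import Data.Rational.Properties using (_≟_)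
open import Data.Product using (∃; _×_; _,_)
open import Data.Unit using (⊤)
open import Relation.Nullary using (yes; no; ¬_)
open import Relation.Binary.PropositionalEquality using (_≡_)

q : ℕ → ℚ
q n = + n / 1

-- total inverse: inv 0 = 0 (only used where the argument is nonzero)
inv : ℚ → ℚ
inv p with p ≟ 0ℚ
... | yes _ = 0ℚ
... | no p≢0 = 1/_ p {{≢-nonZero p≢0}}

data Point : Set where
  O   : Point
  aff : ℚ → ℚ → Point

OnCurve : ℚ → ℚ → Point → Set
OnCurve A B O = ⊤
OnCurve A B (aff x y) = y * y ≡ x * x * x + A * x + B

add : ℚ → ℚ → Point → Point → Point
add A B O Q = Q
add A B (aff x₁ y₁) O = aff x₁ y₁
add A B (aff x₁ y₁) (aff x₂ y₂) with x₁ ≟ x₂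
... | no _ =
  let l  = (y₂ - y₁) * inv (x₂ - x₁)
      x₃ = l * l - x₁ - x₂
  in aff x₃ (l * (x₁ - x₃) - y₁)
... | yes _ with y₁ + y₂ ≟ 0ℚ
...   | yes _ = O
...   | no _ =
  let l  = (q 3 * x₁ * x₁ + A) * inv (q 2 * y₁)
      x₃ = l * l - x₁ - x₂
  in aff x₃ (l * (x₁ - x₃) - y₁)

smul : ℚ → ℚ → ℕ → Point → Point
smul A B zero P = O
smul A B (suc n) P = add A B P (smul A B n P)

PositiveRank : ℚ → ℚ → Set
PositiveRank A B = ∃ λ P → OnCurve A B P × (∀ n → ¬ (smul A B (suc n) P ≡ O))

RankZero : ℚ → ℚ → Set
RankZero A B = ∀ P → OnCurve A B P → ∃ λ n → smul A B (suc n) P ≡ O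

E₁A : ℚ → ℚ → ℚ → ℚ
E₁A a b c = q 27 * (a * a) * (b * b) * (c * c) * (q 3 * a * c - b * b)

E₁B : ℚ → ℚ → ℚ → ℚ
E₁B a b c = q 27 * (a * a * a) * (b * b * b * b) * (c * c * c) * (q 9 * a * c - q 2 * (b * b))

{-# OPTIONS --safe #-}
module Submission where

-- With t = b² / (a c) the curve is a rescaling of z² = r³ - t r² + t r, which carries the rational point P = (1 , 1).
--
-- Positive rank: for t ∉ {-1, 0, 1, 3, 4} one of 2P, 3P, 4P, chosen according to the residue of t in ℚ₂, is close to the origin
-- 2-adically. Doubling multiplies the x-coordinate of such a point by a unit divided by 4, so its multiples by powers of 2 are
-- pairwise distinct. Of the group law this needs only 2ᵏ⁺¹ Q = 2ᵏ Q + 2ᵏ Q, which follows from Q + 2R = R + (R + Q).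
--
-- Rank zero: for t ∈ {-1, 1, 3} a rational point gives coprime integers with x⁴ - t x² y² + t y⁴ = w², and 2-isogeny descent
-- turns such a solution into a smaller one (c , d , a) with y = ± a c d or y = ± 2 a c d. Only x² = y² = 1 and the degenerate
-- solutions survive, so the rational points are finitely many and each is torsion by inspection.

open import Data.Nat as ℕ using (ℕ; zero; suc)
import Data.Nat.Properties as ℕ
import Data.Nat.Divisibility as ℕ
import Data.Nat.DivMod as ℕ
open import Data.Nat.Primality using (Prime; euclidsLemma; prime?; prime⇒nonZero; prime⇒nonTrivial; prime⇒irreducible; ¬prime[1]; prime[2])
import Data.Integer as ℤ
import Data.Integer.Properties as ℤ
import Data.Integer.DivMod as ℤ
import Data.Integer.Divisibility.Signed as ℤ
open import Data.Empty using (⊥; ⊥-elim; ⊥-elim-irr)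
open import Data.List using ([]; _∷_)
open import Data.Product using (∃; ∃₂; _×_; _,_; proj₁; proj₂)
open import Data.Sum using (_⊎_; inj₁; inj₂; [_,_]′; map₁)
open import Data.Unit using (tt)
open import Relation.Nullary using (yes; no; ¬_; Dec)
open import Relation.Binary.PropositionalEquality using (module ≡-Reasoning; _≡_; _≢_; refl; sym; trans; cong; cong₂; subst; subst₂)

-- Put `s = (1 - t) / 2`. Then 2P has r-coordinate s², 3P has ((s² + 2 s - 1) / (s² - 1))², and the
-- denominator of 4P carries 2 s (s² + s - 1). So 3P is the origin for t = -1 and t = 3, and 4P for
-- t = 1: the excluded values are those at which P itself is torsion. The same denominators dictate
-- the choice of multiple. Unless t is a 2-adic unit, s has a pole at 2 and 2P is near the origin;
-- for a unit t either s is even, which puts 4P near the origin, or s is a unit, which makes s² - 1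
-- divisible by 8 and puts 3P there. All these r-coordinates are squares because r modulo squares is
-- a homomorphism sending P to 1; the points are therefore given through a root ν of r. In the
-- descent, X² - t X + t has discriminant t² - 4 t, which is -3 for t = 1 and t = 3, and 5 for t =
-- -1. It is a prime up to sign, so every factorisation into coprime parts leaves only two ways to
-- distribute it.

module Descent where
  open import Data.Integer using (ℤ; +_; -[1+_]; ∣_∣; _+_; _*_; _-_; -_)
  open import Data.Integer.Tactic.RingSolver using (solve; solve-∀)
  import Data.Nat.ListAction as ℕ
  open import Data.Nat.Primality.Factorisation using (factorise; PrimeFactorisation)
  open import Data.Nat.Tactic.RingSolver using () renaming (solve-∀ to solve-∀ⁿ)
  open import Data.List.Relation.Unary.All as All using (All)
  open import Relation.Binary.Definitions using (tri<; tri≈; tri>)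
  open import Relation.Nullary.Decidable using (from-yes)

  -- Integer divisibility, coprimality and signs

  opaque
    -- Consequences of hypotheses are reduced to polynomial identities: the explicit arguments are
    -- the coefficients of a linear combination, and the ring solver checks the last premise.
    combine₁ : ∀ {L R a b} c → a ≡ b → L - R ≡ c * (a - b) → L ≡ R
    combine₁ {b = b} c refl e = ℤ.i-j≡0⇒i≡j _ _ (trans e (trans (cong (c *_) (ℤ.+-inverseʳ b)) (ℤ.*-zeroʳ c)))

    combine₂ : ∀ {L R a b a′ b′} c c′ → a ≡ b → a′ ≡ b′ → L - R ≡ c * (a - b) + c′ * (a′ - b′) → L ≡ R
    combine₂ {b = b} {b′ = b′} c c′ refl refl e = ℤ.i-j≡0⇒i≡j _ _ (trans e (vanish b b′ c c′))
      where
      vanish : ∀ b b′ c c′ → c * (b - b) + c′ * (b′ - b′) ≡ + 0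
      vanish = solve-∀

    combine₃ : ∀ {L R a b a′ b′ a″ b″} c c′ c″ → a ≡ b → a′ ≡ b′ → a″ ≡ b″ →
               L - R ≡ c * (a - b) + c′ * (a′ - b′) + c″ * (a″ - b″) → L ≡ R
    combine₃ {b = b} {b′ = b′} {b″ = b″} c c′ c″ refl refl refl e = ℤ.i-j≡0⇒i≡j _ _ (trans e (vanish b b′ b″ c c′ c″))
      where
      vanish : ∀ b b′ b″ c c′ c″ → c * (b - b) + c′ * (b′ - b′) + c″ * (b″ - b″) ≡ + 0
      vanish = solve-∀

    combine₄ : ∀ {L R a b a′ b′ a″ b″ a‴ b‴} c c′ c″ c‴ → a ≡ b → a′ ≡ b′ → a″ ≡ b″ → a‴ ≡ b‴ →
               L - R ≡ c * (a - b) + c′ * (a′ - b′) + c″ * (a″ - b″) + c‴ * (a‴ - b‴) → L ≡ R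
    combine₄ {b = b} {b′ = b′} {b″ = b″} {b‴ = b‴} c c′ c″ c‴ refl refl refl refl e = ℤ.i-j≡0⇒i≡j _ _ (trans e (vanish b b′ b″ b‴ c c′ c″ c‴))
      where
      vanish : ∀ b b′ b″ b‴ c c′ c″ c‴ → c * (b - b) + c′ * (b′ - b′) + c″ * (b″ - b″) + c‴ * (b‴ - b‴) ≡ + 0
      vanish = solve-∀

  infix 4 _∣ᶻ_
  -- The equation has `x` alone on the left, so matching it with `refl` turns `x` into `+ p * k` and
  -- leaves goals to the ring solver.
  record _∣ᶻ_ (p : ℕ) (x : ℤ) : Set where
    constructor mult
    field
      quotient : ℤ
      x≡ : x ≡ + p * quotient

  opaque
    ∣ᶻ⇒∣ : ∀ {p x} → p ∣ᶻ x → p ℕ.∣ ∣ x ∣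
    ∣ᶻ⇒∣ {p} (mult k refl) = ℕ.divides ∣ k ∣ (trans (ℤ.abs-* (+ p) k) (ℕ.*-comm p ∣ k ∣))

    ∣⇒∣ᶻ : ∀ {p x} → p ℕ.∣ ∣ x ∣ → p ∣ᶻ x
    ∣⇒∣ᶻ {p} {x} h with ℤ.∣ᵤ⇒∣ {+ p} {x} h
    ... | ℤ.divides k e = mult k (trans e (ℤ.*-comm k (+ p)))

    ∣ᶻ-combine : ∀ {p x y z} → p ∣ᶻ x → p ∣ᶻ y → ∀ a b → z ≡ a * x + b * y → p ∣ᶻ z
    ∣ᶻ-combine {p} (mult k refl) (mult l refl) a b refl = mult (a * k + b * l) (e a b k l (+ p))
      where
      e : ∀ a b k l p → a * (p * k) + b * (p * l) ≡ p * (a * k + b * l)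
      e = solve-∀

    ∣ᶻ-*ˡ : ∀ {p x} a → p ∣ᶻ x → p ∣ᶻ a * x
    ∣ᶻ-*ˡ {p} a (mult k refl) = mult (a * k) (e a k (+ p))
      where
      e : ∀ a k p → a * (p * k) ≡ p * (a * k)
      e = solve-∀

    prime∣ᶻ* : ∀ {p} → Prime p → ∀ x y → p ∣ᶻ x * y → p ∣ᶻ x ⊎ p ∣ᶻ y
    prime∣ᶻ* {p} pp x y h with euclidsLemma ∣ x ∣ ∣ y ∣ pp (subst (p ℕ.∣_) (ℤ.abs-* x y) (∣ᶻ⇒∣ h))
    ... | inj₁ h = inj₁ (∣⇒∣ᶻ h)
    ... | inj₂ h = inj₂ (∣⇒∣ᶻ h)

    prime∣ᶻsquare : ∀ {p} → Prime p → ∀ x → p ∣ᶻ x * x → p ∣ᶻ x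
    prime∣ᶻsquare pp x h = [ (λ h → h) , (λ h → h) ]′ (prime∣ᶻ* pp x x h)

    prime∤1 : ∀ {p} → Prime p → ¬ p ∣ᶻ + 1
    prime∤1 pp h with refl ← ℕ.∣1⇒≡1 (∣ᶻ⇒∣ h) = ¬prime[1] pp

    prime∣prime⇒≡ : ∀ {p r} → Prime p → Prime r → p ∣ᶻ + r → p ≡ r
    prime∣prime⇒≡ pp pr h with prime⇒irreducible pr (∣ᶻ⇒∣ h)
    ... | inj₁ refl = ⊥-elim (¬prime[1] pp)
    ... | inj₂ e = e

    prime-divisor : ∀ n → n ≢ 1 → ∃ λ p → Prime p × p ℕ.∣ n
    -- Every prime divides 0, so any prime serves as the answer here.
    prime-divisor zero _ = 2 , prime[2] , 2 ℕ.∣0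
    prime-divisor n@(suc _) n≢1 = from-factors (PrimeFactorisation.factors f) (PrimeFactorisation.isFactorisation f) (PrimeFactorisation.factorsPrime f)
      where
      f : PrimeFactorisation n
      f = factorise n
      from-factors : ∀ ps → n ≡ ℕ.product ps → All Prime ps → ∃ λ p → Prime p × p ℕ.∣ n
      from-factors [] e _ = ⊥-elim (n≢1 e)
      from-factors (p ∷ ps) e (pp All.∷ _) = p , pp , ℕ.divides (ℕ.product ps) (trans e (ℕ.*-comm p (ℕ.product ps)))

  -- No common prime rather than gcd 1: the proofs chase a prime through polynomial identities until
  -- it divides both members of a pair known to be coprime.
  Coprime : ℤ → ℤ → Set
  Coprime x y = ∀ {p} → Prime p → p ∣ᶻ x → p ∣ᶻ y → ⊥

  NonNeg : ℤ → Set
  NonNeg x = ∃ λ n → x ≡ + n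

  opaque
    coprime-swap : ∀ {x y} → Coprime x y → Coprime y x
    coprime-swap c pp h h′ = c pp h′ h

    coprime-0⇒unit : ∀ {x} → Coprime x (+ 0) → ∣ x ∣ ≡ 1
    coprime-0⇒unit {x} c with ∣ x ∣ ℕ.≟ 1
    ... | yes e = e
    ... | no ∣x∣≢1 with prime-divisor ∣ x ∣ ∣x∣≢1
    ...   | p , pp , h = ⊥-elim (c pp (∣⇒∣ᶻ h) (∣⇒∣ᶻ (p ℕ.∣0)))

    ∣i∣≡1⇒i*i≡1 : ∀ x → ∣ x ∣ ≡ 1 → x * x ≡ + 1
    ∣i∣≡1⇒i*i≡1 (+ 1) refl = refl
    ∣i∣≡1⇒i*i≡1 -[1+ 0 ] refl = refl

    square-abs : ∀ x → x * x ≡ + (∣ x ∣ ℕ.* ∣ x ∣)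
    square-abs (+ n) = sym (ℤ.pos-* n n)
    square-abs -[1+ n ] = refl

    -- A nonnegative product excludes strictly opposite signs, and a nonnegative sum excludes the
    -- remaining cases with a negative factor.
    nonNeg-factors : ∀ {U V n s} → U * V ≡ + n → U + V ≡ + s → NonNeg U × NonNeg V
    nonNeg-factors {+ u} {+ v} _ _ = (u , refl) , (v , refl)
    nonNeg-factors { -[1+ u ]} { -[1+ v ]} _ ()
    nonNeg-factors {+ zero} { -[1+ v ]} _ ()
    nonNeg-factors {+ suc u} { -[1+ v ]} () _
    nonNeg-factors { -[1+ u ]} {+ suc v} () _
    nonNeg-factors { -[1+ u ]} {+ zero} _ ()

    nonNeg-cofactor : ∀ {u V n} → + suc u * V ≡ + n → NonNeg V
    nonNeg-cofactor {u} {+ v} _ = v , refl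
    nonNeg-cofactor {u} { -[1+ v ]} ()

    *-zero : ∀ x y → x * y ≡ + 0 → x ≡ + 0 ⊎ y ≡ + 0
    *-zero x y h = ℤ.i*j≡0⇒i≡0∨j≡0 x h

  -- Coprime factors of squares and of fourth powers

  opaque
    xyz≡xzy : ∀ x y z → x ℕ.* y ℕ.* z ≡ x ℕ.* z ℕ.* y
    xyz≡xzy = solve-∀ⁿ

    xy·zz≡xzz·y : ∀ x y z → x ℕ.* y ℕ.* (z ℕ.* z) ≡ x ℕ.* z ℕ.* z ℕ.* y
    xy·zz≡xzz·y = solve-∀ⁿ

    xz·yz≡xyz·z : ∀ x y z → x ℕ.* z ℕ.* (y ℕ.* z) ≡ x ℕ.* y ℕ.* z ℕ.* z
    xz·yz≡xyz·z = solve-∀ⁿ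

    xz·yw≡xy·zw : ∀ x y z w → x ℕ.* z ℕ.* (y ℕ.* w) ≡ x ℕ.* y ℕ.* (z ℕ.* w)
    xz·yw≡xy·zw = solve-∀ⁿ

  -- Induction on u: a prime divisor of u divides k, and then its square divides u because it does not divide v.
  opaque
    square-factor : ∀ n u v k → u ℕ.≤ n → u ℕ.* v ≡ k ℕ.* k → Coprime (+ u) (+ v) → ∃ λ m → u ≡ m ℕ.* m
    square-factor _ zero v k _ _ _ = 0 , refl
    square-factor (suc n) (suc zero) v k _ _ _ = 1 , refl
    square-factor (suc n) u@(suc (suc _)) v k u≤n e c = from-prime (prime-divisor u λ ())
      where
      from-prime : (∃ λ p → Prime p × p ℕ.∣ u) → ∃ λ m → u ≡ m ℕ.* m
      from-prime (p , pp , p∣u@(ℕ.divides u′ u≡u′p)) = descend p∣k p∣u′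
        where
        instance
          p≢0 : ℕ.NonZero p
          p≢0 = prime⇒nonZero pp
        p∤v : ¬ p ℕ.∣ v
        p∤v h = c pp (∣⇒∣ᶻ p∣u) (∣⇒∣ᶻ h)
        p∣k : p ℕ.∣ k
        p∣k = [ (λ h → h) , (λ h → h) ]′ (euclidsLemma k k pp (subst (p ℕ.∣_) e (ℕ.∣m⇒∣m*n v p∣u)))
        p∣u′ : p ℕ.∣ u′
        p∣u′ with euclidsLemma u′ v pp (p∣u′v p∣k)
          where
          p∣u′v : p ℕ.∣ k → p ℕ.∣ u′ ℕ.* v
          p∣u′v (ℕ.divides k′ k≡k′p) = ℕ.divides (k′ ℕ.* k′) (ℕ.*-cancelʳ-≡ _ _ p (begin
            u′ ℕ.* v ℕ.* p               ≡⟨ xyz≡xzy u′ v p ⟩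
            u′ ℕ.* p ℕ.* v               ≡⟨ cong (ℕ._* v) u≡u′p ⟨
            u ℕ.* v                      ≡⟨ e ⟩
            k ℕ.* k                      ≡⟨ cong₂ ℕ._*_ k≡k′p k≡k′p ⟩
            k′ ℕ.* p ℕ.* (k′ ℕ.* p)      ≡⟨ xz·yz≡xyz·z k′ k′ p ⟩
            k′ ℕ.* k′ ℕ.* p ℕ.* p        ∎))
            where
            open ≡-Reasoning
        ... | inj₁ h = h
        ... | inj₂ h = ⊥-elim (p∤v h)
        descend : p ℕ.∣ k → p ℕ.∣ u′ → ∃ λ m → u ≡ m ℕ.* m
        descend (ℕ.divides k′ k≡k′p) (ℕ.divides u″ u′≡u″p) = root (square-factor n u″ v k′ u″≤n e″ c″)
          where
          u≡ : u ≡ u″ ℕ.* p ℕ.* p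
          u≡ = trans u≡u′p (cong (ℕ._* p) u′≡u″p)
          e″ : u″ ℕ.* v ≡ k′ ℕ.* k′
          e″ = ℕ.*-cancelʳ-≡ _ _ (p ℕ.* p) {{ℕ.m*n≢0 p p}} (trans (xy·zz≡xzz·y u″ v p) (trans (cong (ℕ._* v) (sym u≡)) (trans e (trans (cong₂ ℕ._*_ k≡k′p k≡k′p) (xz·yw≡xy·zw k′ k′ p p)))))
          c″ : Coprime (+ u″) (+ v)
          c″ {r} pr h = c pr (∣⇒∣ᶻ {r} {+ u} (subst (r ℕ.∣_) (sym u≡) (ℕ.∣m⇒∣m*n p (ℕ.∣m⇒∣m*n p (∣ᶻ⇒∣ h)))))
          u″≢0 : u″ ≢ 0
          u″≢0 refl with () ← u≡
          2≤p : 2 ℕ.≤ p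
          2≤p = ℕ.nonTrivial⇒n>1 p {{prime⇒nonTrivial pp}}
          u″<u : u″ ℕ.< u
          u″<u = subst (u″ ℕ.<_) (sym u≡) (ℕ.<-≤-trans (ℕ.m<m*n u″ p {{ℕ.≢-nonZero u″≢0}} 2≤p) (ℕ.m≤m*n (u″ ℕ.* p) p))
          u″≤n : u″ ℕ.≤ n
          u″≤n = ℕ.<⇒≤pred (ℕ.<-≤-trans u″<u u≤n)
          root : (∃ λ m → u″ ≡ m ℕ.* m) → ∃ λ m → u ≡ m ℕ.* m
          root (m , u″≡) = m ℕ.* p , trans u≡ (trans (cong (λ x → x ℕ.* p ℕ.* p) u″≡) (sym (xz·yz≡xyz·z m m p)))

    square-injective : ∀ m n → m ℕ.* m ≡ n ℕ.* n → m ≡ n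
    square-injective m n e with ℕ.<-cmp m n
    ... | tri< m<n _ _ = ⊥-elim (ℕ.<⇒≢ (ℕ.*-mono-< m<n m<n) e)
    ... | tri≈ _ m≡n _ = m≡n
    ... | tri> _ _ n<m = ⊥-elim (ℕ.<⇒≢ (ℕ.*-mono-< n<m n<m) (sym e))

    square-factors : ∀ u v k → u ℕ.* v ≡ k ℕ.* k → Coprime (+ u) (+ v) → ∃₂ λ m n → u ≡ m ℕ.* m × v ≡ n ℕ.* n × k ≡ m ℕ.* n
    square-factors u v k e c = combine (square-factor u u v k ℕ.≤-refl e c) (square-factor v v u k ℕ.≤-refl (trans (ℕ.*-comm v u) e) (coprime-swap {+ u} {+ v} c))
      where
      combine : (∃ λ m → u ≡ m ℕ.* m) → (∃ λ n → v ≡ n ℕ.* n) → ∃₂ λ m n → u ≡ m ℕ.* m × v ≡ n ℕ.* n × k ≡ m ℕ.* n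
      combine (m , u≡) (n , v≡) = m , n , u≡ , v≡ , square-injective k (m ℕ.* n) (trans (sym e) (trans (cong₂ ℕ._*_ u≡ v≡) (sym (xz·yw≡xy·zw m m n n))))

  opaque
    i≡±∣i∣ : ∀ z → z ≡ + ∣ z ∣ ⊎ z ≡ - + ∣ z ∣
    i≡±∣i∣ (+ n) = inj₁ refl
    i≡±∣i∣ -[1+ n ] = inj₂ refl

    -- The sign of `z` is put into `a`, so that `b` can be promised nonnegative; this is the source
    -- of the nonnegative `m` in `pythagorean`.
    square-factorsᶻ : ∀ {U V z} → U * V ≡ z * z → NonNeg U → NonNeg V → Coprime U V →
                      ∃₂ λ a b → U ≡ a * a × V ≡ b * b × z ≡ a * b × NonNeg b
    square-factorsᶻ {z = z} e (u , refl) (v , refl) c =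
      lift (square-factors u v ∣ z ∣ (ℤ.+-injective (trans (ℤ.pos-* u v) (trans e (square-abs z)))) c)
      where
      lift : (∃₂ λ m n → u ≡ m ℕ.* m × v ≡ n ℕ.* n × ∣ z ∣ ≡ m ℕ.* n) → ∃₂ λ a b → + u ≡ a * a × + v ≡ b * b × z ≡ a * b × NonNeg b
      lift (m , n , refl , refl , h) = signed (i≡±∣i∣ z)
        where
        ∣z∣≡ : + ∣ z ∣ ≡ + m * + n
        ∣z∣≡ = trans (cong +_ h) (ℤ.pos-* m n)
        signed : z ≡ + ∣ z ∣ ⊎ z ≡ - + ∣ z ∣ → ∃₂ λ a b → + (m ℕ.* m) ≡ a * a × + (n ℕ.* n) ≡ b * b × z ≡ a * b × NonNeg b
        signed (inj₁ e) = + m , + n , ℤ.pos-* m m , ℤ.pos-* n n , trans e ∣z∣≡ , (n , refl)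
        signed (inj₂ e) = - + m , + n , trans (ℤ.pos-* m m) (neg² (+ m)) , ℤ.pos-* n n , trans e (trans (cong -_ ∣z∣≡) (neg-* (+ m) (+ n))) , (n , refl)
          where
          neg² : ∀ x → x * x ≡ - x * - x
          neg² = solve-∀
          neg-* : ∀ x y → - (x * y) ≡ - x * y
          neg-* = solve-∀

    -- The parametrisation of r² + (2 e)² = x²; the hypothesis x = r + 2 f says that x and r have the same parity.
    pythagorean : ∀ {x r e f} → r * r + + 4 * (e * e) ≡ x * x → x ≡ r + + 2 * f → NonNeg x → Coprime r e →
                  ∃₂ λ m n → r ≡ m * m - n * n × e ≡ m * n × x ≡ m * m + n * n × NonNeg m
    pythagorean {x} {r} {e} {f} h refl (s , x≡s) c = finish (square-factorsᶻ {f} {r + f} {e} (trans (ℤ.*-comm f (r + f)) fg≡e²) (proj₂ nonneg) (proj₁ nonneg) (coprime-swap {r + f} {f} coprime))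
      where
      fg≡e² : (r + f) * f ≡ e * e
      fg≡e² = ℤ.*-cancelˡ-≡ (+ 4) ((r + f) * f) (e * e) (combine₁ (- + 1) h (solve (r ∷ e ∷ f ∷ [])))
      sum : (r + f) + f ≡ + s
      sum = trans (rearrange r f) x≡s
        where
        rearrange : ∀ r f → (r + f) + f ≡ r + + 2 * f
        rearrange = solve-∀
      nonneg : NonNeg (r + f) × NonNeg f
      nonneg = nonNeg-factors {r + f} {f} {∣ e ∣ ℕ.* ∣ e ∣} {s} (trans fg≡e² (square-abs e)) sum
      rearrange : ∀ r f → (r + f) * f ≡ (r + f) * f + + 0 * f
      rearrange = solve-∀
      coprime : Coprime (r + f) f
      coprime pp p∣g p∣f = c pp (∣ᶻ-combine p∣g p∣f (+ 1) (- + 1) (solve (r ∷ f ∷ [])))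
        (prime∣ᶻsquare pp e (∣ᶻ-combine p∣f p∣f (r + f) (+ 0) (trans (sym fg≡e²) (rearrange r f))))
      finish : (∃₂ λ n m → f ≡ n * n × r + f ≡ m * m × e ≡ n * m × NonNeg m) →
        ∃₂ λ m n → r ≡ m * m - n * n × e ≡ m * n × r + + 2 * f ≡ m * m + n * n × NonNeg m
      finish (n , m , f≡ , g≡ , e≡ , m≥0) = m , n , combine₂ (+ 1) (- + 1) g≡ f≡ (solve (r ∷ f ∷ m ∷ n ∷ [])) , trans e≡ (ℤ.*-comm n m) , combine₂ (+ 1) (+ 1) g≡ f≡ (solve (r ∷ f ∷ m ∷ n ∷ [])) , m≥0

    -- Only `p = D` needs care: then p² divides D z⁴, and one factor p is left over for z⁴.
    prime-common-factor : ∀ {p D U V z} → Prime p → Prime D → p ∣ᶻ U → p ∣ᶻ V → U * V ≡ + D * (z * z * (z * z)) → p ∣ᶻ z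
    prime-common-factor {p} {D} {U} {V} {z} pp pD p∣U p∣V e = from-D (prime∣ᶻ* pp (+ D) (z * z * (z * z)) (subst (p ∣ᶻ_) e (subst (p ∣ᶻ_) (ℤ.*-comm V U) (∣ᶻ-*ˡ V p∣U))))
      where
      from-fourth : ∀ {p} → Prime p → p ∣ᶻ z * z * (z * z) → p ∣ᶻ z
      from-fourth pp h = prime∣ᶻsquare pp z (prime∣ᶻsquare pp (z * z) h)
      from-D : p ∣ᶻ + D ⊎ p ∣ᶻ z * z * (z * z) → p ∣ᶻ z
      from-D (inj₂ h) = from-fourth pp h
      from-D (inj₁ h) with prime∣prime⇒≡ pp pD h
      ... | refl = both p∣U p∣V
        where
        both : p ∣ᶻ U → p ∣ᶻ V → p ∣ᶻ z
        both (mult u refl) (mult v refl) = from-fourth pp (mult (u * v) (ℤ.*-cancelˡ-≡ (+ p) _ _ {{prime⇒nonZero pp}} (trans (sym e) (rearrange (+ p) u v))))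
          where
          rearrange : ∀ p u v → p * u * (p * v) ≡ p * (p * (u * v))
          rearrange = solve-∀

    fourth-powers : ∀ {u v z} → u ℕ.* v ≡ z ℕ.* z ℕ.* (z ℕ.* z) → Coprime (+ u) (+ v) → ∃₂ λ a b → u ≡ a ℕ.* a ℕ.* (a ℕ.* a) × v ≡ b ℕ.* b ℕ.* (b ℕ.* b) × z ≡ a ℕ.* b
    fourth-powers {u} {v} {z} e c with square-factors u v (z ℕ.* z) e c
    ... | m , n , refl , refl , z²≡mn with square-factors m n z (sym z²≡mn) coprime
      where
      coprime : Coprime (+ m) (+ n)
      coprime {p} pp h h′ = c pp (∣⇒∣ᶻ (ℕ.∣m⇒∣m*n m (∣ᶻ⇒∣ h))) (∣⇒∣ᶻ (ℕ.∣m⇒∣m*n n (∣ᶻ⇒∣ h′)))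
    ... | a , b , refl , refl , z≡ab = a , b , refl , refl , z≡ab

  -- The two alternatives record which factor absorbs the prime `D`. The descent excludes one of
  -- them by a congruence when it uses the difference of `U` and `V`, and treats them alike when it
  -- uses only the sum.
  FourthPowers : ℕ → ℤ → ℤ → ℤ → Set
  FourthPowers D U V z = ∃₂ λ a b → z ≡ a * b × ((U ≡ a * a * (a * a) × V ≡ + D * (b * b * (b * b))) ⊎ (U ≡ + D * (b * b * (b * b)) × V ≡ a * a * (a * a)))

  opaque
    -- The nonnegative sum fixes the signs. The prime `D` divides one of the factors; cancelling it
    -- there leaves coprime naturals with product z⁴.
    fourth-power-factors : ∀ {D U V z s} → Prime D → U * V ≡ + D * (z * z * (z * z)) → U + V ≡ + s → Coprime U V →
      FourthPowers D U V z
    fourth-power-factors {D} {U} {V} {z} {s} pD e sum c =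
      from-nonneg (nonNeg-factors {U} {V} {D ℕ.* (Z ℕ.* Z ℕ.* (Z ℕ.* Z))} {s} (trans e z⁴≡) sum)
      where
      Z : ℕ
      Z = ∣ z ∣
      instance
        D≢0 : ℕ.NonZero D
        D≢0 = prime⇒nonZero pD
      z⁴≡ : + D * (z * z * (z * z)) ≡ + (D ℕ.* (Z ℕ.* Z ℕ.* (Z ℕ.* Z)))
      z⁴≡ = trans (cong (λ x → + D * (x * x)) (square-abs z)) (trans (cong (+ D *_) (sym (ℤ.pos-* (Z ℕ.* Z) (Z ℕ.* Z)))) (sym (ℤ.pos-* D (Z ℕ.* Z ℕ.* (Z ℕ.* Z)))))
      Goal : Set
      Goal = FourthPowers D U V z
      pos⁴ : ∀ a → + (a ℕ.* a ℕ.* (a ℕ.* a)) ≡ (+ a * + a * (+ a * + a))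
      pos⁴ a = trans (ℤ.pos-* (a ℕ.* a) (a ℕ.* a)) (cong₂ _*_ (ℤ.pos-* a a) (ℤ.pos-* a a))
      neg⁴ : ∀ a → (- a) * (- a) * ((- a) * (- a)) ≡ a * a * (a * a)
      neg⁴ = solve-∀
      signed : ∀ a b → Z ≡ a ℕ.* b → ∃ λ a′ → z ≡ a′ * + b × (a′ * a′ * (a′ * a′)) ≡ + (a ℕ.* a ℕ.* (a ℕ.* a))
      signed a b h = go (i≡±∣i∣ z)
        where
        ∣z∣≡ : + Z ≡ + a * + b
        ∣z∣≡ = trans (cong +_ h) (ℤ.pos-* a b)
        neg-* : ∀ x y → - (x * y) ≡ - x * y
        neg-* = solve-∀
        go : z ≡ + ∣ z ∣ ⊎ z ≡ - + ∣ z ∣ → ∃ λ a′ → z ≡ a′ * + b × (a′ * a′ * (a′ * a′)) ≡ + (a ℕ.* a ℕ.* (a ℕ.* a))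
        go (inj₁ e) = + a , trans e ∣z∣≡ , sym (pos⁴ a)
        go (inj₂ e) = - + a , trans e (trans (cong -_ ∣z∣≡) (neg-* (+ a) (+ b))) , trans (neg⁴ (+ a)) (sym (pos⁴ a))
      -- u′ D is the factor divisible by D
      split : ∀ u′ v → u′ ℕ.* D ℕ.* v ≡ D ℕ.* (Z ℕ.* Z ℕ.* (Z ℕ.* Z)) → Coprime (+ (u′ ℕ.* D)) (+ v) →
        ∃₂ λ a b → z ≡ a * b × (+ (u′ ℕ.* D) ≡ + D * (b * b * (b * b)) × + v ≡ (a * a * (a * a)))
      split u′ v h c = from-powers (fourth-powers {v} {u′} {Z} (ℕ.*-cancelˡ-≡ _ _ D (trans (rearrange D u′ v) h)) c′)
        where
        rearrange : ∀ D u v → D ℕ.* (v ℕ.* u) ≡ u ℕ.* D ℕ.* v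
        rearrange = solve-∀ⁿ
        c′ : Coprime (+ v) (+ u′)
        c′ pp h h′ = c pp (∣⇒∣ᶻ (ℕ.∣m⇒∣m*n D (∣ᶻ⇒∣ h′))) h
        from-powers : (∃₂ λ a b → v ≡ a ℕ.* a ℕ.* (a ℕ.* a) × u′ ≡ b ℕ.* b ℕ.* (b ℕ.* b) × Z ≡ a ℕ.* b) → ∃₂ λ a b → z ≡ a * b × (+ (u′ ℕ.* D) ≡ + D * (b * b * (b * b)) × + v ≡ (a * a * (a * a)))
        from-powers (a , b , v≡ , u≡ , Z≡) = let a′ , z≡ , a′⁴≡ = signed a b Z≡ in a′ , + b , z≡ ,
          trans (ℤ.pos-* u′ D) (trans (ℤ.*-comm (+ u′) (+ D)) (cong (+ D *_) (trans (cong +_ u≡) (pos⁴ b)))) , trans (cong +_ v≡) (sym a′⁴≡)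
      from-nonneg : NonNeg U × NonNeg V → Goal
      from-nonneg ((u , refl) , (v , refl)) = either (euclidsLemma u v pD D∣uv)
        where
        uv≡ : u ℕ.* v ≡ D ℕ.* (Z ℕ.* Z ℕ.* (Z ℕ.* Z))
        uv≡ = ℤ.+-injective (trans (ℤ.pos-* u v) (trans e z⁴≡))
        D∣uv : D ℕ.∣ u ℕ.* v
        D∣uv = subst (D ℕ.∣_) (sym uv≡) (ℕ.m∣m*n _)
        either : D ℕ.∣ u ⊎ D ℕ.∣ v → Goal
        either (inj₁ (ℕ.divides u′ refl)) = let a , b , z≡ , U≡ , V≡ = split u′ v uv≡ c in a , b , z≡ , inj₂ (U≡ , V≡)
        either (inj₂ (ℕ.divides v′ refl)) = let a , b , z≡ , V≡ , U≡ = split v′ u (trans (ℕ.*-comm (v′ ℕ.* D) u) uv≡) (coprime-swap {+ u} {+ (v′ ℕ.* D)} c) in a , b , z≡ , inj₁ (U≡ , V≡)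

  -- Parity, residues modulo 4, and the measure of the descent

  Even Odd : ℤ → Set
  Even z = ∃ λ k → z ≡ + 2 * k
  Odd z = ∃ λ k → z ≡ + 1 + + 2 * k

  prime[3] : Prime 3
  prime[3] = from-yes (prime? 3)

  prime[5] : Prime 5
  prime[5] = from-yes (prime? 5)

  opaque
    even∧odd⇒⊥ : ∀ {z} → Even z → Odd z → ⊥
    even∧odd⇒⊥ {z} (k , e) (l , e′) = prime∤1 prime[2] (mult (k - l) (combine₂ (+ 1) (- + 1) e e′ (solve (z ∷ k ∷ l ∷ []))))

    even-*ʳ : ∀ {x} → Even x → ∀ y → Even (x * y)
    even-*ʳ (k , refl) y = k * y , solve (k ∷ y ∷ [])

    even-*ˡ : ∀ x {y} → Even y → Even (x * y)
    even-*ˡ x (k , refl) = x * k , solve (k ∷ x ∷ [])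

    even-+ : ∀ {x y} → Even x → Even y → Even (x + y)
    even-+ (k , refl) (l , refl) = k + l , solve (k ∷ l ∷ [])

    even-neg : ∀ {x} → Even x → Even (- x)
    even-neg (k , refl) = - k , solve (k ∷ [])

    odd-* : ∀ {x y} → Odd x → Odd y → Odd (x * y)
    odd-* (k , refl) (l , refl) = k + l + + 2 * (k * l) , solve (k ∷ l ∷ [])

    odd-+ : ∀ {x y} → Odd x → Even y → Odd (x + y)
    odd-+ (k , refl) (l , refl) = k + l , solve (k ∷ l ∷ [])

    odd-neg : ∀ {x} → Odd x → Odd (- x)
    odd-neg (k , refl) = - k - + 1 , solve (k ∷ [])

    odd+odd : ∀ {x y} → Odd x → Odd y → Even (x + y)
    odd+odd (k , refl) (l , refl) = + 1 + k + l , solve (k ∷ l ∷ [])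

    even-2* : ∀ x → Even (+ 2 * x)
    even-2* x = x , refl

    parity : ∀ z → Even z ⊎ Odd z
    parity z = from-remainder (z ℤ.%ℕ 2) (z ℤ./ℕ 2) (ℤ.n%ℕd<d z 2) (ℤ.a≡a%ℕn+[a/ℕn]*n z 2)
      where
      from-remainder : ∀ r k → r ℕ.< 2 → z ≡ + r + k * + 2 → Even z ⊎ Odd z
      from-remainder 0 k _ e = inj₁ (k , trans e (solve (k ∷ [])))
      from-remainder 1 k _ e = inj₂ (k , trans e (solve (k ∷ [])))
      from-remainder (suc (suc _)) _ (ℕ.s≤s (ℕ.s≤s ())) _

    odd-root : ∀ x → Odd (x * x) → Odd x
    odd-root x o = [ (λ e → ⊥-elim (even∧odd⇒⊥ (even-*ʳ e x) o)) , (λ o → o) ]′ (parity x)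

    odd-factors : ∀ a b → Odd (a * b) → Odd a × Odd b
    odd-factors a b o =
      [ (λ e → ⊥-elim (even∧odd⇒⊥ (even-*ʳ e b) o)) , (λ o → o) ]′ (parity a) ,
      [ (λ e → ⊥-elim (even∧odd⇒⊥ (even-*ˡ a e) o)) , (λ o → o) ]′ (parity b)

    odd-square : ∀ {x} → Odd x → ∃ λ k → x * x ≡ + 1 + + 4 * k
    odd-square (k , refl) = k * k + k , solve (k ∷ [])

    1≢3[4] : ∀ k l → + 1 + + 4 * k ≢ + 3 + + 4 * l
    1≢3[4] k l e = even∧odd⇒⊥ {+ 2 * (k - l)} (k - l , refl) (+ 0 , ℤ.*-cancelˡ-≡ (+ 2) (+ 2 * (k - l)) (+ 1) (combine₁ (+ 1) e (solve (k ∷ l ∷ []))))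

    2∣⇒even : ∀ {x} → 2 ∣ᶻ x → Even x
    2∣⇒even (mult k e) = k , e

    -- A prime divisor of the odd `y` is not 2, so it passes from 2 x to x.
    coprime-odd-multiple : ∀ {p} x y → Prime p → Odd y → p ∣ᶻ y → p ∣ᶻ + 2 * x → p ∣ᶻ x
    coprime-odd-multiple {p} x y pp oy p∣y h = [ (λ h → ⊥-elim (absurd h)) , (λ h → h) ]′ (prime∣ᶻ* pp (+ 2) x h)
      where
      absurd : p ∣ᶻ + 2 → ⊥
      absurd h = even∧odd⇒⊥ (2∣⇒even (subst (_∣ᶻ y) (prime∣prime⇒≡ pp prime[2] h) p∣y)) oy

    nonNeg-square : ∀ x → NonNeg (x * x)
    nonNeg-square x = ∣ x ∣ ℕ.* ∣ x ∣ , square-abs x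

    nonNeg-+ : ∀ {x y} → NonNeg x → NonNeg y → NonNeg (x + y)
    nonNeg-+ (m , refl) (n , refl) = m ℕ.+ n , refl

    nonNeg-* : ∀ n {y} → NonNeg y → NonNeg (+ n * y)
    nonNeg-* n (m , refl) = n ℕ.* m , sym (ℤ.pos-* n m)

    ∣i∣*∣i∣≡i*i : ∀ x → + ∣ x ∣ * + ∣ x ∣ ≡ x * x
    ∣i∣*∣i∣≡i*i x = trans (sym (ℤ.pos-* (∣ x ∣) (∣ x ∣))) (sym (square-abs x))

    -- The absolute values absorb a common negative sign of m and n.
    square-factors-abs : ∀ {m n b} → m * n ≡ b * b → Coprime m n →
      ∃₂ λ c d → m * m ≡ (c * c * (c * c)) × n * n ≡ (d * d * (d * d)) × b ≡ c * d
    square-factors-abs {m} {n} {b} e cop = from-roots (square-factorsᶻ {+ ∣ m ∣} {+ ∣ n ∣} {b} ∣m∣∣n∣≡ (_ , refl) (_ , refl) (λ pp h h′ → cop pp (∣⇒∣ᶻ (∣ᶻ⇒∣ h)) (∣⇒∣ᶻ (∣ᶻ⇒∣ h′))))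
      where
      ∣m∣∣n∣≡ : + ∣ m ∣ * + ∣ n ∣ ≡ b * b
      ∣m∣∣n∣≡ = trans (sym (ℤ.pos-* (∣ m ∣) (∣ n ∣))) (trans (cong +_ (sym (ℤ.abs-* m n))) (trans (cong (λ x → + ∣ x ∣) e) (trans (cong +_ (ℤ.abs-* b b)) (sym (square-abs b)))))
      from-roots : (∃₂ λ c d → + ∣ m ∣ ≡ c * c × + ∣ n ∣ ≡ d * d × b ≡ c * d × NonNeg d) → ∃₂ λ c d → m * m ≡ (c * c * (c * c)) × n * n ≡ (d * d * (d * d)) × b ≡ c * d
      from-roots (c , d , m≡ , n≡ , b≡ , _) = c , d , trans (sym (∣i∣*∣i∣≡i*i m)) (cong₂ _*_ m≡ m≡) , trans (sym (∣i∣*∣i∣≡i*i n)) (cong₂ _*_ n≡ n≡) , b≡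

    *-square-1 : ∀ {y a b} → y ≡ a * b → a * a ≡ + 1 → b * b ≡ + 1 → y * y ≡ + 1
    *-square-1 {_} {a} {b} refl ha hb = combine₂ (b * b) (+ 1) ha hb (solve (a ∷ b ∷ []))

    -- The descent is measured by the second coordinate. It fails to decrease only if `a` and `c`
    -- are units, and then the quartic becomes an equation in `d` alone, which needs no induction.
    smaller : ∀ {y a c d} → y ≢ + 0 → y ≡ a * (c * d) → (∣ d ∣ ℕ.< ∣ y ∣) ⊎ (a * a ≡ + 1 × c * c ≡ + 1)
    smaller {_} {a} {c} {d} y≢0 refl with ∣ a ∣ ℕ.* ∣ c ∣ ℕ.≟ 1
    ... | yes e = inj₂ (∣i∣≡1⇒i*i≡1 a (ℕ.m*n≡1⇒m≡1 (∣ a ∣) (∣ c ∣) e) , ∣i∣≡1⇒i*i≡1 c (ℕ.m*n≡1⇒n≡1 (∣ a ∣) (∣ c ∣) e))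
    ... | no ac≢1 = inj₁ (subst (∣ d ∣ ℕ.<_) (trans (ℕ.*-comm (∣ d ∣) (∣ a ∣ ℕ.* ∣ c ∣)) size) (ℕ.m<m*n (∣ d ∣) (∣ a ∣ ℕ.* ∣ c ∣) {{ℕ.≢-nonZero d≢0}} 1<ac))
      where
      size : ∣ a ∣ ℕ.* ∣ c ∣ ℕ.* ∣ d ∣ ≡ ∣ a * (c * d) ∣
      size = trans (ℕ.*-assoc (∣ a ∣) (∣ c ∣) (∣ d ∣)) (sym (trans (ℤ.abs-* a (c * d)) (cong (∣ a ∣ ℕ.*_) (ℤ.abs-* c d))))
      ∣y∣≢0 : ∣ a ∣ ℕ.* ∣ c ∣ ℕ.* ∣ d ∣ ≢ 0
      ∣y∣≢0 e = y≢0 (ℤ.∣i∣≡0⇒i≡0 (trans (sym size) e))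
      d≢0 : ∣ d ∣ ≢ 0
      d≢0 e = ∣y∣≢0 (trans (cong (∣ a ∣ ℕ.* ∣ c ∣ ℕ.*_) e) (ℕ.*-zeroʳ (∣ a ∣ ℕ.* ∣ c ∣)))
      ac≢0 : ∣ a ∣ ℕ.* ∣ c ∣ ≢ 0
      ac≢0 e = ∣y∣≢0 (cong (ℕ._* ∣ d ∣) e)
      1<ac : 1 ℕ.< ∣ a ∣ ℕ.* ∣ c ∣
      1<ac = ℕ.≤∧≢⇒< (ℕ.n≢0⇒n>0 ac≢0) (λ e → ac≢1 (sym e))

    smaller₂ : ∀ {y a c d} → y ≢ + 0 → y ≡ + 2 * (a * (c * d)) → ∣ d ∣ ℕ.< ∣ y ∣
    smaller₂ {_} {a} {c} {d} y≢0 refl = [ (λ h → h) , (λ (2²≡1 , _) → ⊥-elim (absurd 2²≡1)) ]′ (smaller {+ 2 * (a * (c * d))} {+ 2} {a * c} {d} y≢0 (cong (+ 2 *_) (sym (ℤ.*-assoc a c d))))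
      where
      absurd : + 4 ≢ + 1
      absurd ()

  -- The quartic equation and its factorisations

  Quartic : ℤ → ℤ → ℤ → ℤ → Set
  Quartic t x y w = x * x * (x * x) + t * (y * y * (y * y)) ≡ w * w + t * (x * x * (y * y))

  -- One step of the descent turns a solution (x , y , w) into the solution (c , d , a).
  OddStep EvenStep : ℤ → ℤ → ℤ → Set
  OddStep t x y = ∃ λ a → ∃₂ λ c d → y ≡ a * (c * d) × Quartic t c d a × Coprime c d × (c * c ≡ + 1 → d * d ≡ + 1 → x * x ≡ + 1 × y * y ≡ + 1)
  EvenStep t x y = ∃ λ a → ∃₂ λ c d → y ≡ + 2 * (a * (c * d)) × Quartic t c d a × Coprime c d × (c * c ≡ + 1 → d * d ≡ + 1 → ⊥)

  opaque
    -- Rewritten, w² = x⁴ + t y² (y² - x²), and y² (y² - x²) is even for either parity of `y` when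
    -- `x` is odd.
    quartic-odd-w : ∀ {t x y w} → Odd x → Even y ⊎ Odd y → Quartic t x y w → Odd w
    quartic-odd-w {t} {x} {y} {w} ox py h = odd-root w (subst Odd e (odd-+ (odd-* (odd-* ox ox) (odd-* ox ox)) (even-*ˡ t (product py))))
      where
      product : Even y ⊎ Odd y → Even (y * y * (y * y + - (x * x)))
      product (inj₁ ey) = even-*ʳ (even-*ʳ ey y) _
      product (inj₂ oy) = even-*ˡ (y * y) (odd+odd (odd-* oy oy) (odd-neg (odd-* ox ox)))
      e : x * x * (x * x) + t * (y * y * (y * y + - (x * x))) ≡ w * w
      e = combine₁ (+ 1) h (solve (t ∷ x ∷ y ∷ w ∷ []))

    quartic-1 : ∀ {t c d a} → Quartic t c d a → c * c ≡ + 1 → d * d ≡ + 1 → a * a ≡ + 1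
    quartic-1 {t} {c} {d} {a} h hc hd = combine₃ (- + 1) (c * c + + 1 - t * (d * d)) (t * (d * d)) h hc hd (solve (t ∷ c ∷ d ∷ a ∷ []))

    mod-4-a-odd : ∀ m a b x K A → x * x ≡ + 1 + + 4 * K → a * a ≡ + 1 + + 4 * A →
      -- The long argument of `1≢3[4]` below is the quotient by 4 of the right side less 3, after a²
      -- has been replaced by 1 + 4 A.
      x * x ≢ + 3 * (+ 2 * b * (+ 2 * b) * (+ 2 * b * (+ 2 * b))) - a * a * (a * a) + + 2 * m * (a * a * (+ 2 * b * (+ 2 * b)))
    mod-4-a-odd m a b x K A hx ha h = 1≢3[4] K (+ 12 * (b * b * (b * b)) - + 1 - + 2 * A - + 4 * (A * A) + + 2 * m * ((+ 1 + + 4 * A) * (b * b)))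
      (combine₃ (- + 1) (+ 1) (- (a * a + + 1 + + 4 * A) + + 8 * m * (b * b)) hx h ha (solve (m ∷ a ∷ b ∷ x ∷ K ∷ A ∷ [])))

    mod-4-b-odd : ∀ m a b x K B → x * x ≡ + 1 + + 4 * K → b * b ≡ + 1 + + 4 * B →
      x * x ≢ + 3 * (b * b * (b * b)) - + 2 * a * (+ 2 * a) * (+ 2 * a * (+ 2 * a)) + + 2 * m * (+ 2 * a * (+ 2 * a) * (b * b))
    mod-4-b-odd m a b x K B hx hb h = 1≢3[4] K (+ 6 * B + + 12 * (B * B) - + 4 * (a * a * (a * a)) + + 2 * m * (a * a * (+ 1 + + 4 * B)))
      (combine₃ (- + 1) (+ 1) (+ 3 * (b * b + + 1 + + 4 * B) + + 8 * m * (a * a)) hx h hb (solve (m ∷ a ∷ b ∷ x ∷ K ∷ B ∷ [])))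

    -- The oddness hypothesis leaves exactly one of `a` and `b` odd. The right side is then -1 or 3
    -- modulo 4, which is the same residue, and no odd square has it.
    no-square-mod-4 : ∀ m a b x → Odd x → Odd (a * a * (a * a) + + 3 * (b * b * (b * b))) →
      x * x ≢ + 3 * (b * b * (b * b)) - a * a * (a * a) + + 2 * m * (a * a * (b * b))
    no-square-mod-4 m a b x ox o h = cases (parity a) (parity b) h
      where
      cases : Even a ⊎ Odd a → Even b ⊎ Odd b → x * x ≢ + 3 * (b * b * (b * b)) - a * a * (a * a) + + 2 * m * (a * a * (b * b))
      cases (inj₁ ea) (inj₁ eb) _ = even∧odd⇒⊥ (even-+ (even-*ʳ (even-*ʳ ea a) (a * a)) (even-*ˡ (+ 3) (even-*ʳ (even-*ʳ eb b) (b * b)))) o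
      cases (inj₂ oa) (inj₂ ob) _ = even∧odd⇒⊥ (odd+odd (odd-* (odd-* oa oa) (odd-* oa oa)) (odd-* (+ 1 , refl) (odd-* (odd-* ob ob) (odd-* ob ob)))) o
      cases (inj₂ oa) (inj₁ (b′ , refl)) h = let K , hx = odd-square ox ; A , ha = odd-square oa in mod-4-a-odd m a b′ x K A hx ha h
      cases (inj₁ (a′ , refl)) (inj₂ ob) h = let K , hx = odd-square ox ; B , hb = odd-square ob in mod-4-b-odd m a′ b x K B hx hb h

    ∣ᶻ-fourth : ∀ {p c u} D → p ∣ᶻ c → u ≡ D * (c * c * (c * c)) → p ∣ᶻ u
    ∣ᶻ-fourth {p} {c} D h refl = ∣ᶻ-combine h h (D * (c * c * c)) (+ 0) (solve (D ∷ c ∷ []))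

    coprime-fourth-roots : ∀ {U V c d} D E → U ≡ D * (c * c * (c * c)) → V ≡ E * (d * d * (d * d)) → Coprime U V → Coprime c d
    coprime-fourth-roots D E hU hV cop pp p∣c p∣d = cop pp (∣ᶻ-fourth D p∣c hU) (∣ᶻ-fourth E p∣d hV)

    -- Here the descent for t = 3 closes up: the two factors are c⁴ and 3 d⁴ in some order with b =
    -- c d, and the prescribed sum then reads c⁴ + 3 d⁴ = a² + 3 c² d².
    quartic-from-factors₃ : ∀ {U V a b} → U * V ≡ + 3 * (b * b * (b * b)) → U + V ≡ a * a + + 3 * (b * b) → Coprime U V →
      ∃₂ λ c d → b ≡ c * d × Quartic (+ 3) c d a × Coprime c d × U + V ≡ c * c * (c * c) + + 3 * (d * d * (d * d))
    quartic-from-factors₃ {U} {V} {a} {b} e sum cop =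
      from-powers (fourth-power-factors {3} {U} {V} {b} prime[3] e (trans sum (proj₂ (nonNeg-+ (nonNeg-square a) (nonNeg-* 3 (nonNeg-square b))))) cop)
      where
      one* : ∀ x → x ≡ + 1 * x
      one* x = sym (ℤ.*-identityˡ x)
      from-powers : FourthPowers 3 U V b → ∃₂ λ c d → b ≡ c * d × Quartic (+ 3) c d a × Coprime c d × U + V ≡ c * c * (c * c) + + 3 * (d * d * (d * d))
      from-powers (c , d , refl , inj₁ (U≡ , V≡)) = c , d , refl , combine₃ (+ 1) (- + 1) (- + 1) sum U≡ V≡ (solve (U ∷ V ∷ a ∷ c ∷ d ∷ [])) ,
        coprime-fourth-roots (+ 1) (+ 3) (trans U≡ (one* _)) V≡ cop , cong₂ _+_ U≡ V≡
      from-powers (c , d , refl , inj₂ (U≡ , V≡)) = c , d , refl , combine₃ (+ 1) (- + 1) (- + 1) sum U≡ V≡ (solve (U ∷ V ∷ a ∷ c ∷ d ∷ [])) ,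
        coprime-swap {d} {c} (coprime-fourth-roots (+ 3) (+ 1) U≡ (trans V≡ (one* _)) cop) , trans (ℤ.+-comm U V) (cong₂ _+_ V≡ U≡)

    -- `f` and `g` are the halves of w ∓ (x² - 2 t y²). Completing the square in the quartic leaves
    -- the negated discriminant t (4 - t) as coefficient of y⁴.
    half-product : ∀ t x y w f g → Quartic t x (+ 2 * y) w → w + - (x * x + - (+ 2 * t * (y * y))) ≡ + 2 * f → g ≡ f + (x * x - + 2 * t * (y * y)) →
      f * g ≡ t * (+ 4 - t) * (y * y * (y * y))
    half-product t x y w f g h hf hg = ℤ.*-cancelˡ-≡ (+ 4) (f * g) (t * (+ 4 - t) * (y * y * (y * y)))
      (combine₃ (- + 1) (- (w + + 2 * f + (x * x - + 2 * t * (y * y)))) (+ 4 * f) h hf hg (solve (t ∷ w ∷ x ∷ y ∷ f ∷ g ∷ [])))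

    half-sum : ∀ w E f g → w + - E ≡ + 2 * f → g ≡ f + E → f + g ≡ w
    half-sum w E f g hf hg = combine₂ (+ 1) (- + 1) hg hf (solve (w ∷ E ∷ f ∷ g ∷ []))

    half-difference : ∀ t x y f g → g ≡ f + (x * x - + 2 * t * (y * y)) → x * x ≡ + 1 * (+ 1 * g + - + 1 * f) + + 2 * t * y * y
    half-difference t x y f g hg = combine₁ (- + 1) hg (solve (t ∷ x ∷ y ∷ f ∷ g ∷ []))

    x²-from-factors : ∀ t x y f g a b F G → g ≡ f + (x * x - + 2 * t * (y * y)) → f ≡ F → g ≡ G → y ≡ a * b → x * x ≡ G - F + + 2 * t * (a * a * (b * b))
    x²-from-factors t x _ _ _ a b F G hg refl refl refl = combine₁ (- + 1) hg (solve (t ∷ x ∷ a ∷ b ∷ F ∷ G ∷ []))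

    -- (w - (x² - 2 t y²)) (w + (x² - 2 t y²)) = 4 t (4 - t) y⁴, where t (4 - t) = 3 for t = 1 and for t = 3.
    even-factorisation : ∀ t {x y w} → t * (+ 4 - t) ≡ + 3 → Odd x → NonNeg w → Coprime x (+ 2 * y) → Quartic t x (+ 2 * y) w →
      ∃₂ λ a b → y ≡ a * b × x * x ≡ a * a * (a * a) - + 3 * (b * b * (b * b)) + + 2 * t * (a * a * (b * b))
    even-factorisation t {x} {y} {w} t[4-t]≡3 ox (s , w≡s) cop h =
      let f , hf = odd+odd ow (odd-neg (odd-+ (odd-* ox ox) (even-neg (even-*ʳ (even-*ʳ (even-2* (+ 1)) t) (y * y))))) in factors f _ hf refl
      where
      ow : Odd w
      ow = quartic-odd-w {t} {x} {+ 2 * y} ox (inj₁ (y , refl)) h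
      Factored : Set
      Factored = ∃₂ λ a b → y ≡ a * b × x * x ≡ a * a * (a * a) - + 3 * (b * b * (b * b)) + + 2 * t * (a * a * (b * b))
      factors : ∀ f g → w + - (x * x + - (+ 2 * t * (y * y))) ≡ + 2 * f → g ≡ f + (x * x - + 2 * t * (y * y)) → Factored
      factors f g hf hg = from-powers (fourth-power-factors {3} {f} {g} {y} {s} prime[3] fg≡3y⁴ (trans f+g≡w w≡s) coprime)
        where
        fg≡3y⁴ : f * g ≡ + 3 * (y * y * (y * y))
        fg≡3y⁴ = trans (half-product t x y w f g h hf hg) (cong (_* (y * y * (y * y))) t[4-t]≡3)
        f+g≡w : f + g ≡ w
        f+g≡w = half-sum w (x * x - + 2 * t * (y * y)) f g hf hg
        coprime : Coprime f g
        coprime {p} pp p∣f p∣g = cop pp (prime∣ᶻsquare pp x (∣ᶻ-combine (∣ᶻ-combine p∣g p∣f (+ 1) (- + 1) refl) p∣y (+ 1) (+ 2 * t * y) (half-difference t x y f g hg))) (∣ᶻ-*ˡ (+ 2) p∣y)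
          where
          p∣y : p ∣ᶻ y
          p∣y = prime-common-factor {p} {3} {f} {g} {y} pp prime[3] p∣f p∣g fg≡3y⁴
        from-powers : FourthPowers 3 f g y → Factored
        -- Since x² = g - f + 2 t y², the choice f = a⁴, g = 3 b⁴ would make the odd square x²
        -- congruent to 3 modulo 4.
        from-powers (a , b , y≡ , inj₁ (f≡ , g≡)) = ⊥-elim (no-square-mod-4 t a b x ox (subst Odd (trans (sym f+g≡w) (cong₂ _+_ f≡ g≡)) ow) (x²-from-factors t x y f g a b _ _ hg f≡ g≡ y≡))
        from-powers (a , b , y≡ , inj₂ (f≡ , g≡)) = a , b , y≡ , x²-from-factors t x y f g a b _ _ hg f≡ g≡ y≡

    -- The two descent steps for t = 3

    complete-square₃ : ∀ a b x → x * x ≡ a * a * (a * a) - + 3 * (b * b * (b * b)) + + 2 * + 3 * (a * a * (b * b)) →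
      x * x + + 12 * (b * b * (b * b)) ≡ (a * a + + 3 * (b * b)) * (a * a + + 3 * (b * b))
    complete-square₃ a b x h = combine₁ (+ 1) h (solve (a ∷ b ∷ x ∷ []))

    product₃ : ∀ b h₀ x f → x * x + + 12 * (b * b * (b * b)) ≡ h₀ * h₀ → h₀ + - x ≡ + 2 * f → f * (f + x) ≡ + 3 * (b * b * (b * b))
    product₃ b h₀ x f hh hf = ℤ.*-cancelˡ-≡ (+ 4) (f * (f + x)) (+ 3 * (b * b * (b * b)))
      (combine₂ (- + 1) (- (h₀ + + 2 * f + x)) hh hf (solve (h₀ ∷ x ∷ f ∷ b ∷ [])))

    -- Two factorisations in turn, one for the 2-isogeny and one for its dual: the outcome of
    -- `even-factorisation` completes to h₀² - x² = 12 b⁴, and the halves of h₀ ∓ x have product 3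
    -- b⁴ and sum a² + 3 b².
    even-step₃ : ∀ {x y w} → Odd x → Even y → NonNeg w → Coprime x y → Quartic (+ 3) x y w → EvenStep (+ 3) x y
    even-step₃ {x} {_} {w} ox (y , refl) w≥0 cop h =
      let a , b , y≡ , hx = even-factorisation (+ 3) {x} {y} {w} refl ox w≥0 cop h in second a b (a * a + + 3 * (b * b)) y≡ refl (complete-square₃ a b x hx)
      where
      Step : Set
      Step = EvenStep (+ 3) x (+ 2 * y)
      second : ∀ a b h₀ → y ≡ a * b → h₀ ≡ a * a + + 3 * (b * b) → x * x + + 12 * (b * b * (b * b)) ≡ h₀ * h₀ → Step
      second a b h₀ y≡ h₀≡S hh = halves (odd+odd oh₀ (odd-neg ox))
        where
        oh₀ : Odd h₀
        oh₀ = odd-root h₀ (subst Odd hh (odd-+ (odd-* ox ox) (even-*ʳ (+ 6 , refl) _)))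
        pack : ∀ f g → h₀ ≡ f + g → (∃₂ λ c d → b ≡ c * d × Quartic (+ 3) c d a × Coprime c d × f + g ≡ c * c * (c * c) + + 3 * (d * d * (d * d))) → Step
        pack f g h₀≡f+g (c , d , b≡ , qu , cop′ , sum) = a , c , d , trans (cong (+ 2 *_) y≡) (cong (λ b → + 2 * (a * b)) b≡) , qu , cop′ ,
          -- If c² = d² = 1, then h₀ = c⁴ + 3 d⁴ = 4, although h₀ is odd.
          λ hc hd → even∧odd⇒⊥ {h₀} (+ 2 , trans h₀≡f+g (trans sum (combine₂ (c * c + + 1) (+ 3 * (d * d + + 1)) hc hd (solve (c ∷ d ∷ []))))) oh₀
        halves : Even (h₀ + - x) → Step
        halves (f , hf) = pack f (f + x) h₀≡f+g (quartic-from-factors₃ {f} {f + x} {a} {b} product (trans (sym h₀≡f+g) h₀≡S) cop′)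
          where
          h₀≡f+g : h₀ ≡ f + (f + x)
          h₀≡f+g = combine₁ (+ 1) hf (solve (h₀ ∷ x ∷ f ∷ []))
          product : f * (f + x) ≡ + 3 * (b * b * (b * b))
          product = product₃ b h₀ x f hh hf
          cop′ : Coprime f (f + x)
          cop′ {p} pp p∣f p∣g = cop pp (∣ᶻ-combine p∣g p∣f (+ 1) (- + 1) (solve (x ∷ f ∷ []))) (∣ᶻ-*ˡ (+ 2) (subst (p ∣ᶻ_) (sym y≡) (∣ᶻ-*ˡ a (prime-common-factor {p} {3} {f} {f + x} {b} pp prime[3] p∣f p∣g product))))

  opaque
    coprime-odd-double : ∀ {p} x y → Prime p → Odd y → p ∣ᶻ y → p ∣ᶻ + 4 * (x * x) → p ∣ᶻ x
    coprime-odd-double {p} x y pp oy p∣y h = prime∣ᶻsquare pp x (coprime-odd-multiple (x * x) y pp oy p∣y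
      (coprime-odd-multiple (+ 2 * (x * x)) y pp oy p∣y (subst (p ∣ᶻ_) (rearrange x) h)))
      where
      rearrange : ∀ x → + 4 * (x * x) ≡ + 2 * (+ 2 * (x * x))
      rearrange = solve-∀

    x²-from-odd-factors : ∀ x y w U V a b F G → y ≡ a * b → U ≡ F → V ≡ G →
      U ≡ + 2 * w - + 2 * (x * x) + + 3 * (y * y) → V ≡ + 2 * w + + 2 * (x * x) - + 3 * (y * y) → + 4 * (x * x) ≡ G - F + + 6 * (a * a * (b * b))
    x²-from-odd-factors x _ w _ _ a b F G refl refl refl hU hV = combine₂ (- + 1) (+ 1) hV hU (solve (x ∷ w ∷ a ∷ b ∷ F ∷ G ∷ []))

    -- With all squares congruent to 1 modulo 4, the right side is divisible by 8, while 4 x² is 4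
    -- modulo 8.
    odd-triple⇒⊥ : ∀ x a b → (∃ λ K → x * x ≡ + 1 + + 4 * K) → (∃ λ A → a * a ≡ + 1 + + 4 * A) → (∃ λ B → b * b ≡ + 1 + + 4 * B) →
      + 4 * (x * x) ≢ + 3 * (b * b * (b * b)) - a * a * (a * a) + + 6 * (a * a * (b * b))
    odd-triple⇒⊥ x a b (K , hx) (A , ha) (B , hb) h = even∧odd⇒⊥ {+ 1 + + 4 * K}
      (+ 1 + + 6 * B + + 6 * (B * B) + + 2 * A - + 2 * (A * A) + + 12 * (A * B) ,
        ℤ.*-cancelˡ-≡ (+ 4) (+ 1 + + 4 * K) (+ 2 * (+ 1 + + 6 * B + + 6 * (B * B) + + 2 * A - + 2 * (A * A) + + 12 * (A * B)))
          (combine₄ (- + 4) (+ 1) (- (a * a + + 1 + + 4 * A) + + 6 * (b * b)) (+ 3 * (b * b + + 1 + + 4 * B) + + 6 * (+ 1 + + 4 * A)) hx h ha hb (solve (x ∷ a ∷ b ∷ K ∷ A ∷ B ∷ []))))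
      (+ 2 * K , cong (λ z → + 1 + z) (ℤ.*-assoc (+ 2) (+ 2) K))

    -- The first hypothesis says (2 x)² = (a² + 3 b²)² - 12 b⁴, and a² + 3 b² = 2 f, so a factor 4
    -- cancels.
    product-odd₃ : ∀ x a b f → + 4 * (x * x) ≡ a * a * (a * a) - + 3 * (b * b * (b * b)) + + 6 * (a * a * (b * b)) → a * a + + 3 * (b * b) ≡ + 2 * f →
      (f - x) * (f + x) ≡ + 3 * (b * b * (b * b))
    product-odd₃ x a b f hh hf = ℤ.*-cancelˡ-≡ (+ 4) ((f - x) * (f + x)) (+ 3 * (b * b * (b * b)))
      (combine₂ (- (a * a + + 3 * (b * b) + + 2 * f)) (- + 1) hf hh (solve (x ∷ a ∷ b ∷ f ∷ [])))

    unit-odd₃ : ∀ x a b → + 4 * (x * x) ≡ a * a * (a * a) - + 3 * (b * b * (b * b)) + + 6 * (a * a * (b * b)) → a * a ≡ + 1 → b * b ≡ + 1 → x * x ≡ + 1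
    unit-odd₃ x a b hh ha hb = ℤ.*-cancelˡ-≡ (+ 4) (x * x) (+ 1) (combine₃ (+ 1) (a * a + + 1 + + 6 * (b * b)) (- (+ 3 * (b * b + + 1)) + + 6) hh ha hb (solve (x ∷ a ∷ b ∷ [])))

    -- For odd `y` the square is completed after multiplication by 4: 4 w² - (2 x² - 3 y²)² = 3 y⁴.
    product-UV₃ : ∀ x y w U V → Quartic (+ 3) x y w → U ≡ + 2 * w - + 2 * (x * x) + + 3 * (y * y) → V ≡ + 2 * w + + 2 * (x * x) - + 3 * (y * y) →
      U * V ≡ + 3 * (y * y * (y * y))
    product-UV₃ x y w U V h hU hV = combine₃ V (+ 2 * w - + 2 * (x * x) + + 3 * (y * y)) (- + 4) hU hV h (solve (x ∷ y ∷ w ∷ U ∷ V ∷ []))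

    odd-step₃ : ∀ {x y w} → Odd x → Odd y → NonNeg w → Coprime x y → Quartic (+ 3) x y w → OddStep (+ 3) x y
    odd-step₃ {x} {y} {w} ox oy (s , w≡s) cop h = factors _ _ refl refl
      where
      Step : Set
      Step = OddStep (+ 3) x y
      finish : ∀ a b f → y ≡ a * b → + 4 * (x * x) ≡ a * a * (a * a) - + 3 * (b * b * (b * b)) + + 6 * (a * a * (b * b)) → a * a + + 3 * (b * b) ≡ + 2 * f → Step
      finish a b f y≡ hh hf = pack (quartic-from-factors₃ {f - x} {f + x} {a} {b} product sum coprime)
        where
        product : (f - x) * (f + x) ≡ + 3 * (b * b * (b * b))
        product = product-odd₃ x a b f hh hf
        sum : f - x + (f + x) ≡ a * a + + 3 * (b * b)
        sum = combine₁ (- + 1) hf (solve (x ∷ a ∷ b ∷ f ∷ []))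
        coprime : Coprime (f - x) (f + x)
        coprime {p} pp p∣U p∣V = cop pp (coprime-odd-multiple x y pp oy p∣y (∣ᶻ-combine p∣V p∣U (+ 1) (- + 1) (solve (x ∷ f ∷ [])))) p∣y
          where
          p∣y : p ∣ᶻ y
          p∣y = subst (p ∣ᶻ_) (sym y≡) (∣ᶻ-*ˡ a (prime-common-factor {p} {3} {f - x} {f + x} {b} pp prime[3] p∣U p∣V product))
        pack : (∃₂ λ c d → b ≡ c * d × Quartic (+ 3) c d a × Coprime c d × f - x + (f + x) ≡ c * c * (c * c) + + 3 * (d * d * (d * d))) → Step
        pack (c , d , b≡ , qu , cop′ , _) = a , c , d , trans y≡ (cong (a *_) b≡) , qu , cop′ , unit
          where
          unit : c * c ≡ + 1 → d * d ≡ + 1 → x * x ≡ + 1 × y * y ≡ + 1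
          unit hc hd = unit-odd₃ x a b hh ha hb , *-square-1 {y} {a} {b} y≡ ha hb
            where
            ha : a * a ≡ + 1
            ha = quartic-1 {+ 3} {c} {d} {a} qu hc hd
            hb : b * b ≡ + 1
            hb = *-square-1 {b} {c} {d} b≡ hc hd
      factors : ∀ U V → U ≡ + 2 * w - + 2 * (x * x) + + 3 * (y * y) → V ≡ + 2 * w + + 2 * (x * x) - + 3 * (y * y) → Step
      factors U V hU hV = from-powers (fourth-power-factors {3} {U} {V} {y} {4 ℕ.* s} prime[3] product (trans sum (trans (cong (+ 4 *_) w≡s) (sym (ℤ.pos-* 4 s)))) coprime)
        where
        product : U * V ≡ + 3 * (y * y * (y * y))
        product = product-UV₃ x y w U V h hU hV
        sum : U + V ≡ + 4 * w
        sum = combine₂ (+ 1) (+ 1) hU hV (solve (x ∷ y ∷ w ∷ U ∷ V ∷ []))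
        coprime : Coprime U V
        coprime {p} pp p∣U p∣V = cop pp (coprime-odd-double x y pp oy p∣y (∣ᶻ-combine (∣ᶻ-combine p∣V p∣U (+ 1) (- + 1) refl) p∣y (+ 1) (+ 6 * y) (combine₂ (- + 1) (+ 1) hV hU (solve (x ∷ y ∷ w ∷ U ∷ V ∷ []))))) p∣y
          where
          p∣y : p ∣ᶻ y
          p∣y = prime-common-factor {p} {3} {U} {V} {y} pp prime[3] p∣U p∣V product
        from-powers : FourthPowers 3 U V y → Step
        from-powers (a , b , y≡ , inj₁ (U≡ , V≡)) = ⊥-elim (odd-triple⇒⊥ x a b (odd-square ox) (odd-square (proj₁ oab)) (odd-square (proj₂ oab)) hh)
          where
          oab : Odd a × Odd b
          oab = odd-factors a b (subst Odd y≡ oy)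
          hh : + 4 * (x * x) ≡ + 3 * (b * b * (b * b)) - a * a * (a * a) + + 6 * (a * a * (b * b))
          hh = x²-from-odd-factors x y w U V a b _ _ y≡ U≡ V≡ hU hV
        from-powers (a , b , y≡ , inj₂ (U≡ , V≡)) = halve (odd+odd (odd-* oa oa) (odd-* (+ 1 , refl) (odd-* ob ob)))
          where
          oa : Odd a
          oa = proj₁ (odd-factors a b (subst Odd y≡ oy))
          ob : Odd b
          ob = proj₂ (odd-factors a b (subst Odd y≡ oy))
          halve : Even (a * a + + 3 * (b * b)) → Step
          halve (f , hf) = finish a b f y≡ (x²-from-odd-factors x y w U V a b _ _ y≡ U≡ V≡ hU hV) hf

  -- The two descent steps for t = -1

  opaque
    coprime-square-roots : ∀ {m n c d} → m * m ≡ c * c * (c * c) → n * n ≡ d * d * (d * d) → Coprime m n → Coprime c d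
    coprime-square-roots {m} {n} {c} {d} hm hn cop pp p∣c p∣d =
      cop pp (prime∣ᶻsquare pp m (∣ᶻ-combine p∣c p∣c (c * (c * c)) (+ 0) (trans hm (rearrange c)))) (prime∣ᶻsquare pp n (∣ᶻ-combine p∣d p∣d (d * (d * d)) (+ 0) (trans hn (rearrange d))))
      where
      rearrange : ∀ c → c * c * (c * c) ≡ c * (c * c) * c + + 0 * c
      rearrange = solve-∀

    pythagorean-quartic₋₁ : ∀ a b c d m n → b ≡ c * d → a * a - b * b ≡ m * m - n * n → m * m ≡ c * c * (c * c) → n * n ≡ d * d * (d * d) → Quartic (- + 1) c d a
    pythagorean-quartic₋₁ a _ c d m n refl hr hm hn = combine₃ (- + 1) (+ 1) (- + 1) hm hn hr (solve (a ∷ c ∷ d ∷ m ∷ n ∷ []))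

    odd-quartic₋₁ : ∀ a b c d e m n → b ≡ d * c → e ≡ m * n → a * a - b * b ≡ + 4 * e → m - n ≡ d * d → m + n ≡ c * c → Quartic (- + 1) c d a
    odd-quartic₋₁ a _ c d _ m n refl refl he hd hc = combine₃ (- (m + n + c * c)) (m - n + d * d) (- + 1) hc hd he (solve (a ∷ c ∷ d ∷ m ∷ n ∷ []))

    -- For t = -1 the number t (4 - t) is -5, so w² is subtracted from the completed square (x² + 2
    -- y²)² to keep the product nonnegative.
    half-product₋₁ : ∀ x y w f g → Quartic (- + 1) x (+ 2 * y) w → x * x + + 2 * (y * y) + - w ≡ + 2 * f → g ≡ f + w → f * g ≡ + 5 * (y * y * (y * y))
    half-product₋₁ x y w f g h hf hg = ℤ.*-cancelˡ-≡ (+ 4) (f * g) (+ 5 * (y * y * (y * y)))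
      (combine₃ (+ 1) (- (x * x + + 2 * (y * y) + + 2 * f + w)) (+ 4 * f) h hf hg (solve (w ∷ x ∷ y ∷ f ∷ g ∷ [])))

    product-UV₋₁ : ∀ x y w U V → Quartic (- + 1) x y w → U ≡ + 2 * (x * x) + y * y - + 2 * w → V ≡ + 2 * (x * x) + y * y + + 2 * w → U * V ≡ + 5 * (y * y * (y * y))
    product-UV₋₁ x y w U V h hU hV = combine₃ V (+ 2 * (x * x) + y * y - + 2 * w) (+ 4) hU hV h (solve (x ∷ y ∷ w ∷ U ∷ V ∷ []))

    -- A sum of two squares appears instead of a difference, so the second stage for t = -1 is a
    -- Pythagorean triple with legs a² - b² and 2 b².
    complete-square₋₁ : ∀ x y a b → y ≡ a * b → a * a * (a * a) + + 5 * (b * b * (b * b)) ≡ x * x + + 2 * (y * y) →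
      (a * a - b * b) * (a * a - b * b) + + 4 * (b * b * (b * b)) ≡ x * x
    complete-square₋₁ x _ a b refl h = combine₁ (+ 1) h (solve (x ∷ a ∷ b ∷ []))

    x²-from-odd-sum : ∀ x y a b → y ≡ a * b → a * a * (a * a) + + 5 * (b * b * (b * b)) ≡ + 4 * (x * x) + + 2 * (y * y) →
      + 4 * (x * x) ≡ (a * a - b * b) * (a * a - b * b) + + 4 * (b * b * (b * b))
    x²-from-odd-sum x _ a b refl h = combine₁ (- + 1) h (solve (x ∷ a ∷ b ∷ []))

    quarter-square : ∀ x a b e → + 4 * (x * x) ≡ (a * a - b * b) * (a * a - b * b) + + 4 * (b * b * (b * b)) → a * a - b * b ≡ + 4 * e →
      + 4 * (b * b * (b * b) + + 4 * (e * e)) ≡ + 4 * (x * x)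
    quarter-square x a b e hh he = combine₂ (- + 1) (- (a * a - b * b + + 4 * e)) hh he (solve (x ∷ a ∷ b ∷ e ∷ []))

    even-step₋₁ : ∀ {x y w} → Odd x → Even y → NonNeg x → NonNeg w → Coprime x y → Quartic (- + 1) x y w → EvenStep (- + 1) x y
    even-step₋₁ {x} {_} {w} ox (y , refl) x≥0 w≥0 cop h =
      first (odd+odd (odd-+ (odd-* ox ox) (even-2* (y * y))) (odd-neg ow))
      where
      ow : Odd w
      ow = quartic-odd-w { - + 1} {x} {+ 2 * y} ox (inj₁ (y , refl)) h
      Step : Set
      Step = EvenStep (- + 1) x (+ 2 * y)
      second : ∀ a b r → y ≡ a * b → r ≡ a * a - b * b → r * r + + 4 * (b * b * (b * b)) ≡ x * x → Step
      second a b r y≡ r≡ hx = halve (odd+odd ox (odd-neg or))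
        where
        or : Odd r
        or = odd-root r (subst Odd r²≡ (odd-+ (odd-* ox ox) (even-neg (even-2* (+ 2 * (b * b * (b * b)))))))
          where
          r²≡ : x * x + - (+ 2 * (+ 2 * (b * b * (b * b)))) ≡ r * r
          r²≡ = combine₁ (- + 1) hx (solve (x ∷ b ∷ r ∷ []))
        coprime : Coprime r (b * b)
        coprime {p} pp p∣r p∣b² = cop pp (prime∣ᶻsquare pp x (∣ᶻ-combine p∣r p∣b² r (+ 4 * (b * b)) (trans (sym hx) (solve (b ∷ r ∷ [])))))
          (∣ᶻ-*ˡ (+ 2) (subst (p ∣ᶻ_) (sym y≡) (∣ᶻ-*ˡ a (prime∣ᶻsquare pp b p∣b²))))
        halve : Even (x + - r) → Step
        halve (f , hf) = parametrised (pythagorean {x} {r} {b * b} {f} hx (combine₁ (+ 1) hf (solve (x ∷ r ∷ f ∷ []))) x≥0 coprime)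
          where
          parametrised : (∃₂ λ m n → r ≡ m * m - n * n × b * b ≡ m * n × x ≡ m * m + n * n × NonNeg m) → Step
          parametrised (m , n , hr , hb , hx′ , _) = roots (square-factors-abs {m} {n} {b} (sym hb) cop-mn)
            where
            cop-mn : Coprime m n
            cop-mn {p} pp p∣m p∣n = coprime pp (∣ᶻ-combine p∣m p∣n m (- n) (trans hr (solve (m ∷ n ∷ [])))) (∣ᶻ-combine p∣m p∣n n (+ 0) (trans hb (solve (m ∷ n ∷ []))))
            roots : (∃₂ λ c d → m * m ≡ c * c * (c * c) × n * n ≡ d * d * (d * d) × b ≡ c * d) → Step
            roots (c , d , hm , hn , b≡) = a , c , d , trans (cong (+ 2 *_) y≡) (cong (λ b → + 2 * (a * b)) b≡) ,
              pythagorean-quartic₋₁ a b c d m n b≡ (trans (sym r≡) hr) hm hn , coprime-square-roots {m} {n} {c} {d} hm hn cop-mn ,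
              -- If c² = d² = 1, then x = m² + n² = c⁴ + d⁴ = 2, although x is odd.
              λ hc hd → even∧odd⇒⊥ {x} (+ 1 , trans hx′ (cong₂ _+_ (trans hm (cong₂ _*_ hc hc)) (trans hn (cong₂ _*_ hd hd)))) ox
      factors : ∀ f g → x * x + + 2 * (y * y) + - w ≡ + 2 * f → g ≡ f + w → Step
      factors f g hf hg = from-powers (fourth-power-factors {5} {f} {g} {y} prime[5] product (trans sum (proj₂ (nonNeg-+ (nonNeg-square x) (nonNeg-* 2 (nonNeg-square y))))) coprime)
        where
        product : f * g ≡ + 5 * (y * y * (y * y))
        product = half-product₋₁ x y w f g h hf hg
        sum : f + g ≡ x * x + + 2 * (y * y)
        sum = combine₂ (+ 1) (- + 1) hg hf (solve (w ∷ x ∷ y ∷ f ∷ g ∷ []))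
        coprime : Coprime f g
        coprime {p} pp p∣f p∣g = cop pp (prime∣ᶻsquare pp x (∣ᶻ-combine (∣ᶻ-combine p∣f p∣g (+ 1) (+ 1) refl) p∣y (+ 1) (- (+ 2 * y)) (combine₁ (- + 1) sum (solve (x ∷ y ∷ f ∷ g ∷ []))))) (∣ᶻ-*ˡ (+ 2) p∣y)
          where
          p∣y : p ∣ᶻ y
          p∣y = prime-common-factor {p} {5} {f} {g} {y} pp prime[5] p∣f p∣g product
        from-powers : FourthPowers 5 f g y → Step
        from-powers (a , b , y≡ , inj₁ (f≡ , g≡)) = second a b (a * a - b * b) y≡ refl (complete-square₋₁ x y a b y≡ (trans (sym (cong₂ _+_ f≡ g≡)) sum))
        from-powers (a , b , y≡ , inj₂ (f≡ , g≡)) = second a b (a * a - b * b) y≡ refl (complete-square₋₁ x y a b y≡ (trans (trans (ℤ.+-comm (a * a * (a * a)) _) (sym (cong₂ _+_ f≡ g≡))) sum))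
      first : Even (x * x + + 2 * (y * y) + - w) → Step
      first (f , hf) = factors f _ hf refl

    odd-step₋₁ : ∀ {x y w} → Odd x → Odd y → NonNeg x → NonNeg w → Coprime x y → Quartic (- + 1) x y w → OddStep (- + 1) x y
    odd-step₋₁ {x} {y} {w} ox oy x≥0 w≥0 cop h = factors _ _ refl refl
      where
      Step : Set
      Step = OddStep (- + 1) x y
      finish : ∀ a b e → y ≡ a * b → Odd b → + 4 * (x * x) ≡ (a * a - b * b) * (a * a - b * b) + + 4 * (b * b * (b * b)) → a * a - b * b ≡ + 4 * e → Step
      finish a b e y≡ ob hh he = halve (odd+odd ox (odd-neg (odd-* ob ob)))
        where
        hx : b * b * (b * b) + + 4 * (e * e) ≡ x * x
        hx = ℤ.*-cancelˡ-≡ (+ 4) (b * b * (b * b) + + 4 * (e * e)) (x * x) (quarter-square x a b e hh he)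
        p∣b⇒p∣y : ∀ {p} → p ∣ᶻ b → p ∣ᶻ y
        p∣b⇒p∣y {p} p∣b = subst (p ∣ᶻ_) (sym y≡) (∣ᶻ-*ˡ a p∣b)
        coprime : Coprime (b * b) e
        coprime {p} pp p∣b² p∣e = cop pp (prime∣ᶻsquare pp x (∣ᶻ-combine p∣b² p∣e (b * b) (+ 4 * e) (trans (sym hx) (solve (b ∷ e ∷ []))))) (p∣b⇒p∣y (prime∣ᶻsquare pp b p∣b²))
        halve : Even (x + - (b * b)) → Step
        halve (f , hf) = parametrised (pythagorean {x} {b * b} {e} {f} hx (combine₁ (+ 1) hf (solve (x ∷ b ∷ f ∷ []))) x≥0 coprime)
          where
          parametrised : (∃₂ λ m n → b * b ≡ m * m - n * n × e ≡ m * n × x ≡ m * m + n * n × NonNeg m) → Step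
          parametrised (m , n , hb , he′ , hx′ , m≥0) = roots (square-factorsᶻ {m - n} {m + n} {b} product (proj₁ nonneg) (proj₂ nonneg) cop′)
            where
            product : (m - n) * (m + n) ≡ b * b
            product = combine₁ (- + 1) hb (solve (b ∷ m ∷ n ∷ []))
            sum : m - n + (m + n) ≡ + 2 * m
            sum = solve (m ∷ n ∷ [])
            -- The factors have product b² and sum 2 m, so m ≥ 0 makes both nonnegative; they can
            -- then be written as d² and c² without a sign.
            nonneg : NonNeg (m - n) × NonNeg (m + n)
            nonneg = nonNeg-factors {m - n} {m + n} (trans product (square-abs b)) (trans sum (proj₂ (nonNeg-* 2 m≥0)))
            cop′ : Coprime (m - n) (m + n)
            cop′ {p} pp p∣U p∣V = cop pp (∣ᶻ-combine p∣m p∣n m n hx′) p∣y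
              where
              p∣y : p ∣ᶻ y
              p∣y = p∣b⇒p∣y (prime∣ᶻsquare pp b (∣ᶻ-combine p∣U p∣U (m + n) (+ 0) (trans (sym product) (solve (m ∷ n ∷ [])))))
              p∣m : p ∣ᶻ m
              p∣m = coprime-odd-multiple m y pp oy p∣y (∣ᶻ-combine p∣V p∣U (+ 1) (+ 1) (solve (m ∷ n ∷ [])))
              p∣n : p ∣ᶻ n
              p∣n = coprime-odd-multiple n y pp oy p∣y (∣ᶻ-combine p∣V p∣U (+ 1) (- + 1) (solve (m ∷ n ∷ [])))
            roots : (∃₂ λ d c → m - n ≡ d * d × m + n ≡ c * c × b ≡ d * c × NonNeg c) → Step
            roots (d , c , hd , hc , b≡ , _) = a , c , d , trans y≡ (cong (a *_) (trans b≡ (ℤ.*-comm d c))) , qu ,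
              (λ {p} pp p∣c p∣d → cop′ pp (subst (p ∣ᶻ_) (sym hd) (∣ᶻ-*ˡ d p∣d)) (subst (p ∣ᶻ_) (sym hc) (∣ᶻ-*ˡ c p∣c))) , unit
              where
              qu : Quartic (- + 1) c d a
              qu = odd-quartic₋₁ a b c d e m n b≡ he′ he hd hc
              unit : c * c ≡ + 1 → d * d ≡ + 1 → x * x ≡ + 1 × y * y ≡ + 1
              unit uc ud = ℤ.*-cancelˡ-≡ (+ 4) (x * x) (+ 1) (trans hh (cong₂ (λ r s → (r - s) * (r - s) + + 4 * (s * s)) ua ub)) , *-square-1 {y} {a} {b} y≡ ua ub
                where
                ua : a * a ≡ + 1
                ua = quartic-1 { - + 1} {c} {d} {a} qu uc ud
                ub : b * b ≡ + 1
                ub = *-square-1 {b} {d} {c} b≡ ud uc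
      powers : ∀ a b → y ≡ a * b → a * a * (a * a) + + 5 * (b * b * (b * b)) ≡ + 4 * (x * x) + + 2 * (y * y) → Step
      powers a b y≡ hs = go (odd-square (proj₁ oab)) (odd-square (proj₂ oab))
        where
        oab : Odd a × Odd b
        oab = odd-factors a b (subst Odd y≡ oy)
        go : (∃ λ A → a * a ≡ + 1 + + 4 * A) → (∃ λ B → b * b ≡ + 1 + + 4 * B) → Step
        go (A , ha) (B , hb) = finish a b (A - B) y≡ (proj₂ oab)
          -- As a² and b² are both 1 modulo 4, a² - b² is 4 e with e = A - B; the triple divided by
          -- 2 has legs b² and 2 e.
          (x²-from-odd-sum x y a b y≡ hs)
          (combine₂ (+ 1) (- + 1) ha hb (solve (a ∷ b ∷ A ∷ B ∷ [])))
      factors : ∀ U V → U ≡ + 2 * (x * x) + y * y - + 2 * w → V ≡ + 2 * (x * x) + y * y + + 2 * w → Step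
      factors U V hU hV = from-powers (fourth-power-factors {5} {U} {V} {y} prime[5] product (trans sum (proj₂ (nonNeg-+ (nonNeg-* 4 (nonNeg-square x)) (nonNeg-* 2 (nonNeg-square y))))) coprime)
        where
        product : U * V ≡ + 5 * (y * y * (y * y))
        product = product-UV₋₁ x y w U V h hU hV
        sum : U + V ≡ + 4 * (x * x) + + 2 * (y * y)
        sum = combine₂ (+ 1) (+ 1) hU hV (solve (x ∷ y ∷ w ∷ U ∷ V ∷ []))
        coprime : Coprime U V
        coprime {p} pp p∣U p∣V = cop pp (coprime-odd-double x y pp oy p∣y (∣ᶻ-combine (∣ᶻ-combine p∣U p∣V (+ 1) (+ 1) refl) p∣y (+ 1) (- (+ 2 * y)) (combine₁ (- + 1) sum (solve (x ∷ y ∷ U ∷ V ∷ []))))) p∣y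
          where
          p∣y : p ∣ᶻ y
          p∣y = prime-common-factor {p} {5} {U} {V} {y} pp prime[5] p∣U p∣V product
        from-powers : FourthPowers 5 U V y → Step
        from-powers (a , b , y≡ , inj₁ (U≡ , V≡)) = powers a b y≡ (trans (sym (cong₂ _+_ U≡ V≡)) sum)
        from-powers (a , b , y≡ , inj₂ (U≡ , V≡)) = powers a b y≡ (trans (ℤ.+-comm (a * a * (a * a)) _) (trans (sym (cong₂ _+_ U≡ V≡)) sum))

  -- Induction for t = 3 and t = -1

  opaque
    coprime-abs : ∀ {x y} → Coprime x y → Coprime (+ ∣ x ∣) y
    coprime-abs cop pp p∣x = cop pp (∣⇒∣ᶻ (∣ᶻ⇒∣ p∣x))

    odd-abs : ∀ {x} → Odd x → Odd (+ ∣ x ∣)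
    odd-abs {x} ox = odd-root (+ ∣ x ∣) (subst Odd (sym (∣i∣*∣i∣≡i*i x)) (odd-* ox ox))

    quartic-abs : ∀ {t x y w} → Quartic t x y w → Quartic t (+ ∣ x ∣) y (+ ∣ w ∣)
    quartic-abs {t} {x} {y} {w} h = trans (cong (λ s → s * s + t * (y * y * (y * y))) (∣i∣*∣i∣≡i*i x))
      (trans h (sym (cong₂ (λ r s → r + t * (s * (y * y))) (∣i∣*∣i∣≡i*i w) (∣i∣*∣i∣≡i*i x))))

    quartic-swap : ∀ {x y w} → Quartic (+ 1) x y w → Quartic (+ 1) y x w
    quartic-swap {x} {y} {w} h = combine₁ (+ 1) h (solve (x ∷ y ∷ w ∷ []))

    even∧even⇒⊥ : ∀ {x y} → Coprime x y → Even x → Even y → ⊥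
    even∧even⇒⊥ cop (k , hk) (l , hl) = cop prime[2] (mult k hk) (mult l hl)

    -- Modulo 4 the even first coordinate contributes nothing, and t y⁴ is 3.
    w²≡3[4] : ∀ u x y w B → Quartic (+ 3 + + 4 * u) (+ 2 * x) y w → y * y ≡ + 1 + + 4 * B → ∃ λ L → w * w ≡ + 3 + + 4 * L
    w²≡3[4] u x y w B h hb = + 3 * (+ 2 * B + + 4 * (B * B)) + u * (+ 1 + + 4 * B) * (+ 1 + + 4 * B) + + 4 * (x * x * (x * x)) - (+ 3 + + 4 * u) * (x * x * (+ 1 + + 4 * B)) ,
      combine₂ (- + 1) ((+ 3 + + 4 * u) * (y * y + + 1 + + 4 * B) - (+ 3 + + 4 * u) * (+ 4 * (x * x))) h hb (solve (u ∷ x ∷ y ∷ w ∷ B ∷ []))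

    3[4]⇒odd : ∀ L → Odd (+ 3 + + 4 * L)
    3[4]⇒odd L = + 1 + + 2 * L , solve (L ∷ [])

    -- This covers t = 3 and t = - 1, which are congruent to 3 modulo 4.
    even-x-impossible : ∀ {u x y w} → Even x → Odd y → ¬ Quartic (+ 3 + + 4 * u) x y w
    even-x-impossible {u} {_} {y} {w} (x , refl) oy h = w-parity (parity w) (odd-square oy)
      where
      w-parity : Even w ⊎ Odd w → (∃ λ B → y * y ≡ + 1 + + 4 * B) → ⊥
      w-parity (inj₁ ew) (B , hb) = let L , hw = w²≡3[4] u x y w B h hb in even∧odd⇒⊥ (subst Even hw (even-*ʳ ew w)) (3[4]⇒odd L)
      w-parity (inj₂ ow) (B , hb) = let L , hw = w²≡3[4] u x y w B h hb ; K , hw′ = odd-square ow in 1≢3[4] K L (trans (sym hw′) hw)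

  opaque
    quartic-d² : ∀ t a c d → Quartic t c d a → c * c ≡ + 1 → a * a ≡ + 1 → t * (d * d) * (d * d - + 1) ≡ + 0
    quartic-d² t a c d qu hc ha = combine₃ (+ 1) (- (c * c + + 1) + t * (d * d)) (+ 1) qu hc ha (solve (t ∷ a ∷ c ∷ d ∷ []))

  -- The induction sees `t` only as a number congruent to 3 modulo 4, hence nonzero. The steps are
  -- parameters because they end in a factorisation for t = 3 and in a Pythagorean triple for t =
  -- -1.
  module ThreeModFour (u : ℤ)
    (odd-step  : ∀ {x y w} → Odd x → Odd y → NonNeg x → NonNeg w → Coprime x y → Quartic (+ 3 + + 4 * u) x y w → OddStep (+ 3 + + 4 * u) x y)
    (even-step : ∀ {x y w} → Odd x → Even y → NonNeg x → NonNeg w → Coprime x y → Quartic (+ 3 + + 4 * u) x y w → EvenStep (+ 3 + + 4 * u) x y) where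

    private
      t : ℤ
      t = + 3 + + 4 * u

    Trivial : ℤ → ℤ → Set
    Trivial x y = y ≡ + 0 ⊎ (x * x ≡ + 1 × y * y ≡ + 1)

    opaque
      bounded : ∀ n x y w → ∣ y ∣ ℕ.≤ n → Coprime x y → Quartic t x y w → Trivial x y
      bounded zero x y w y≤0 _ _ = inj₁ (ℤ.∣i∣≡0⇒i≡0 (ℕ.n≤0⇒n≡0 y≤0))
      bounded (suc n) x y w y≤n cop h with y ℤ.≟ + 0
      ... | yes y≡0 = inj₁ y≡0
      ... | no y≢0 = cases (parity x) (parity y)
        where
        descend-odd : OddStep t (+ ∣ x ∣) y → Trivial x y
        descend-odd (a , c , d , y≡ , qu , cop′ , unit) = [ (λ d<y → from-smaller (bounded n c d a (ℕ.<⇒≤pred (ℕ.<-≤-trans d<y y≤n)) cop′ qu)) , (λ (ha , hc) → inj₂ (units (hc , hd ha hc))) ]′ (smaller {y} {a} {c} {d} y≢0 y≡)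
          where
          units : c * c ≡ + 1 × d * d ≡ + 1 → x * x ≡ + 1 × y * y ≡ + 1
          units (hc , hd) = trans (sym (∣i∣*∣i∣≡i*i x)) (proj₁ (unit hc hd)) , proj₂ (unit hc hd)
          from-smaller : Trivial c d → Trivial x y
          from-smaller (inj₂ (hc , hd)) = inj₂ (units (hc , hd))
          from-smaller (inj₁ d≡0) = inj₁ (trans y≡ (trans (cong (λ d → a * (c * d)) d≡0) (zero-product a c)))
            where
            zero-product : ∀ a c → a * (c * + 0) ≡ + 0
            zero-product = solve-∀
          d≢0 : d ≢ + 0
          d≢0 d≡0 = [ y≢0 , (λ ()) ]′ (from-d≡0 d≡0)
            where
            from-d≡0 : d ≡ + 0 → y ≡ + 0 ⊎ ⊥
            from-d≡0 refl = inj₁ (trans y≡ (zero-product a c))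
              where
              zero-product : ∀ a c → a * (c * + 0) ≡ + 0
              zero-product = solve-∀
          -- with a² = c² = 1 the quartic reads t d² (d² - 1) = 0
          hd : a * a ≡ + 1 → c * c ≡ + 1 → d * d ≡ + 1
          hd ha hc = [ (λ td²≡0 → ⊥-elim ([ t≢0 , (λ d²≡0 → d≢0 ([ (λ e → e) , (λ e → e) ]′ (*-zero d d d²≡0))) ]′ (*-zero (+ 3 + + 4 * u) (d * d) td²≡0))) , ℤ.i-j≡0⇒i≡j (d * d) (+ 1) ]′
            (*-zero ((+ 3 + + 4 * u) * (d * d)) (d * d - + 1)
              (quartic-d² (+ 3 + + 4 * u) a c d qu hc ha))
            where
            t≢0 : + 3 + + 4 * u ≢ + 0
            t≢0 e = even∧odd⇒⊥ {+ 3 + + 4 * u} (+ 0 , e) (+ 1 + + 2 * u , solve (u ∷ []))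
        descend-even : EvenStep t (+ ∣ x ∣) y → Trivial x y
        descend-even (a , c , d , y≡ , qu , cop′ , ¬unit) = from-smaller (bounded n c d a (ℕ.<⇒≤pred (ℕ.<-≤-trans (smaller₂ {y} {a} {c} {d} y≢0 y≡) y≤n)) cop′ qu)
          where
          from-smaller : Trivial c d → Trivial x y
          from-smaller (inj₂ (hc , hd)) = ⊥-elim (¬unit hc hd)
          from-smaller (inj₁ d≡0) = inj₁ (trans y≡ (trans (cong (λ d → + 2 * (a * (c * d))) d≡0) (zero-product a c)))
            where
            zero-product : ∀ a c → + 2 * (a * (c * + 0)) ≡ + 0
            zero-product = solve-∀
        cases : Even x ⊎ Odd x → Even y ⊎ Odd y → Trivial x y
        cases (inj₁ ex) (inj₁ ey) = ⊥-elim (even∧even⇒⊥ {x} {y} cop ex ey)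
        cases (inj₁ ex) (inj₂ oy) = ⊥-elim (even-x-impossible {u} {x} {y} {w} ex oy h)
        cases (inj₂ ox) (inj₂ oy) = descend-odd (odd-step {+ ∣ x ∣} {y} {+ ∣ w ∣} (odd-abs ox) oy (_ , refl) (_ , refl) (coprime-abs {x} {y} cop) (quartic-abs {t} {x} {y} {w} h))
        cases (inj₂ ox) (inj₁ ey) = descend-even (even-step {+ ∣ x ∣} {y} {+ ∣ w ∣} (odd-abs ox) ey (_ , refl) (_ , refl) (coprime-abs {x} {y} cop) (quartic-abs {t} {x} {y} {w} h))

      quartic-solutions : ∀ {x y w} → Coprime x y → Quartic t x y w → Trivial x y
      quartic-solutions {x} {y} {w} = bounded (∣ y ∣) x y w ℕ.≤-refl

  opaque
    quartic₃-solutions : ∀ {x y w} → Coprime x y → Quartic (+ 3) x y w → y ≡ + 0 ⊎ (x * x ≡ + 1 × y * y ≡ + 1)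
    quartic₃-solutions {x} {y} {w} = ThreeModFour.quartic-solutions (+ 0)
      (λ {x} {y} {w} ox oy _ → odd-step₃ {x} {y} {w} ox oy) (λ {x} {y} {w} ox ey _ → even-step₃ {x} {y} {w} ox ey) {x} {y} {w}

    quartic₋₁-solutions : ∀ {x y w} → Coprime x y → Quartic (- + 1) x y w → y ≡ + 0 ⊎ (x * x ≡ + 1 × y * y ≡ + 1)
    quartic₋₁-solutions {x} {y} {w} = ThreeModFour.quartic-solutions (- + 1)
      (λ {x} {y} {w} → odd-step₋₁ {x} {y} {w}) (λ {x} {y} {w} → even-step₋₁ {x} {y} {w}) {x} {y} {w}

    -- The descent for t = 1

    complete-square₁ : ∀ a b x → x * x ≡ a * a * (a * a) - + 3 * (b * b * (b * b)) + + 2 * + 1 * (a * a * (b * b)) →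
      x * x + + 4 * (b * b * (b * b)) ≡ (a * a + b * b) * (a * a + b * b)
    complete-square₁ a b x h = combine₁ (+ 1) h (solve (a ∷ b ∷ x ∷ []))

    pythagorean-quartic₁ : ∀ a b c d m n → b ≡ c * d → a * a + b * b ≡ m * m + n * n → m * m ≡ c * c * (c * c) → n * n ≡ d * d * (d * d) → Quartic (+ 1) c d a
    pythagorean-quartic₁ a _ c d m n refl hh hm hn = combine₃ (- + 1) (- + 1) (- + 1) hm hn hh (solve (a ∷ c ∷ d ∷ m ∷ n ∷ []))

    -- The second stage is the triple with legs `x` and 2 b². The odd number c⁴ - d⁴ is `x` itself;
    -- it shows that exactly one of `c` and `d` is odd, so the descent stays among solutions of
    -- opposite parity.
    even-step₁ : ∀ {x y w} → Odd x → Even y → NonNeg w → Coprime x y → Quartic (+ 1) x y w →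
      ∃ λ a → ∃₂ λ c d → y ≡ + 2 * (a * (c * d)) × Quartic (+ 1) c d a × Coprime c d × Odd (c * c * (c * c) + - (d * d * (d * d)))
    even-step₁ {x} {_} {w} ox (y , refl) w≥0 cop h =
      let a , b , y≡ , hx = even-factorisation (+ 1) {x} {y} {w} refl ox w≥0 cop h in second a b (a * a + b * b) y≡ refl (complete-square₁ a b x hx)
      where
      Step : Set
      Step = ∃ λ a → ∃₂ λ c d → + 2 * y ≡ + 2 * (a * (c * d)) × Quartic (+ 1) c d a × Coprime c d × Odd (c * c * (c * c) + - (d * d * (d * d)))
      second : ∀ a b h₀ → y ≡ a * b → h₀ ≡ a * a + b * b → x * x + + 4 * (b * b * (b * b)) ≡ h₀ * h₀ → Step
      second a b h₀ y≡ h₀≡ hh = halve (odd+odd oh₀ (odd-neg ox))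
        where
        oh₀ : Odd h₀
        oh₀ = odd-root h₀ (subst Odd hh (odd-+ (odd-* ox ox) (even-*ʳ (+ 2 , refl) _)))
        coprime : Coprime x (b * b)
        coprime {p} pp p∣x p∣b² = cop pp p∣x (∣ᶻ-*ˡ (+ 2) (subst (p ∣ᶻ_) (sym y≡) (∣ᶻ-*ˡ a (prime∣ᶻsquare pp b p∣b²))))
        halve : Even (h₀ + - x) → Step
        halve (f , hf) = parametrised (pythagorean {h₀} {x} {b * b} {f} hh (combine₁ (+ 1) hf (solve (x ∷ h₀ ∷ f ∷ []))) (proj₁ nonneg , trans h₀≡ (proj₂ nonneg)) coprime)
          where
          nonneg : NonNeg (a * a + b * b)
          nonneg = nonNeg-+ (nonNeg-square a) (nonNeg-square b)
          parametrised : (∃₂ λ m n → x ≡ m * m - n * n × b * b ≡ m * n × h₀ ≡ m * m + n * n × NonNeg m) → Step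
          parametrised (m , n , hx , hb , hh₀ , _) = roots (square-factors-abs {m} {n} {b} (sym hb) cop-mn)
            where
            cop-mn : Coprime m n
            cop-mn {p} pp p∣m p∣n = coprime pp (∣ᶻ-combine p∣m p∣n m (- n) (trans hx (solve (m ∷ n ∷ [])))) (∣ᶻ-combine p∣m p∣n n (+ 0) (trans hb (solve (m ∷ n ∷ []))))
            roots : (∃₂ λ c d → m * m ≡ c * c * (c * c) × n * n ≡ d * d * (d * d) × b ≡ c * d) → Step
            roots (c , d , hm , hn , b≡) = a , c , d , trans (cong (+ 2 *_) y≡) (cong (λ b → + 2 * (a * b)) b≡) ,
              pythagorean-quartic₁ a b c d m n b≡ (trans (sym h₀≡) hh₀) hm hn , coprime-square-roots {m} {n} {c} {d} hm hn cop-mn ,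
              subst Odd (trans hx (cong₂ (λ r s → r + - s) hm hn)) ox

    -- For t = 1 the equation is symmetric, so whichever of `c` and `d` is even becomes the new
    -- second coordinate.
    quartic₁-bounded : ∀ n x y w → ∣ y ∣ ℕ.≤ n → Odd x → Even y → Coprime x y → Quartic (+ 1) x y w → y ≡ + 0
    quartic₁-bounded zero x y w y≤0 _ _ _ _ = ℤ.∣i∣≡0⇒i≡0 (ℕ.n≤0⇒n≡0 y≤0)
    quartic₁-bounded (suc n) x y w y≤n ox ey cop h with y ℤ.≟ + 0
    ... | yes y≡0 = y≡0
    ... | no y≢0 = descend (even-step₁ {+ ∣ x ∣} {y} {+ ∣ w ∣} (odd-abs ox) ey (_ , refl) (coprime-abs {x} {y} cop) (quartic-abs {+ 1} {x} {y} {w} h))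
      where
      descend : (∃ λ a → ∃₂ λ c d → y ≡ + 2 * (a * (c * d)) × Quartic (+ 1) c d a × Coprime c d × Odd (c * c * (c * c) + - (d * d * (d * d)))) → y ≡ + 0
      descend (a , c , d , y≡ , qu , cop′ , o) = cases (parity c) (parity d)
        where
        y≡′ : y ≡ + 2 * (a * (d * c))
        y≡′ = trans y≡ (cong (λ z → + 2 * (a * z)) (ℤ.*-comm c d))
        zero-product : ∀ a c → + 2 * (a * (c * + 0)) ≡ + 0
        zero-product = solve-∀
        cases : Even c ⊎ Odd c → Even d ⊎ Odd d → y ≡ + 0
        cases (inj₁ ec) (inj₁ ed) = ⊥-elim (even∧even⇒⊥ {c} {d} cop′ ec ed)
        cases (inj₂ oc) (inj₂ od) = ⊥-elim (even∧odd⇒⊥ (odd+odd (odd-* (odd-* oc oc) (odd-* oc oc)) (odd-neg (odd-* (odd-* od od) (odd-* od od)))) o)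
        cases (inj₂ oc) (inj₁ ed) = trans y≡ (trans (cong (λ d → + 2 * (a * (c * d))) d≡0) (zero-product a c))
          where
          d≡0 : d ≡ + 0
          d≡0 = quartic₁-bounded n c d a (ℕ.<⇒≤pred (ℕ.<-≤-trans (smaller₂ {y} {a} {c} {d} y≢0 y≡) y≤n)) oc ed cop′ qu
        cases (inj₁ ec) (inj₂ od) = trans y≡′ (trans (cong (λ c → + 2 * (a * (d * c))) c≡0) (zero-product a d))
          where
          c≡0 : c ≡ + 0
          c≡0 = quartic₁-bounded n d c a (ℕ.<⇒≤pred (ℕ.<-≤-trans (smaller₂ {y} {a} {d} {c} y≢0 y≡′) y≤n)) od ec (coprime-swap {c} {d} cop′) (quartic-swap {c} {d} {a} qu)

    sum-of-squares₁ : ∀ x y w e → Quartic (+ 1) x y w → x * x - y * y ≡ + 2 * e → x * y * (x * y) + + 4 * (e * e) ≡ w * w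
    sum-of-squares₁ x y w e h he = combine₂ (+ 1) (- (x * x - y * y + + 2 * e)) h he (solve (x ∷ y ∷ w ∷ e ∷ []))

    odd-quartic₁ : ∀ x y e v m n → e ≡ m * n → x * y ≡ m * m - n * n → x * x - y * y ≡ + 2 * e → x * x + y * y ≡ + 2 * v →
      + 4 * (m * m * (m * m) + + 1 * (n * n * (n * n))) ≡ + 4 * (v * v + + 1 * (m * m * (n * n)))
    odd-quartic₁ x y _ v m n refl hxy he hv = combine₃ (- (+ 4 * (x * y + m * m - n * n))) (- (x * x - y * y + + 2 * (m * n))) (x * x + y * y + + 2 * v) hxy he hv
      (solve (x ∷ y ∷ v ∷ m ∷ n ∷ []))

    -- Here w² = (x y)² + (x² - y²)², so x y = m² - n² and (x² - y²) / 2 = m n. Then v = (x² + y²) /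
    -- 2 satisfies v² = m⁴ - m² n² + n⁴, a solution of opposite parity because x y is odd. Hence m n
    -- = 0 and x² = y², which coprimality turns into 1.
    quartic₁-odd : ∀ {x y w} → Odd x → Odd y → NonNeg w → Coprime x y → Quartic (+ 1) x y w → x * x ≡ + 1 × y * y ≡ + 1
    quartic₁-odd {x} {y} {w} ox oy w≥0 cop h = split (odd-square ox) (odd-square oy)
      where
      oxy : Odd (x * y)
      oxy = odd-* ox oy
      ow : Odd w
      ow = quartic-odd-w {+ 1} {x} {y} ox (inj₂ oy) h
      equal : x * x ≡ y * y → x * x ≡ + 1 × y * y ≡ + 1
      equal e = x²≡1 , trans (sym e) x²≡1
        where
        x²≡1 : x * x ≡ + 1
        x²≡1 = ∣i∣≡1⇒i*i≡1 x (coprime-0⇒unit {x} λ {p} pp p∣x _ → cop pp p∣x (prime∣ᶻsquare pp y (subst (p ∣ᶻ_) e (∣ᶻ-*ˡ x p∣x))))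
      split : (∃ λ K → x * x ≡ + 1 + + 4 * K) → (∃ λ L → y * y ≡ + 1 + + 4 * L) → x * x ≡ + 1 × y * y ≡ + 1
      split (K , hx) (L , hy) = with-e (+ 2 * (K - L)) (+ 1 + + 2 * K + + 2 * L)
        (combine₂ (+ 1) (- + 1) hx hy (solve (x ∷ y ∷ K ∷ L ∷ []))) (combine₂ (+ 1) (+ 1) hx hy (solve (x ∷ y ∷ K ∷ L ∷ [])))
        where
        with-e : ∀ e v → x * x - y * y ≡ + 2 * e → x * x + y * y ≡ + 2 * v → x * x ≡ + 1 × y * y ≡ + 1
        with-e e v he hv = halve (odd+odd ow (odd-neg oxy))
          where
          hw : x * y * (x * y) + + 4 * (e * e) ≡ w * w
          hw = sum-of-squares₁ x y w e h he
          coprime : Coprime (x * y) e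
          coprime {p} pp p∣xy p∣e = [ from-x , from-y ]′ (prime∣ᶻ* pp x y p∣xy)
            where
            from-x : p ∣ᶻ x → ⊥
            from-x p∣x = cop pp p∣x (prime∣ᶻsquare pp y (∣ᶻ-combine p∣x p∣e x (- + 2) (combine₁ (- + 1) he (solve (x ∷ y ∷ e ∷ [])))))
            from-y : p ∣ᶻ y → ⊥
            from-y p∣y = cop pp (prime∣ᶻsquare pp x (∣ᶻ-combine p∣y p∣e y (+ 2) (combine₁ (+ 1) he (solve (x ∷ y ∷ e ∷ []))))) p∣y
          e≡0⇒ : e ≡ + 0 → x * x ≡ + 1 × y * y ≡ + 1
          e≡0⇒ e≡0 = equal (combine₂ (+ 1) (+ 2) he e≡0 (solve (x ∷ y ∷ e ∷ [])))
          halve : Even (w + - (x * y)) → x * x ≡ + 1 × y * y ≡ + 1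
          halve (f , hf) = parametrised (pythagorean {w} {x * y} {e} {f} hw (combine₁ (+ 1) hf (solve (w ∷ x ∷ y ∷ f ∷ []))) w≥0 coprime)
            where
            parametrised : (∃₂ λ m n → x * y ≡ m * m - n * n × e ≡ m * n × w ≡ m * m + n * n × NonNeg m) → x * x ≡ + 1 × y * y ≡ + 1
            parametrised (m , n , hxy , e≡ , _ , _) = cases (parity m) (parity n)
              where
              qu : Quartic (+ 1) m n v
              qu = ℤ.*-cancelˡ-≡ (+ 4) (m * m * (m * m) + + 1 * (n * n * (n * n))) (v * v + + 1 * (m * m * (n * n))) (odd-quartic₁ x y e v m n e≡ hxy he hv)
              cop-mn : Coprime m n
              cop-mn {p} pp p∣m p∣n = coprime pp (∣ᶻ-combine p∣m p∣n m (- n) (trans hxy (solve (m ∷ n ∷ [])))) (∣ᶻ-combine p∣m p∣n n (+ 0) (trans e≡ (solve (m ∷ n ∷ []))))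
              cases : Even m ⊎ Odd m → Even n ⊎ Odd n → x * x ≡ + 1 × y * y ≡ + 1
              cases (inj₁ em) (inj₁ en) = ⊥-elim (even∧even⇒⊥ {m} {n} cop-mn em en)
              cases (inj₂ om) (inj₂ on) = ⊥-elim (even∧odd⇒⊥ (odd+odd (odd-* om om) (odd-neg (odd-* on on))) (subst Odd hxy oxy))
              cases (inj₂ om) (inj₁ en) = e≡0⇒ (trans e≡ (trans (cong (m *_) (quartic₁-bounded (∣ n ∣) m n v ℕ.≤-refl om en cop-mn qu)) (ℤ.*-zeroʳ m)))
              cases (inj₁ em) (inj₂ on) = e≡0⇒ (trans e≡ (cong (_* n) (quartic₁-bounded (∣ m ∣) n m v ℕ.≤-refl on em (coprime-swap {m} {n} cop-mn) (quartic-swap {m} {n} {v} qu))))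

    quartic₁-solutions : ∀ {x y w} → Coprime x y → Quartic (+ 1) x y w → x ≡ + 0 ⊎ y ≡ + 0 ⊎ (x * x ≡ + 1 × y * y ≡ + 1)
    quartic₁-solutions {x} {y} {w} cop h = cases (parity x) (parity y)
      where
      cases : Even x ⊎ Odd x → Even y ⊎ Odd y → x ≡ + 0 ⊎ y ≡ + 0 ⊎ (x * x ≡ + 1 × y * y ≡ + 1)
      cases (inj₁ ex) (inj₁ ey) = ⊥-elim (even∧even⇒⊥ {x} {y} cop ex ey)
      cases (inj₁ ex) (inj₂ oy) = inj₁ (quartic₁-bounded (∣ x ∣) y x w ℕ.≤-refl oy ex (coprime-swap {x} {y} cop) (quartic-swap {x} {y} {w} h))
      cases (inj₂ ox) (inj₁ ey) = inj₂ (inj₁ (quartic₁-bounded (∣ y ∣) x y w ℕ.≤-refl ox ey cop h))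
      cases (inj₂ ox) (inj₂ oy) = inj₂ (inj₂ (abs (quartic₁-odd {+ ∣ x ∣} {y} {+ ∣ w ∣} (odd-abs ox) oy (_ , refl) (coprime-abs {x} {y} cop) (quartic-abs {+ 1} {x} {y} {w} h))))
        where
        abs : + ∣ x ∣ * + ∣ x ∣ ≡ + 1 × y * y ≡ + 1 → x * x ≡ + 1 × y * y ≡ + 1
        abs (hx , hy) = trans (sym (∣i∣*∣i∣≡i*i x)) hx , hy

  -- Rational solutions as fractions in lowest terms

  Form : ℤ → ℤ → ℤ → ℤ
  Form t m n = m * m - t * (m * n) + t * (n * n)

  opaque
    nonNeg+positive≢0 : ∀ {x k} → NonNeg x → x + + suc k ≢ + 0
    nonNeg+positive≢0 {_} {k} (n , refl) e = ℕ.1+n≢0 (trans (sym (ℕ.+-suc n k)) (ℤ.+-injective e))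

    -- For r = m / n the left side of the equation is n⁴ (r³ - t r² + t r). Modulo n the form is m²,
    -- so n is coprime to m and to the form, and each of the two factors is a square.
    denominator-square : ∀ t m k Z → Coprime m (+ suc k) → + suc k * (m * Form t m (+ suc k)) ≡ Z * Z →
      ∃₂ λ e f → + suc k ≡ e * e × m * Form t m (+ suc k) ≡ f * f
    denominator-square t m k Z cop h =
      let e , f , n≡ , M≡ , _ = square-factorsᶻ {+ suc k} {m * Form t m (+ suc k)} {Z} h (_ , refl) (nonNeg-cofactor {k} {m * Form t m (+ suc k)} (trans h (square-abs Z))) cop′
      in e , f , n≡ , M≡
      where
      m² : ∀ t m n → m * m ≡ + 1 * (m * m - t * (m * n) + t * (n * n)) + (t * m - t * n) * n
      m² = solve-∀
      cop′ : Coprime (+ suc k) (m * Form t m (+ suc k))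
      cop′ {p} pp p∣n p∣M = [ (λ p∣m → cop pp p∣m p∣n) , from-form ]′ (prime∣ᶻ* pp m (Form t m (+ suc k)) p∣M)
        where
        from-form : p ∣ᶻ Form t m (+ suc k) → ⊥
        from-form p∣Q = cop pp (prime∣ᶻsquare pp m (∣ᶻ-combine p∣Q p∣n (+ 1) (t * m - t * + suc k) (m² t m (+ suc k)))) p∣n

    coprime-roots : ∀ {x y a b} → x ≡ a * a → y ≡ b * b → Coprime x y → Coprime a b
    coprime-roots {a = a} {b} refl refl cop pp p∣a p∣b = cop pp (∣ᶻ-*ˡ a p∣a) (∣ᶻ-*ˡ b p∣b)

    form-quartic : ∀ {t m n g e w} → m ≡ g * g → n ≡ e * e → m * m - t * (m * n) + t * (n * n) ≡ w * w → Quartic t g e w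
    form-quartic {t} {_} {_} {g} {e} {w} refl refl h = combine₁ (+ 1) h (solve (t ∷ g ∷ e ∷ w ∷ []))

    negated-form-quartic₋₁ : ∀ m n g e w → - m ≡ g * g → n ≡ e * e → - (m * m - (- + 1) * (m * n) + (- + 1) * (n * n)) ≡ w * w → Quartic (- + 1) e g w
    negated-form-quartic₋₁ m _ g e w m≡ refl Q≡ = combine₂ (+ 1) (g * g - m - e * e) Q≡ m≡ (solve (m ∷ g ∷ e ∷ w ∷ []))

    swapped-form-quartic₃ : ∀ m n g e w → m ≡ g * g → n ≡ e * e → + 3 * (m * m) - + 3 * (m * n) + n * n ≡ w * w → Quartic (+ 3) e g w
    swapped-form-quartic₃ _ _ g e w refl refl Q≡ = combine₁ (+ 1) Q≡ (solve (g ∷ e ∷ w ∷ []))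

    positive-definite : ∀ {q k} x → NonNeg q → + 4 * q + x * x + + 3 * (+ suc k * + suc k) ≢ + 0
    positive-definite {q} {k} x q≥0 e = nonNeg+positive≢0 (nonNeg-+ (nonNeg-+ (nonNeg-* 4 q≥0) (nonNeg-square x)) (nonNeg-* 2 (nonNeg-square (+ suc k))))
      (trans (rearrange (+ 4 * q + x * x) (+ suc k * + suc k)) e)
      where
      rearrange : ∀ x y → x + + 2 * y + y ≡ x + + 3 * y
      rearrange = solve-∀

    0≢e*e : ∀ {k e} → + suc k ≡ e * e → e ≢ + 0
    0≢e*e h refl with () ← h

    root-0 : ∀ {m g} → m ≡ g * g → g ≡ + 0 → m ≡ + 0
    root-0 refl refl = refl

    -- For t = 1 and t = 3 the form has discriminant -3. Completing the square shows it positive, so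
    -- a negative numerator would give a negative square.
    negative-form⇒⊥ : ∀ t {k l f} s → + 4 * Form t -[1+ l ] (+ suc k) ≡ s * s + + 3 * (+ suc k * + suc k) → -[1+ l ] * Form t -[1+ l ] (+ suc k) ≢ f * f
    negative-form⇒⊥ t {k} {l} {f} s 4Q h = positive-definite {q} {k} s (nonNeg-cofactor {l} (trans (flip (+ suc l) Q) (trans h (square-abs f))))
        (combine₁ (- + 1) 4Q (vanish Q s (+ suc k)))
      where
      Q q : ℤ
      Q = Form t -[1+ l ] (+ suc k)
      q = - Q
      flip : ∀ a Q → a * - Q ≡ - a * Q
      flip = solve-∀
      vanish : ∀ Q s n → + 4 * - Q + s * s + + 3 * (n * n) - + 0 ≡ - + 1 * (+ 4 * Q - (s * s + + 3 * (n * n)))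
      vanish = solve-∀

    fractions₁ : ∀ m k Z → Coprime m (+ suc k) → + suc k * (m * Form (+ 1) m (+ suc k)) ≡ Z * Z → m ≡ + 0 ⊎ m ≡ + suc k
    fractions₁ m k Z cop h = let e , f , n≡ , M≡ = denominator-square (+ 1) m k Z cop h in go m cop e f n≡ M≡
      where
      n² : ∀ m n → n * n ≡ + 1 * (m * m - + 1 * (m * n) + + 1 * (n * n)) + (n - m) * m
      n² = solve-∀
      4Q : ∀ m n → + 4 * (m * m - + 1 * (m * n) + + 1 * (n * n)) ≡ (+ 2 * m - n) * (+ 2 * m - n) + + 3 * (n * n)
      4Q = solve-∀
      go : ∀ m → Coprime m (+ suc k) → ∀ e f → + suc k ≡ e * e → m * Form (+ 1) m (+ suc k) ≡ f * f → m ≡ + 0 ⊎ m ≡ + suc k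
      go (+ zero) _ _ _ _ _ = inj₁ refl
      go -[1+ l ] _ e f _ M≡ = ⊥-elim (negative-form⇒⊥ (+ 1) {k} {l} {f} (+ 2 * -[1+ l ] - + suc k) (4Q -[1+ l ] (+ suc k)) M≡)
      go m@(+ suc l) cop e f n≡ M≡ = roots (square-factorsᶻ {m} {Form (+ 1) m (+ suc k)} {f} M≡ (_ , refl) (nonNeg-cofactor {l} (trans M≡ (square-abs f)))
          λ pp p∣m p∣Q → cop pp p∣m (prime∣ᶻsquare pp (+ suc k) (∣ᶻ-combine p∣Q p∣m (+ 1) (+ suc k - m) (n² m (+ suc k)))))
        where
        roots : (∃₂ λ g w → m ≡ g * g × Form (+ 1) m (+ suc k) ≡ w * w × f ≡ g * w × NonNeg w) → m ≡ + 0 ⊎ m ≡ + suc k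
        roots (g , w , m≡ , Q≡ , _) = [ (λ g≡0 → inj₁ (root-0 {m} {g} m≡ g≡0)) , [ (λ e≡0 → ⊥-elim (0≢e*e {k} {e} n≡ e≡0)) , (λ (g² , e²) → inj₂ (trans (trans m≡ g²) (sym (trans n≡ e²)))) ]′ ]′
          (quartic₁-solutions {g} {e} {w} (coprime-roots {m} {+ suc k} {g} {e} m≡ n≡ cop) (form-quartic {+ 1} {m} {+ suc k} {g} {e} {w} m≡ n≡ Q≡))

    fractions₋₁ : ∀ m k Z → Coprime m (+ suc k) → + suc k * (m * Form (- + 1) m (+ suc k)) ≡ Z * Z → m ≡ + 0 ⊎ m ≡ + suc k ⊎ m ≡ - + suc k
    fractions₋₁ m k Z cop h = let e , f , n≡ , M≡ = denominator-square (- + 1) m k Z cop h in go m cop e f n≡ M≡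
      where
      n² : ∀ m n → n * n ≡ - + 1 * (m * m - (- + 1) * (m * n) + (- + 1) * (n * n)) + (n + m) * m
      n² = solve-∀
      flip : ∀ m Q → - m * - Q ≡ m * Q
      flip = solve-∀
      coprime : ∀ m → Coprime m (+ suc k) → Coprime m (Form (- + 1) m (+ suc k))
      coprime m cop pp p∣m p∣Q = cop pp p∣m (prime∣ᶻsquare pp (+ suc k) (∣ᶻ-combine p∣Q p∣m (- + 1) (+ suc k + m) (n² m (+ suc k))))
      go : ∀ m → Coprime m (+ suc k) → ∀ e f → + suc k ≡ e * e → m * Form (- + 1) m (+ suc k) ≡ f * f → m ≡ + 0 ⊎ m ≡ + suc k ⊎ m ≡ - + suc k
      go (+ zero) _ _ _ _ _ = inj₁ refl
      go m@(+ suc l) cop e f n≡ M≡ = roots (square-factorsᶻ {m} {Form (- + 1) m (+ suc k)} {f} M≡ (_ , refl) (nonNeg-cofactor {l} (trans M≡ (square-abs f))) (coprime m cop))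
        where
        roots : (∃₂ λ g w → m ≡ g * g × Form (- + 1) m (+ suc k) ≡ w * w × f ≡ g * w × NonNeg w) → m ≡ + 0 ⊎ m ≡ + suc k ⊎ m ≡ - + suc k
        roots (g , w , m≡ , Q≡ , _) = [ (λ e≡0 → ⊥-elim (0≢e*e {k} {e} n≡ e≡0)) , (λ (g² , e²) → inj₂ (inj₁ (trans (trans m≡ g²) (sym (trans n≡ e²))))) ]′
          (quartic₋₁-solutions {g} {e} {w} (coprime-roots {m} {+ suc k} {g} {e} m≡ n≡ cop) (form-quartic { - + 1} {m} {+ suc k} {g} {e} {w} m≡ n≡ Q≡))
      -- For t = -1 the form is indefinite and r may be negative. Then -1 / r = n / (- m), the
      -- translate of r by the 2-torsion point (0 , 0), is positive, and the quartic holds with `e`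
      -- and `g` exchanged.
      go m@(-[1+ l ]) cop e f n≡ M≡ = roots (square-factorsᶻ {+ suc l} { - Form (- + 1) m (+ suc k)} {f} M≡′ (_ , refl) (nonNeg-cofactor {l} (trans M≡′ (square-abs f))) cop′)
        where
        M≡′ : + suc l * - Form (- + 1) m (+ suc k) ≡ f * f
        M≡′ = trans (flip m (Form (- + 1) m (+ suc k))) M≡
        negate : ∀ {p} x → p ∣ᶻ - x → p ∣ᶻ x
        negate x h = ∣ᶻ-combine h h (- + 1) (+ 0) (solve (x ∷ []))
        cop′ : Coprime (+ suc l) (- Form (- + 1) m (+ suc k))
        cop′ pp p∣m p∣Q = coprime m cop pp (negate m p∣m) (negate (Form (- + 1) m (+ suc k)) p∣Q)
        cop″ : Coprime (+ suc k) (+ suc l)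
        cop″ pp p∣n p∣m = cop pp (negate m p∣m) p∣n
        roots : (∃₂ λ g w → + suc l ≡ g * g × - Form (- + 1) m (+ suc k) ≡ w * w × f ≡ g * w × NonNeg w) → m ≡ + 0 ⊎ m ≡ + suc k ⊎ m ≡ - + suc k
        roots (g , w , m≡ , Q≡ , _) = [ (λ g≡0 → ⊥-elim (0≢e*e {l} {g} m≡ g≡0)) , (λ (e² , g²) → inj₂ (inj₂ (cong -_ (trans (trans m≡ g²) (sym (trans n≡ e²)))))) ]′
          (quartic₋₁-solutions {e} {g} {w} (coprime-roots {+ suc k} {+ suc l} {e} {g} n≡ m≡ cop″) (negated-form-quartic₋₁ m (+ suc k) g e w m≡ n≡ Q≡))

    -- Modulo m the form is 3 n², so m and the form can share only the prime 3. If m = 3 m′, passing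
    -- to 3 / r = n / m′, again translation by (0 , 0), restores coprime factors, now with the roles
    -- of numerator and denominator exchanged.
    fractions₃ : ∀ m k Z → Coprime m (+ suc k) → + suc k * (m * Form (+ 3) m (+ suc k)) ≡ Z * Z → m ≡ + 0 ⊎ m ≡ + suc k ⊎ m ≡ + 3 * + suc k
    fractions₃ m k Z cop h = let e , f , n≡ , M≡ = denominator-square (+ 3) m k Z cop h in go m cop e f n≡ M≡
      where
      3n² : ∀ m n → + 3 * (n * n) ≡ + 1 * (m * m - + 3 * (m * n) + + 3 * (n * n)) + (+ 3 * n - m) * m
      3n² = solve-∀
      4Q : ∀ m n → + 4 * (m * m - + 3 * (m * n) + + 3 * (n * n)) ≡ (+ 2 * m - + 3 * n) * (+ 2 * m - + 3 * n) + + 3 * (n * n)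
      4Q = solve-∀
      divisible : ∀ m′ → Coprime (+ 3 * m′) (+ suc k) → ∀ e f → + suc k ≡ e * e → NonNeg (+ 3 * m′) → + 3 * m′ * Form (+ 3) (+ 3 * m′) (+ suc k) ≡ f * f →
        + 3 * m′ ≡ + 0 ⊎ + 3 * m′ ≡ + suc k ⊎ + 3 * m′ ≡ + 3 * + suc k
      divisible (+ zero) _ _ _ _ _ _ = inj₁ refl
      divisible -[1+ l ] _ _ _ _ (_ , ()) _
      divisible m′@(+ suc l) cop e f n≡ _ M≡ = with-root (prime∣ᶻsquare prime[3] f (mult (+ 3 * (m′ * (+ 3 * (m′ * m′) - + 3 * (m′ * + suc k) + + suc k * + suc k))) (trans (sym M≡) (expand m′ (+ suc k)))))
        where
        expand : ∀ m n → + 3 * m * (+ 3 * m * (+ 3 * m) - + 3 * (+ 3 * m * n) + + 3 * (n * n)) ≡ + 3 * (+ 3 * (m * (+ 3 * (m * m) - + 3 * (m * n) + n * n)))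
        expand = solve-∀
        Q′ : ℤ
        Q′ = + 3 * (m′ * m′) - + 3 * (m′ * + suc k) + + suc k * + suc k
        n² : ∀ m n → n * n ≡ + 1 * (+ 3 * (m * m) - + 3 * (m * n) + n * n) + (+ 3 * n - + 3 * m) * m
        n² = solve-∀
        cop′ : Coprime m′ Q′
        cop′ pp p∣m p∣Q = cop pp (∣ᶻ-*ˡ (+ 3) p∣m) (prime∣ᶻsquare pp (+ suc k) (∣ᶻ-combine p∣Q p∣m (+ 1) (+ 3 * + suc k - + 3 * m′) (n² m′ (+ suc k))))
        with-root : 3 ∣ᶻ f → + 3 * m′ ≡ + 0 ⊎ + 3 * m′ ≡ + suc k ⊎ + 3 * m′ ≡ + 3 * + suc k
        with-root (mult f′ f≡) = roots (square-factorsᶻ {m′} {Q′} {f′} M′≡ (_ , refl) (nonNeg-cofactor {l} (trans M′≡ (square-abs f′))) cop′)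
          where
          M′≡ : m′ * Q′ ≡ f′ * f′
          M′≡ = ℤ.*-cancelˡ-≡ (+ 3) (m′ * Q′) (f′ * f′) (ℤ.*-cancelˡ-≡ (+ 3) (+ 3 * (m′ * Q′)) (+ 3 * (f′ * f′))
            (trans (sym (expand m′ (+ suc k))) (trans M≡ (trans (cong₂ _*_ f≡ f≡) (rearrange f′)))))
            where
            rearrange : ∀ f → + 3 * f * (+ 3 * f) ≡ + 3 * (+ 3 * (f * f))
            rearrange = solve-∀
          roots : (∃₂ λ g w → m′ ≡ g * g × Q′ ≡ w * w × f′ ≡ g * w × NonNeg w) → + 3 * m′ ≡ + 0 ⊎ + 3 * m′ ≡ + suc k ⊎ + 3 * m′ ≡ + 3 * + suc k
          roots (g , w , m≡ , Q≡ , _) = [ (λ g≡0 → ⊥-elim (0≢e*e {l} {g} m≡ g≡0)) , (λ (e² , g²) → inj₂ (inj₂ (cong (+ 3 *_) (trans (trans m≡ g²) (sym (trans n≡ e²)))))) ]′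
            (quartic₃-solutions {e} {g} {w} (coprime-roots {+ suc k} {m′} {e} {g} n≡ m≡ (λ pp p∣n p∣m → cop pp (∣ᶻ-*ˡ (+ 3) p∣m) p∣n)) (swapped-form-quartic₃ m′ (+ suc k) g e w m≡ n≡ Q≡))
      go : ∀ m → Coprime m (+ suc k) → ∀ e f → + suc k ≡ e * e → m * Form (+ 3) m (+ suc k) ≡ f * f → m ≡ + 0 ⊎ m ≡ + suc k ⊎ m ≡ + 3 * + suc k
      go (+ zero) _ _ _ _ _ = inj₁ refl
      go -[1+ l ] _ e f _ M≡ = ⊥-elim (negative-form⇒⊥ (+ 3) {k} {l} {f} (+ 2 * -[1+ l ] - + 3 * + suc k) (4Q -[1+ l ] (+ suc k)) M≡)
      go m@(+ suc l) cop e f n≡ M≡ = by-3 (3 ℕ.∣? suc l)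
        where
        by-3 : Dec (3 ℕ.∣ suc l) → m ≡ + 0 ⊎ m ≡ + suc k ⊎ m ≡ + 3 * + suc k
        by-3 (yes h) = from-multiple (∣⇒∣ᶻ {3} {m} h)
          where
          from-multiple : 3 ∣ᶻ m → m ≡ + 0 ⊎ m ≡ + suc k ⊎ m ≡ + 3 * + suc k
          from-multiple (mult m′ m≡) = subst (λ m → m ≡ + 0 ⊎ m ≡ + suc k ⊎ m ≡ + 3 * + suc k) (sym m≡)
            (divisible m′ (subst (λ m → Coprime m (+ suc k)) m≡ cop) e f n≡ (_ , sym m≡) (subst (λ m → m * Form (+ 3) m (+ suc k) ≡ f * f) m≡ M≡))
        by-3 (no 3∤m) = roots (square-factorsᶻ {m} {Form (+ 3) m (+ suc k)} {f} M≡ (_ , refl) (nonNeg-cofactor {l} (trans M≡ (square-abs f))) cop′)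
          where
          cop′ : Coprime m (Form (+ 3) m (+ suc k))
          cop′ {p} pp p∣m p∣Q = [ p∤3 , (λ p∣n² → cop pp p∣m (prime∣ᶻsquare pp (+ suc k) p∣n²)) ]′
            (prime∣ᶻ* pp (+ 3) (+ suc k * + suc k) (∣ᶻ-combine p∣Q p∣m (+ 1) (+ 3 * + suc k - m) (3n² m (+ suc k))))
            where
            p∤3 : p ∣ᶻ + 3 → ⊥
            p∤3 h = 3∤m (subst (ℕ._∣ suc l) (prime∣prime⇒≡ pp prime[3] h) (∣ᶻ⇒∣ p∣m))
          roots : (∃₂ λ g w → m ≡ g * g × Form (+ 3) m (+ suc k) ≡ w * w × f ≡ g * w × NonNeg w) → m ≡ + 0 ⊎ m ≡ + suc k ⊎ m ≡ + 3 * + suc k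
          roots (g , w , m≡ , Q≡ , _) = [ (λ e≡0 → ⊥-elim (0≢e*e {k} {e} n≡ e≡0)) , (λ (g² , e²) → inj₂ (inj₁ (trans (trans m≡ g²) (sym (trans n≡ e²))))) ]′
            (quartic₃-solutions {g} {e} {w} (coprime-roots {m} {+ suc k} {g} {e} m≡ n≡ cop) (form-quartic {+ 3} {m} {+ suc k} {g} {e} {w} m≡ n≡ Q≡))

open import Defs
open import Data.Fin as Fin using (Fin; toℕ; fromℕ<)
import Data.Fin.Properties as Fin
open import Data.Integer using (ℤ; +_; -[1+_]; ∣_∣)
open import Data.Integer.Tactic.RingSolver using () renaming (solve-∀ to solve-∀ᶻ)
open import Data.Maybe using (Maybe; just; nothing)
open import Data.Nat.Coprimality as Coprimality using (Coprime; 1-coprimeTo)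
open import Data.Rational using (ℚ; 0ℚ; 1ℚ; _+_; _*_; _-_; -_; ≢-nonZero; mkℚ; toℚᵘ; ↥_; ↧_; _/_)
open import Data.Rational.Properties using (_≟_; +-*-commutativeRing; *-inverseʳ; +-inverseʳ; *-zeroʳ; *-distribˡ-+; toℚᵘ-injective; toℚᵘ-homo-+; toℚᵘ-homo-*; toℚᵘ-homo‿-)
import Data.Rational.Unnormalised as ℚᵘ
import Data.Rational.Unnormalised.Properties as ℚᵘ
open import Level using (0ℓ)
open import Tactic.RingSolver using (solve; solve-∀)
open import Tactic.RingSolver.Core.AlmostCommutativeRing using (AlmostCommutativeRing; fromCommutativeRing)

-- Field arithmetic in the rationals

opaque
  coprime-1 : ∀ n → Coprime n 1
  coprime-1 n = Coprimality.sym (1-coprimeTo n)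

ι : ℤ → ℚ
ι i = mkℚ i 0 (coprime-1 ∣ i ∣)

-- Equal to q n, but in constructor form: the ring solver normalises its numerals, which is expensive for q.
infix 20 #_
#_ : ℕ → ℚ
# n = ι (+ n)

0≟_ : ∀ x → Maybe (0ℚ ≡ x)
0≟ x with 0ℚ ≟ x
... | yes 0≡x = just 0≡x
... | no _    = nothing

ℚ-ring : AlmostCommutativeRing 0ℓ 0ℓ
ℚ-ring = fromCommutativeRing +-*-commutativeRing 0≟_

opaque
  x-y≡0⇒x≡y : ∀ {x y} → x - y ≡ 0ℚ → x ≡ y
  x-y≡0⇒x≡y {x} {y} e = trans (split x y) (trans (cong (_+ y) e) (zero+ y))
    where
    split : ∀ x y → x ≡ (x - y) + y
    split = solve-∀ ℚ-ring
    zero+ : ∀ y → 0ℚ + y ≡ y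
    zero+ = solve-∀ ℚ-ring

x≡y⇒x-y≡0 : ∀ {x y} → x ≡ y → x - y ≡ 0ℚ
x≡y⇒x-y≡0 {x} refl = +-inverseʳ x

-- Proofs by linear combination: L - R is exhibited as a combination of the differences of known equations.
opaque
  combine₁ : ∀ {L R a b} c → a ≡ b → L - R ≡ c * (a - b) → L ≡ R
  combine₁ c h e = x-y≡0⇒x≡y (trans e (trans (cong (c *_) (x≡y⇒x-y≡0 h)) (*-zeroʳ c)))

opaque
  combine₂ : ∀ {L R a b a′ b′} c c′ → a ≡ b → a′ ≡ b′ → L - R ≡ c * (a - b) + c′ * (a′ - b′) → L ≡ R
  combine₂ c c′ h h′ e = x-y≡0⇒x≡y (trans e (trans (cong₂ (λ u v → c * u + c′ * v) (x≡y⇒x-y≡0 h) (x≡y⇒x-y≡0 h′)) (zeros c c′)))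
    where
    zeros : ∀ c c′ → c * 0ℚ + c′ * 0ℚ ≡ 0ℚ
    zeros = solve-∀ ℚ-ring

opaque
  combine₃ : ∀ {L R a b a′ b′ a″ b″} c c′ c″ → a ≡ b → a′ ≡ b′ → a″ ≡ b″ →
             L - R ≡ c * (a - b) + c′ * (a′ - b′) + c″ * (a″ - b″) → L ≡ R
  combine₃ c c′ c″ h h′ h″ e = x-y≡0⇒x≡y (trans e (trans (cong₂ _+_ (cong₂ (λ u v → c * u + c′ * v) (x≡y⇒x-y≡0 h) (x≡y⇒x-y≡0 h′)) (cong (c″ *_) (x≡y⇒x-y≡0 h″))) (zeros c c′ c″)))
    where
    zeros : ∀ c c′ c″ → c * 0ℚ + c′ * 0ℚ + c″ * 0ℚ ≡ 0ℚ
    zeros = solve-∀ ℚ-ring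

inv-inverse : ∀ {x} → x ≢ 0ℚ → x * inv x ≡ 1ℚ
inv-inverse {x} x≢0 with x ≟ 0ℚ
... | yes x≡0 = ⊥-elim (x≢0 x≡0)
... | no  x≢0 = *-inverseʳ x {{≢-nonZero x≢0}}

opaque
  -- Behind the existential the inverse is a variable with one equation, which is all that the ring
  -- solver should see of `inv`.
  invertible : ∀ {x} → x ≢ 0ℚ → ∃ λ i → x * i ≡ 1ℚ
  invertible {x} x≢0 = inv x , inv-inverse x≢0

opaque
  *-cancelˡ : ∀ {x y z} → x ≢ 0ℚ → x * y ≡ x * z → y ≡ z
  *-cancelˡ {x} {y} {z} x≢0 h with invertible x≢0
  ... | i , xi≡1 = combine₂ i (z - y) h xi≡1 (solve (x ∷ y ∷ z ∷ i ∷ []) ℚ-ring)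

opaque
  x*y≡0⇒x≡0∨y≡0 : ∀ {x y} → x * y ≡ 0ℚ → x ≡ 0ℚ ⊎ y ≡ 0ℚ
  x*y≡0⇒x≡0∨y≡0 {x} h with x ≟ 0ℚ
  ... | yes x≡0 = inj₁ x≡0
  ... | no  x≢0 = inj₂ (*-cancelˡ x≢0 (trans h (sym (*-zeroʳ x))))

*-≢0 : ∀ {x y} → x ≢ 0ℚ → y ≢ 0ℚ → x * y ≢ 0ℚ
*-≢0 x≢0 y≢0 h with x*y≡0⇒x≡0∨y≡0 h
... | inj₁ x≡0 = x≢0 x≡0
... | inj₂ y≡0 = y≢0 y≡0

opaque
  x*x≡y*y⇒x≡y∨x+y≡0 : ∀ {x y} → x * x ≡ y * y → x ≡ y ⊎ x + y ≡ 0ℚ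
  x*x≡y*y⇒x≡y∨x+y≡0 {x} {y} h = map₁ x-y≡0⇒x≡y (x*y≡0⇒x≡0∨y≡0 product)
    where
    product : (x - y) * (x + y) ≡ 0ℚ
    product = combine₁ 1ℚ h (solve (x ∷ y ∷ []) ℚ-ring)

-- Lines and the required fragment of the group law

neg : Point → Point
neg O = O
neg (aff x y) = aff x (- y)

neg-neg : ∀ P → neg (neg P) ≡ P
neg-neg O = refl
neg-neg (aff x y) = cong (aff x) (involutive y)
  where
  involutive : ∀ y → - (- y) ≡ y
  involutive = solve-∀ ℚ-ring

infix 4 _≟ₚ_
_≟ₚ_ : (P Q : Point) → Dec (P ≡ Q)
O ≟ₚ O = yes refl
O ≟ₚ aff _ _ = no λ ()
aff _ _ ≟ₚ O = no λ ()
aff x y ≟ₚ aff x′ y′ with x ≟ x′ | y ≟ y′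
... | yes refl | yes refl = yes refl
... | no x≢x′  | _        = no λ { refl → x≢x′ refl }
... | yes _    | no y≢y′  = no λ { refl → y≢y′ refl }

add-O : ∀ {A B} P → add A B P O ≡ P
add-O O = refl
add-O (aff _ _) = refl

-- l is the slope of the line through two points of the curve; in the tangent case, where chord is void, the slope is determined by tangent.
record Line (A x₁ y₁ x₂ y₂ l : ℚ) : Set where
  constructor mkLine
  field
    chord   : l * (x₂ - x₁) ≡ y₂ - y₁
    tangent : l * (y₁ + y₂) ≡ x₁ * x₁ + x₁ * x₂ + x₂ * x₂ + A

record Opposite (x₁ y₁ x₂ y₂ : ℚ) : Set where
  constructor mkOpposite
  field
    same-x     : x₁ ≡ x₂
    opposite-y : y₁ + y₂ ≡ 0ℚ

data SumView (A x₁ y₁ x₂ y₂ : ℚ) : Set where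
  opposite : Opposite x₁ y₁ x₂ y₂ → SumView A x₁ y₁ x₂ y₂
  line     : ∀ l → Line A x₁ y₁ x₂ y₂ l → ¬ Opposite x₁ y₁ x₂ y₂ → SumView A x₁ y₁ x₂ y₂

opaque
  y+y≡0⇒y≡0 : ∀ {y} → y + y ≡ 0ℚ → y ≡ 0ℚ
  y+y≡0⇒y≡0 {y} h = *-cancelˡ {# 2} (λ ()) (trans (double y) h)
    where
    double : ∀ y → # 2 * y ≡ y + y
    double = solve-∀ ℚ-ring

opaque
  add-opposite : ∀ {A B x₁ y₁ x₂ y₂} → Opposite x₁ y₁ x₂ y₂ → add A B (aff x₁ y₁) (aff x₂ y₂) ≡ O
  add-opposite {x₁ = x₁} {y₁} {x₂} {y₂} (mkOpposite x₁≡x₂ h) with x₁ ≟ x₂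
  ... | no x₁≢x₂ = ⊥-elim (x₁≢x₂ x₁≡x₂)
  ... | yes _ with y₁ + y₂ ≟ 0ℚ
  ...   | yes _ = refl
  ...   | no y₁+y₂≢0 = ⊥-elim (y₁+y₂≢0 h)

opaque
  -- The two equations of `Line` determine the slope: `chord` if x₁ ≠ x₂, and otherwise `tangent`,
  -- since y₁ + y₂ is then nonzero. So `add` computes the same l in either branch, and later proofs
  -- need no division.
  add-line : ∀ {A B x₁ y₁ x₂ y₂ x₃ y₃} l → Line A x₁ y₁ x₂ y₂ l → ¬ Opposite x₁ y₁ x₂ y₂ →
             x₃ ≡ l * l - x₁ - x₂ → y₃ ≡ l * (x₁ - x₃) - y₁ →
             add A B (aff x₁ y₁) (aff x₂ y₂) ≡ aff x₃ y₃
  add-line {A} {B} {x₁} {y₁} {x₂} {y₂} l (mkLine ch tg) ¬opp x₃≡ y₃≡ with x₁ ≟ x₂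
  add-line {A} {B} {x₁} {y₁} {x₂} {y₂} l (mkLine ch tg) ¬opp refl refl | no x₁≢x₂ = cong (λ m → aff (m * m - x₁ - x₂) (m * (x₁ - (m * m - x₁ - x₂)) - y₁)) (slope _ (inv-inverse x₂-x₁≢0))
    where
    x₂-x₁≢0 : x₂ - x₁ ≢ 0ℚ
    x₂-x₁≢0 h = x₁≢x₂ (sym (x-y≡0⇒x≡y h))
    slope : ∀ i → (x₂ - x₁) * i ≡ 1ℚ → (y₂ - y₁) * i ≡ l
    slope i h = combine₂ (- i) l ch h (solve (x₁ ∷ x₂ ∷ y₁ ∷ y₂ ∷ l ∷ i ∷ []) ℚ-ring)
  add-line {A} {B} {x₁} {y₁} {x₂} {y₂} l (mkLine ch tg) ¬opp refl refl | yes refl with y₁ + y₂ ≟ 0ℚ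
  ... | yes h = ⊥-elim (¬opp (mkOpposite refl h))
  ... | no y₁+y₂≢0 = cong (λ m → aff (m * m - x₁ - x₁) (m * (x₁ - (m * m - x₁ - x₁)) - y₁)) (slope _ (inv-inverse (λ h → y₁+y₂≢0 (trans (double h) h))))
    where
    -- With equal abscissae the chord equation says y₁ = y₂.
    double : # 2 * y₁ ≡ 0ℚ → y₁ + y₂ ≡ # 2 * y₁
    double _ = combine₁ (- 1ℚ) ch (solve (x₁ ∷ y₁ ∷ y₂ ∷ l ∷ []) ℚ-ring)
    slope : ∀ i → # 2 * y₁ * i ≡ 1ℚ → (# 3 * x₁ * x₁ + A) * i ≡ l
    slope i h = combine₃ (- i) l (- (i * l)) tg h ch (solve (x₁ ∷ y₁ ∷ y₂ ∷ l ∷ i ∷ A ∷ []) ℚ-ring)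

opaque
  line-swap : ∀ {A x₁ y₁ x₂ y₂ l} → Line A x₁ y₁ x₂ y₂ l → Line A x₂ y₂ x₁ y₁ l
  line-swap {A} {x₁} {y₁} {x₂} {y₂} {l} (mkLine ch tg) = mkLine
    (combine₁ (- 1ℚ) ch (solve (x₁ ∷ y₁ ∷ x₂ ∷ y₂ ∷ l ∷ []) ℚ-ring))
    (combine₁ 1ℚ tg (solve (x₁ ∷ y₁ ∷ x₂ ∷ y₂ ∷ l ∷ A ∷ []) ℚ-ring))

opaque
  line-neg : ∀ {A x₁ y₁ x₂ y₂ l} → Line A x₁ y₁ x₂ y₂ l → Line A x₁ (- y₁) x₂ (- y₂) (- l)
  line-neg {A} {x₁} {y₁} {x₂} {y₂} {l} (mkLine ch tg) = mkLine
    (combine₁ (- 1ℚ) ch (solve (x₁ ∷ y₁ ∷ x₂ ∷ y₂ ∷ l ∷ []) ℚ-ring))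
    (combine₁ 1ℚ tg (solve (x₁ ∷ y₁ ∷ x₂ ∷ y₂ ∷ l ∷ A ∷ []) ℚ-ring))

opaque
  -- Reflecting the line through P and Q in the x-axis gives a line of slope -l through -P and P +
  -- Q.
  line-third : ∀ {A x₁ y₁ x₂ y₂ l} x₃ y₃ → Line A x₁ y₁ x₂ y₂ l →
               x₃ ≡ l * l - x₁ - x₂ → y₃ ≡ l * (x₁ - x₃) - y₁ → Line A x₁ (- y₁) x₃ y₃ (- l)
  line-third {A} {x₁} {y₁} {x₂} {y₂} {l} _ _ (mkLine ch tg) refl refl = mkLine
    (solve (x₁ ∷ y₁ ∷ x₂ ∷ l ∷ []) ℚ-ring)
    (combine₂ 1ℚ l tg ch (solve (x₁ ∷ y₁ ∷ x₂ ∷ y₂ ∷ l ∷ A ∷ []) ℚ-ring))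

opaque
  third-on-curve : ∀ {A B x₁ y₁ x₂ y₂ l} → OnCurve A B (aff x₁ y₁) → Line A x₁ y₁ x₂ y₂ l →
                   OnCurve A B (aff (l * l - x₁ - x₂) (l * (x₁ - (l * l - x₁ - x₂)) - y₁))
  third-on-curve {A} {B} {x₁} {y₁} {x₂} {y₂} {l} on (mkLine ch tg) =
    combine₃ 1ℚ (l * l - x₁ - x₂ - x₁) (l * (l * l - x₁ - x₂ - x₁)) on tg ch
      (solve (x₁ ∷ y₁ ∷ x₂ ∷ y₂ ∷ l ∷ A ∷ B ∷ []) ℚ-ring)

opaque
  -- For distinct abscissae `tangent` is the difference of the two curve equations divided by x₂ -
  -- x₁. For equal ones the points coincide or are opposite.
  sumView : ∀ {A B x₁ y₁ x₂ y₂} → OnCurve A B (aff x₁ y₁) → OnCurve A B (aff x₂ y₂) → SumView A x₁ y₁ x₂ y₂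
  sumView {A} {B} {x₁} {y₁} {x₂} {y₂} on₁ on₂ with x₁ ≟ x₂
  ... | no x₁≢x₂ = distinct (invertible (λ h → x₁≢x₂ (sym (x-y≡0⇒x≡y h))))
    where
    distinct : (∃ λ i → (x₂ - x₁) * i ≡ 1ℚ) → SumView A x₁ y₁ x₂ y₂
    distinct (i , h) = line ((y₂ - y₁) * i)
      (mkLine (combine₁ (y₂ - y₁) h (solve (x₁ ∷ y₁ ∷ x₂ ∷ y₂ ∷ i ∷ []) ℚ-ring))
              (combine₃ i (- i) (x₁ * x₁ + x₁ * x₂ + x₂ * x₂ + A) on₂ on₁ h
                (solve (x₁ ∷ y₁ ∷ x₂ ∷ y₂ ∷ i ∷ A ∷ B ∷ []) ℚ-ring)))
      (λ { (mkOpposite e _) → x₁≢x₂ e })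
  ... | yes refl with y₁ + y₂ ≟ 0ℚ
  ...   | yes h = opposite (mkOpposite refl h)
  ...   | no y₁+y₂≢0 with x*x≡y*y⇒x≡y∨x+y≡0 {y₁} {y₂} (trans on₁ (sym on₂))
  ...     | inj₂ h = opposite (mkOpposite refl h)
  ...     | inj₁ refl = same (invertible y₁+y₂≢0)
    where
    same : (∃ λ i → (y₁ + y₁) * i ≡ 1ℚ) → SumView A x₁ y₁ x₁ y₁
    same (i , h) = line ((# 3 * x₁ * x₁ + A) * i)
      (mkLine (solve (x₁ ∷ y₁ ∷ i ∷ A ∷ []) ℚ-ring)
              (combine₁ (# 3 * x₁ * x₁ + A) h (solve (x₁ ∷ y₁ ∷ i ∷ A ∷ []) ℚ-ring)))
      (λ { (mkOpposite _ e) → y₁+y₂≢0 e })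

opaque
  x≡x∧nonopposite⇒≡ : ∀ {A B x₁ y₁ x₂ y₂} → OnCurve A B (aff x₁ y₁) → OnCurve A B (aff x₂ y₂) →
                      ¬ Opposite x₁ y₁ x₂ y₂ → x₁ ≡ x₂ → aff x₁ y₁ ≡ aff x₂ y₂
  x≡x∧nonopposite⇒≡ {x₁ = x₁} {y₁} {_} {y₂} on₁ on₂ ¬opp refl with x*x≡y*y⇒x≡y∨x+y≡0 {y₁} {y₂} (trans on₁ (sym on₂))
  ... | inj₁ refl = refl
  ... | inj₂ h = ⊥-elim (¬opp (mkOpposite refl h))

-- The slopes of the four lines behind Q + 2R = R + (R + Q), where Q = (x₁ , y₁) and R = (x₂ , y₂), are rational in
-- x₁ - x₂, the slope l of QR and the slope m of the tangent at R: with k = l - m and d = x₁ - x₂ they are d / k - m and d / k - l.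
module Slopes {A x₁ y₁ x₂ y₂ l m s t : ℚ}
  (RQ : Line A x₂ y₂ x₁ y₁ l) (RR : Line A x₂ y₂ x₂ y₂ m)
  (QM : Line A x₁ y₁ (m * m - x₂ - x₂) (m * (x₂ - (m * m - x₂ - x₂)) - y₂) s) (RS : Line A x₂ y₂ (l * l - x₂ - x₁) (l * (x₂ - (l * l - x₂ - x₁)) - y₂) t)
  (x₁≢x₂ : x₁ ≢ x₂) (x₃≢x₂ : l * l - x₂ - x₁ ≢ x₂) (x₄≢x₁ : m * m - x₂ - x₂ ≢ x₁) where

  private
    x-y≢0 : ∀ {x y} → x ≢ y → x - y ≢ 0ℚ
    x-y≢0 x≢y h = x≢y (x-y≡0⇒x≡y h)

    -- The difference of the tangent equations of QR and of R, with y₁ eliminated by the chord. The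
    -- right side is a product of nonzero differences, so k is invertible.
    2yk : (y₂ + y₂) * (l - m) ≡ - ((x₁ - x₂) * (l * l - x₂ - x₁ - x₂))
    2yk = combine₃ 1ℚ l (- 1ℚ) (Line.tangent RQ) (Line.chord RQ) (Line.tangent RR)
            (solve (x₁ ∷ y₁ ∷ x₂ ∷ y₂ ∷ l ∷ m ∷ A ∷ []) ℚ-ring)

    k≢0 : l - m ≢ 0ℚ
    k≢0 h = *-≢0 (x-y≢0 x₁≢x₂) (x-y≢0 x₃≢x₂)
      (combine₂ 1ℚ (- (y₂ + y₂)) 2yk h (solve (x₁ ∷ y₁ ∷ x₂ ∷ y₂ ∷ l ∷ m ∷ []) ℚ-ring))

    tk : t * (l - m) ≡ - l * (l - m) + (x₁ - x₂)
    tk = *-cancelˡ (x-y≢0 x₃≢x₂) (combine₂ (l - m) (- 1ℚ) (Line.chord RS) 2yk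
           (solve (x₁ ∷ y₁ ∷ x₂ ∷ y₂ ∷ l ∷ m ∷ t ∷ []) ℚ-ring))

    sk : s * (l - m) ≡ - m * (l - m) + (x₁ - x₂)
    sk = *-cancelˡ (x-y≢0 x₄≢x₁) (combine₃ (l - m) (l - m) (- 1ℚ) (Line.chord QM) (Line.chord RQ) 2yk
           (solve (x₁ ∷ y₁ ∷ x₂ ∷ y₂ ∷ l ∷ m ∷ s ∷ []) ℚ-ring))

    s-t≡k : s - t ≡ l - m
    s-t≡k = *-cancelˡ k≢0 (combine₂ 1ℚ (- 1ℚ) sk tk (solve (x₁ ∷ x₂ ∷ l ∷ m ∷ s ∷ t ∷ []) ℚ-ring))

  same-x₅ : s * s - x₁ - (m * m - x₂ - x₂) ≡ t * t - x₂ - (l * l - x₂ - x₁)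
  same-x₅ = combine₃ (s + t) 1ℚ 1ℚ s-t≡k tk sk (solve (x₁ ∷ x₂ ∷ l ∷ m ∷ s ∷ t ∷ []) ℚ-ring)

  same-y₅ : s * (x₁ - (s * s - x₁ - (m * m - x₂ - x₂))) - y₁ ≡ t * (x₂ - (t * t - x₂ - (l * l - x₂ - x₁))) - y₂
  same-y₅ = trans (cong (λ x → s * (x₁ - x) - y₁) same-x₅)
    (combine₃ 1ℚ (x₁ - x₂ - (t * t - x₂ - (l * l - x₂ - x₁) - x₂)) (l - t) (Line.chord RQ) s-t≡k tk
      (solve (x₁ ∷ y₁ ∷ x₂ ∷ y₂ ∷ l ∷ m ∷ s ∷ t ∷ []) ℚ-ring))

module GroupLaw (A B : ℚ) (nonsingular : ∀ x → x * x * x + A * x + B ≡ 0ℚ → # 3 * x * x + A ≢ 0ℚ) where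

  infixl 6 _⊕_
  _⊕_ : Point → Point → Point
  P ⊕ Q = add A B P Q

  On : Point → Set
  On = OnCurve A B

  ⊕-closed : ∀ {P Q} → On P → On Q → On (P ⊕ Q)
  ⊕-closed {O} onP onQ = onQ
  ⊕-closed {aff _ _} {O} onP onQ = onP
  ⊕-closed {aff x₁ y₁} {aff x₂ y₂} onP onQ with sumView {A} {B} {x₁} {y₁} {x₂} {y₂} onP onQ
  ... | opposite opp = subst On (sym (add-opposite {A} {B} opp)) tt
  ... | line l ln ¬opp = subst On (sym (add-line {A} {B} l ln ¬opp refl refl)) (third-on-curve {A} {B} {x₁} {y₁} {x₂} {y₂} onP ln)

  neg-closed : ∀ {P} → On P → On (neg P)
  neg-closed {O} on = tt
  neg-closed {aff x y} on = trans (square y) on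
    where
    square : ∀ y → (- y) * (- y) ≡ y * y
    square = solve-∀ ℚ-ring

  ⊕-comm : ∀ {P Q} → On P → On Q → P ⊕ Q ≡ Q ⊕ P
  ⊕-comm {O} {Q} onP onQ = sym (add-O {A} {B} Q)
  ⊕-comm {aff _ _} {O} onP onQ = refl
  ⊕-comm {aff x₁ y₁} {aff x₂ y₂} onP onQ with sumView {A} {B} {x₁} {y₁} {x₂} {y₂} onP onQ
  ... | opposite opp@(mkOpposite refl h) = trans (add-opposite {A} {B} opp) (sym (add-opposite {A} {B} opp′))
    where
    opp′ : Opposite x₂ y₂ x₁ y₁
    opp′ = mkOpposite refl (combine₁ 1ℚ h (solve (y₁ ∷ y₂ ∷ []) ℚ-ring))
  ... | line l ln ¬opp = trans (add-line {A} {B} l ln ¬opp refl refl) (sym (add-line {A} {B} l (line-swap ln) ¬opp′ x₃≡ y₃≡))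
    where
    ¬opp′ : ¬ Opposite x₂ y₂ x₁ y₁
    ¬opp′ (mkOpposite refl h) = ¬opp (mkOpposite refl (combine₁ 1ℚ h (solve (y₁ ∷ y₂ ∷ []) ℚ-ring)))
    x₃≡ : l * l - x₁ - x₂ ≡ l * l - x₂ - x₁
    x₃≡ = solve (x₁ ∷ x₂ ∷ l ∷ []) ℚ-ring
    y₃≡ : l * (x₁ - (l * l - x₁ - x₂)) - y₁ ≡ l * (x₂ - (l * l - x₁ - x₂)) - y₂
    y₃≡ = combine₁ (- 1ℚ) (Line.chord ln) (solve (x₁ ∷ y₁ ∷ x₂ ∷ y₂ ∷ l ∷ []) ℚ-ring)

  neg-⊕ : ∀ {P Q} → On P → On Q → neg (P ⊕ Q) ≡ neg P ⊕ neg Q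
  neg-⊕ {O} onP onQ = refl
  neg-⊕ {aff _ _} {O} onP onQ = refl
  neg-⊕ {aff x₁ y₁} {aff x₂ y₂} onP onQ with sumView {A} {B} {x₁} {y₁} {x₂} {y₂} onP onQ
  ... | opposite opp@(mkOpposite e h) = trans (cong neg (add-opposite {A} {B} opp)) (sym (add-opposite {A} {B} opp′))
    where
    opp′ : Opposite x₁ (- y₁) x₂ (- y₂)
    opp′ = mkOpposite e (combine₁ (- 1ℚ) h (solve (y₁ ∷ y₂ ∷ []) ℚ-ring))
  ... | line l ln ¬opp = trans (cong neg (add-line {A} {B} l ln ¬opp refl refl)) (sym (add-line {A} {B} (- l) (line-neg ln) ¬opp′ x₃≡ y₃≡))
    where
    ¬opp′ : ¬ Opposite x₁ (- y₁) x₂ (- y₂)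
    ¬opp′ (mkOpposite e h) = ¬opp (mkOpposite e (combine₁ (- 1ℚ) h (solve (y₁ ∷ y₂ ∷ []) ℚ-ring)))
    x₃≡ : l * l - x₁ - x₂ ≡ (- l) * (- l) - x₁ - x₂
    x₃≡ = solve (x₁ ∷ x₂ ∷ l ∷ []) ℚ-ring
    y₃≡ : - (l * (x₁ - (l * l - x₁ - x₂)) - y₁) ≡ (- l) * (x₁ - (l * l - x₁ - x₂)) - (- y₁)
    y₃≡ = solve (x₁ ∷ x₂ ∷ l ∷ y₁ ∷ []) ℚ-ring

  ⊕-inverse : ∀ P → neg P ⊕ P ≡ O
  ⊕-inverse O = refl
  ⊕-inverse (aff x y) = add-opposite {A} {B} opp
    where
    opp : Opposite x (- y) x y
    opp = mkOpposite refl (solve (y ∷ []) ℚ-ring)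

  cancel : ∀ {P Q} → On P → On Q → neg P ⊕ (P ⊕ Q) ≡ Q
  cancel {O} onP onQ = refl
  cancel {aff x y} {O} onP onQ = ⊕-inverse (aff x y)
  cancel {aff x₁ y₁} {aff x₂ y₂} onP onQ with sumView {A} {B} {x₁} {y₁} {x₂} {y₂} onP onQ
  ... | opposite opp@(mkOpposite refl h) = trans (cong (aff x₁ (- y₁) ⊕_) (add-opposite {A} {B} opp)) (cong (aff x₁) -y₁≡y₂)
    where
    -y₁≡y₂ : - y₁ ≡ y₂
    -y₁≡y₂ = combine₁ (- 1ℚ) h (solve (y₁ ∷ y₂ ∷ []) ℚ-ring)
  ... | line l ln@(mkLine ch tg) ¬opp = trans (cong (aff x₁ (- y₁) ⊕_) (add-line {A} {B} l ln ¬opp refl refl))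
                                  (add-line {A} {B} (- l) (line-third x₃ y₃ ln refl refl) ¬opp′ x₂≡ y₂≡)
    where
    x₃ = l * l - x₁ - x₂
    y₃ = l * (x₁ - x₃) - y₁
    x₂≡ : x₂ ≡ (- l) * (- l) - x₁ - (l * l - x₁ - x₂)
    x₂≡ = solve (x₁ ∷ x₂ ∷ l ∷ []) ℚ-ring
    y₂≡ : y₂ ≡ (- l) * (x₁ - x₂) - (- y₁)
    y₂≡ = combine₁ (- 1ℚ) ch (solve (x₁ ∷ x₂ ∷ y₁ ∷ y₂ ∷ l ∷ []) ℚ-ring)
    -- An opposite pair here would mean P + Q = P. Then y₁ = 0, and the tangent equation gives 3 x₁²
    -- + A = 0, so P would be a singular point.
    ¬opp′ : ¬ Opposite x₁ (- y₁) x₃ y₃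
    ¬opp′ (mkOpposite e h) = nonsingular x₁ root (trans (sym (slope x₃ e)) (trans (cong (λ y → (- l) * (- y + y₃)) y₁≡0) (trans (cong (λ y → (- l) * y) y₃≡0) (zero-r l))))
      where
      zero-r : ∀ l → (- l) * 0ℚ ≡ 0ℚ
      zero-r = solve-∀ ℚ-ring
      y₁+y₁≡0 : ∀ x₃ → x₁ ≡ x₃ → - y₁ + (l * (x₁ - x₃) - y₁) ≡ 0ℚ → y₁ + y₁ ≡ 0ℚ
      y₁+y₁≡0 x₃ refl h = combine₁ (- 1ℚ) h (solve (x₁ ∷ y₁ ∷ l ∷ []) ℚ-ring)
      y₁≡0 : y₁ ≡ 0ℚ
      y₁≡0 = y+y≡0⇒y≡0 (y₁+y₁≡0 x₃ e h)
      y₃≡0 : - 0ℚ + y₃ ≡ 0ℚ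
      y₃≡0 = trans (cong (λ y → - y + y₃) (sym y₁≡0)) h
      slope : ∀ x → x₁ ≡ x → (- l) * (- y₁ + y₃) ≡ # 3 * x₁ * x₁ + A
      slope x e′ = trans (Line.tangent (line-third x₃ y₃ ln refl refl)) (collapse x₃ e)
        where
        collapse : ∀ x → x₁ ≡ x → x₁ * x₁ + x₁ * x + x * x + A ≡ # 3 * x₁ * x₁ + A
        collapse _ refl = solve (x₁ ∷ A ∷ []) ℚ-ring
      root : x₁ * x₁ * x₁ + A * x₁ + B ≡ 0ℚ
      root = trans (sym onP) (trans (cong (λ y → y * y) y₁≡0) refl)

  neg-unique : ∀ {x₁ y₁ x₂ y₂} → Opposite x₁ y₁ x₂ y₂ → aff x₁ y₁ ≡ neg (aff x₂ y₂)
  neg-unique {x₁} {y₁} {_} {y₂} (mkOpposite refl h) = cong (aff x₁) y₁≡-y₂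
    where
    y₁≡-y₂ : y₁ ≡ - y₂
    y₁≡-y₂ = combine₁ 1ℚ h (solve (y₁ ∷ y₂ ∷ []) ℚ-ring)

  ⊕-inverseʳ : ∀ P → P ⊕ neg P ≡ O
  ⊕-inverseʳ P = subst (λ X → X ⊕ neg P ≡ O) (neg-neg P) (⊕-inverse (neg P))

  cancel′ : ∀ {P Q} → On P → On Q → P ⊕ (neg P ⊕ Q) ≡ Q
  cancel′ {P} {Q} onP onQ = subst (λ X → X ⊕ (neg P ⊕ Q) ≡ Q) (neg-neg P) (cancel {neg P} {Q} (neg-closed {P} onP) onQ)

  -- The comparison of slopes needs distinct abscissae and no vertical line. The degenerate
  -- positions are Q = R, which is immediate, 2R = O, Q = -R and Q = -2R, which reduce to
  -- cancellation, and Q = 2R, which is excluded here and treated separately.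
  module _ {x₁ y₁ x₂ y₂ : ℚ} (onQ : On (aff x₁ y₁)) (onR : On (aff x₂ y₂)) where

    private
      Q = aff x₁ y₁
      R = aff x₂ y₂
      Goal : Set
      Goal = Q ⊕ (R ⊕ R) ≡ R ⊕ (R ⊕ Q)

      on-neg : On (neg R)
      on-neg = neg-closed {R} onR

      order-two : Opposite x₂ y₂ x₂ y₂ → Goal
      order-two opp = trans (cong (Q ⊕_) (add-opposite {A} {B} opp))
        (sym (subst (λ X → X ⊕ (R ⊕ Q) ≡ Q) (sym (neg-unique opp)) (cancel {R} {Q} onR onQ)))

      Q≡-R⇒goal : Q ≡ neg R → Goal
      Q≡-R⇒goal Q≡-R = trans (cong (_⊕ (R ⊕ R)) Q≡-R) (trans (cancel {R} {R} onR onR)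
        (sym (trans (cong (λ X → R ⊕ (R ⊕ X)) Q≡-R) (cong (R ⊕_) (⊕-inverseʳ R)))))

      Q≡-2R⇒goal : Q ≡ neg (R ⊕ R) → Goal
      Q≡-2R⇒goal Q≡-2R = trans (trans (cong (_⊕ (R ⊕ R)) Q≡-2R) (⊕-inverse (R ⊕ R)))
        (sym (trans (cong (λ X → R ⊕ (R ⊕ X)) (trans Q≡-2R (neg-⊕ {R} {R} onR onR)))
             (trans (cong (R ⊕_) (cancel′ {R} {neg R} onR on-neg)) (⊕-inverseʳ R))))

      Q≡-R+ : ∀ {S} → R ⊕ Q ≡ S → Q ≡ neg R ⊕ S
      Q≡-R+ e = trans (sym (cancel {R} {Q} onR onQ)) (cong (neg R ⊕_) e)

      distinct : R ⊕ R ≢ Q → ∀ {l m} → Line A x₂ y₂ x₁ y₁ l → ¬ Opposite x₂ y₂ x₁ y₁ → Line A x₂ y₂ x₂ y₂ m → ¬ Opposite x₂ y₂ x₂ y₂ → x₁ ≢ x₂ → Goal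
      distinct 2R≢Q {l} {m} RQ ¬RQ RR ¬RR x₁≢x₂ = viewQM (sumView {A} {B} onQ onM)
        where
        x₃ = l * l - x₂ - x₁
        y₃ = l * (x₂ - x₃) - y₂
        x₄ = m * m - x₂ - x₂
        y₄ = m * (x₂ - x₄) - y₂
        S = aff x₃ y₃
        M = aff x₄ y₄
        R+Q≡S : R ⊕ Q ≡ S
        R+Q≡S = add-line {A} {B} l RQ ¬RQ refl refl
        R+R≡M : R ⊕ R ≡ M
        R+R≡M = add-line {A} {B} m RR ¬RR refl refl
        onS : On S
        onS = third-on-curve {A} {B} {x₂} {y₂} {x₁} {y₁} onR RQ
        onM : On M
        onM = third-on-curve {A} {B} {x₂} {y₂} {x₂} {y₂} onR RR

        generic : ∀ {s t} → Line A x₁ y₁ x₄ y₄ s → ¬ Opposite x₁ y₁ x₄ y₄ → Line A x₂ y₂ x₃ y₃ t → ¬ Opposite x₂ y₂ x₃ y₃ → Goal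
        generic {s} {t} QM ¬QM RS ¬RS with x₃ ≟ x₂ | x₄ ≟ x₁
        ... | yes x₃≡x₂ | _ = ⊥-elim (aff≢O (trans (Q≡-R+ (trans R+Q≡S (sym (x≡x∧nonopposite⇒≡ {A} {B} onR onS ¬RS (sym x₃≡x₂))))) (⊕-inverse R)))
          where
          aff≢O : Q ≢ O
          aff≢O ()
        ... | no _ | yes x₄≡x₁ = ⊥-elim (2R≢Q (trans R+R≡M (sym (x≡x∧nonopposite⇒≡ {A} {B} onQ onM ¬QM (sym x₄≡x₁)))))
        ... | no x₃≢x₂ | no x₄≢x₁ =
          trans (cong (Q ⊕_) R+R≡M) (trans (add-line {A} {B} s QM ¬QM refl refl)
          (trans (cong₂ aff (Slopes.same-x₅ RQ RR QM RS x₁≢x₂ x₃≢x₂ x₄≢x₁) (Slopes.same-y₅ RQ RR QM RS x₁≢x₂ x₃≢x₂ x₄≢x₁))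
          (sym (trans (cong (R ⊕_) R+Q≡S) (add-line {A} {B} t RS ¬RS refl refl)))))

        viewRS : ∀ {s} → Line A x₁ y₁ x₄ y₄ s → ¬ Opposite x₁ y₁ x₄ y₄ → SumView A x₂ y₂ x₃ y₃ → Goal
        viewRS QM ¬QM (line t RS ¬RS) = generic QM ¬QM RS ¬RS
        viewRS QM ¬QM (opposite opp) = Q≡-2R⇒goal (trans (Q≡-R+ (trans R+Q≡S S≡-R)) (sym (neg-⊕ {R} {R} onR onR)))
          where
          S≡-R : S ≡ neg R
          S≡-R = trans (sym (neg-neg S)) (cong neg (sym (neg-unique opp)))

        viewQM : SumView A x₁ y₁ x₄ y₄ → Goal
        viewQM (line s QM ¬QM) = viewRS QM ¬QM (sumView {A} {B} onR onS)
        viewQM (opposite opp) = Q≡-2R⇒goal (trans (neg-unique opp) (cong neg (sym R+R≡M)))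

      views : R ⊕ R ≢ Q → SumView A x₂ y₂ x₁ y₁ → SumView A x₂ y₂ x₂ y₂ → Goal
      views _ (opposite opp) _ = Q≡-R⇒goal (trans (sym (neg-neg Q)) (cong neg (sym (neg-unique opp))))
      views _ (line _ _ _) (opposite opp) = order-two opp
      views 2R≢Q (line l RQ ¬RQ) (line m RR ¬RR) with x₁ ≟ x₂
      ... | no x₁≢x₂ = distinct 2R≢Q RQ ¬RQ RR ¬RR x₁≢x₂
      ... | yes x₁≡x₂ = subst (λ X → X ⊕ (R ⊕ R) ≡ R ⊕ (R ⊕ X)) (x≡x∧nonopposite⇒≡ {A} {B} onR onQ ¬RQ (sym x₁≡x₂)) refl

    double-assoc-affine : R ⊕ R ≢ Q → Q ⊕ (R ⊕ R) ≡ R ⊕ (R ⊕ Q)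
    double-assoc-affine 2R≢Q = views 2R≢Q (sumView {A} {B} onR onQ) (sumView {A} {B} onR onR)

  double-assoc-≢ : ∀ {Q R} → On Q → On R → R ⊕ R ≢ Q → Q ⊕ (R ⊕ R) ≡ R ⊕ (R ⊕ Q)
  double-assoc-≢ {O} {R} _ _ _ = cong (R ⊕_) (sym (add-O {A} {B} R))
  double-assoc-≢ {aff _ _} {O} _ _ _ = refl
  double-assoc-≢ {aff x₁ y₁} {aff x₂ y₂} onQ onR = double-assoc-affine {x₁} {y₁} {x₂} {y₂} onQ onR

  double-assoc : ∀ {Q R} → On Q → On R → Q ⊕ (R ⊕ R) ≡ R ⊕ (R ⊕ Q)
  double-assoc {Q} {R} onQ onR with R ⊕ R ≟ₚ Q
  ... | no 2R≢Q = double-assoc-≢ {Q} {R} onQ onR 2R≢Q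
  ... | yes refl with Q ⊕ Q ≟ₚ neg R
  -- Since Q = 2R, the claim for Q and R follows from the claim for - R and Q.
  ...   | no 2Q≢-R = begin
      Q ⊕ Q                       ≡⟨ cancel′ {R} {Q ⊕ Q} onR (⊕-closed {Q} {Q} onQ onQ) ⟨
      R ⊕ (neg R ⊕ (Q ⊕ Q))       ≡⟨ cong (R ⊕_) (double-assoc-≢ {neg R} {Q} (neg-closed {R} onR) onQ 2Q≢-R) ⟩
      R ⊕ (Q ⊕ (Q ⊕ neg R))       ≡⟨ cong (λ X → R ⊕ (Q ⊕ X)) (⊕-comm {Q} {neg R} onQ (neg-closed {R} onR)) ⟩
      R ⊕ (Q ⊕ (neg R ⊕ Q))       ≡⟨ cong (λ X → R ⊕ (Q ⊕ X)) (cancel {R} {R} onR onR) ⟩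
      R ⊕ (Q ⊕ R)                 ≡⟨ cong (R ⊕_) (⊕-comm {Q} {R} onQ onR) ⟩
      R ⊕ (R ⊕ Q)                 ∎
    where open ≡-Reasoning
  -- Now Q = 2R and 2Q = -R, so 5R = O, and both sides are shown equal by way of -R, using only
  -- cancellation and negation.
  ...   | yes 2Q≡-R = begin
      Q ⊕ Q                       ≡⟨ 2Q≡-R ⟩
      neg R                       ≡⟨ cong neg (cancel {R} {R} onR onR) ⟨
      neg (neg R ⊕ Q)             ≡⟨ neg-⊕ {neg R} {Q} (neg-closed {R} onR) onQ ⟩
      neg (neg R) ⊕ neg Q         ≡⟨ cong (_⊕ neg Q) (neg-neg R) ⟩
      R ⊕ neg Q                   ≡⟨ cong (λ X → R ⊕ neg X) (cancel {Q} {Q} onQ onQ) ⟨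
      R ⊕ neg (neg Q ⊕ (Q ⊕ Q))   ≡⟨ cong (λ X → R ⊕ neg (neg Q ⊕ X)) 2Q≡-R ⟩
      R ⊕ neg (neg Q ⊕ neg R)     ≡⟨ cong (λ X → R ⊕ neg X) (neg-⊕ {Q} {R} onQ onR) ⟨
      R ⊕ neg (neg (Q ⊕ R))       ≡⟨ cong (R ⊕_) (neg-neg (Q ⊕ R)) ⟩
      R ⊕ (Q ⊕ R)                 ≡⟨ cong (R ⊕_) (⊕-comm {Q} {R} onQ onR) ⟩
      R ⊕ (R ⊕ Q)                 ∎
    where open ≡-Reasoning

  infixr 7 _·_
  _·_ : ℕ → Point → Point
  _·_ = smul A B

  ·-closed : ∀ n {P} → On P → On (n · P)
  ·-closed zero onP = tt
  ·-closed (suc n) {P} onP = ⊕-closed {P} {n · P} onP (·-closed n {P} onP)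

  private
    ·-double-step : ∀ n {P} → On P → (n ℕ.+ n) · P ≡ n · P ⊕ n · P → (n ℕ.+ suc n) · P ≡ n · P ⊕ suc n · P
    ·-double-step n {P} onP e = begin
      (n ℕ.+ suc n) · P            ≡⟨ cong (_· P) (ℕ.+-suc n n) ⟩
      P ⊕ (n ℕ.+ n) · P            ≡⟨ cong (P ⊕_) e ⟩
      P ⊕ (n · P ⊕ n · P)          ≡⟨ double-assoc {P} {n · P} onP onR ⟩
      n · P ⊕ (n · P ⊕ P)          ≡⟨ cong (n · P ⊕_) (⊕-comm {n · P} {P} onR onP) ⟩
      n · P ⊕ suc n · P            ∎
      where
      open ≡-Reasoning
      onR = ·-closed n {P} onP

  -- In place of general associativity, n P is written as -P + S with S = (n + 1) P. Then S + (S -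
  -- P) = -P + 2S by `double-assoc`, and the outer P cancels.
  ·-double : ∀ n {P} → On P → (n ℕ.+ n) · P ≡ n · P ⊕ n · P
  ·-double zero onP = refl
  ·-double (suc n) {P} onP = begin
      P ⊕ (n ℕ.+ suc n) · P        ≡⟨ cong (P ⊕_) (·-double-step n {P} onP (·-double n {P} onP)) ⟩
      P ⊕ (n · P ⊕ S)              ≡⟨ cong (λ X → P ⊕ (X ⊕ S)) (cancel {P} {n · P} onP onR) ⟨
      P ⊕ ((neg P ⊕ S) ⊕ S)        ≡⟨ cong (P ⊕_) (⊕-comm {neg P ⊕ S} {S} (⊕-closed {neg P} {S} on-P onS) onS) ⟩
      P ⊕ (S ⊕ (neg P ⊕ S))        ≡⟨ cong (λ X → P ⊕ (S ⊕ X)) (⊕-comm {neg P} {S} on-P onS) ⟩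
      P ⊕ (S ⊕ (S ⊕ neg P))        ≡⟨ cong (P ⊕_) (double-assoc {neg P} {S} on-P onS) ⟨
      P ⊕ (neg P ⊕ (S ⊕ S))        ≡⟨ cancel′ {P} {S ⊕ S} onP (⊕-closed {S} {S} onS onS) ⟩
      S ⊕ S                        ∎
      where
      open ≡-Reasoning
      S = suc n · P
      onR = ·-closed n {P} onP
      onS = ·-closed (suc n) {P} onP
      on-P = neg-closed {P} onP

-- Integers in the rationals and the local ring at 2

opaque
  toℚᵘ-ι : ∀ i → toℚᵘ (ι i) ℚᵘ.≃ ℚᵘ.mkℚᵘ i 0
  toℚᵘ-ι i = ℚᵘ.≃-refl

  ι-injective : ∀ {i j} → ι i ≡ ι j → i ≡ j
  ι-injective {i} {j} e with ℚᵘ.≃-trans (ℚᵘ.≃-sym (toℚᵘ-ι i)) (ℚᵘ.≃-trans (ℚᵘ.≃-reflexive (cong toℚᵘ e)) (toℚᵘ-ι j))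
  ... | ℚᵘ.*≡* h = trans (sym (ℤ.*-identityʳ i)) (trans h (ℤ.*-identityʳ j))

  ι-+ : ∀ i j → ι (i ℤ.+ j) ≡ ι i + ι j
  ι-+ i j = toℚᵘ-injective (ℚᵘ.≃-trans (toℚᵘ-ι (i ℤ.+ j)) (ℚᵘ.≃-trans (ℚᵘ.*≡* (ident i j))
    (ℚᵘ.≃-sym (ℚᵘ.≃-trans (toℚᵘ-homo-+ (ι i) (ι j)) (ℚᵘ.+-cong (toℚᵘ-ι i) (toℚᵘ-ι j))))))
    where
    ident : ∀ i j → (i ℤ.+ j) ℤ.* + 1 ≡ (i ℤ.* + 1 ℤ.+ j ℤ.* + 1) ℤ.* + 1
    ident = solve-∀ᶻ

  ι-* : ∀ i j → ι (i ℤ.* j) ≡ ι i * ι j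
  ι-* i j = toℚᵘ-injective (ℚᵘ.≃-trans (toℚᵘ-ι (i ℤ.* j)) (ℚᵘ.≃-trans (ℚᵘ.*≡* refl)
    (ℚᵘ.≃-sym (ℚᵘ.≃-trans (toℚᵘ-homo-* (ι i) (ι j)) (ℚᵘ.*-cong (toℚᵘ-ι i) (toℚᵘ-ι j))))))

  ι-neg : ∀ i → ι (ℤ.- i) ≡ - ι i
  ι-neg i = toℚᵘ-injective (ℚᵘ.≃-trans (toℚᵘ-ι (ℤ.- i)) (ℚᵘ.≃-sym (ℚᵘ.≃-trans (toℚᵘ-homo‿- (ι i)) (ℚᵘ.-‿cong (toℚᵘ-ι i)))))

  p*↧p≡↥p : ∀ p → p * ι (↧ p) ≡ ι (↥ p)
  p*↧p≡↥p p@record{} = toℚᵘ-injective (ℚᵘ.≃-trans (toℚᵘ-homo-* p (ι (↧ p))) (ℚᵘ.≃-trans (ℚᵘ.*-cong (ℚᵘ.≃-refl {toℚᵘ p}) (toℚᵘ-ι (↧ p)))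
    (ℚᵘ.≃-trans (ℚᵘ.*≡* (ident (↥ p) (↧ p))) (ℚᵘ.≃-sym (toℚᵘ-ι (↥ p))))))
    where
    ident : ∀ i j → (i ℤ.* j) ℤ.* + 1 ≡ i ℤ.* (j ℤ.* + 1)
    ident = solve-∀ᶻ

Int : ℚ → Set
Int p = ∃ λ i → p ≡ ι i

-- Z₂ is the local ring of rationals with odd denominator; Even and Unit are its maximal ideal and its group of units.
record Z₂ (p : ℚ) : Set where
  constructor mkZ₂
  field
    d     : ℚ
    int-d : Int d
    int-p : Int (p * (1ℚ + # 2 * d))

record Even (p : ℚ) : Set where
  constructor mkEven
  field
    half    : ℚ
    Z₂-half : Z₂ half
    p≡      : p ≡ # 2 * half

record Unit (p : ℚ) : Set where
  constructor mkUnit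
  field
    half    : ℚ
    Z₂-half : Z₂ half
    p≡      : p ≡ 1ℚ + # 2 * half

opaque
  Int-# : ∀ n → Int (# n)
  Int-# n = + n , refl

  Int-+ : ∀ {p r} → Int p → Int r → Int (p + r)
  Int-+ (i , refl) (j , refl) = i ℤ.+ j , sym (ι-+ i j)

  Int-* : ∀ {p r} → Int p → Int r → Int (p * r)
  Int-* (i , refl) (j , refl) = i ℤ.* j , sym (ι-* i j)

  Int-neg : ∀ {p} → Int p → Int (- p)
  Int-neg (i , refl) = ℤ.- i , sym (ι-neg i)

opaque
  Int⇒Z₂ : ∀ {p} → Int p → Z₂ p
  Int⇒Z₂ {p} ip = mkZ₂ 0ℚ (Int-# 0) (subst Int (e p) ip)
    where
    e : ∀ p → p ≡ p * (1ℚ + # 2 * 0ℚ)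
    e = solve-∀ ℚ-ring

  Z₂-+ : ∀ {p r} → Z₂ p → Z₂ r → Z₂ (p + r)
  Z₂-+ {p} {r} (mkZ₂ d id ip) (mkZ₂ d′ id′ ir) =
    mkZ₂ (d + d′ + # 2 * (d * d′)) (Int-+ (Int-+ id id′) (Int-* (Int-# 2) (Int-* id id′)))
      (subst Int (e p r d d′) (Int-+ (Int-* ip (Int-+ (Int-# 1) (Int-* (Int-# 2) id′))) (Int-* ir (Int-+ (Int-# 1) (Int-* (Int-# 2) id)))))
    where
    e : ∀ p r d d′ → p * (1ℚ + # 2 * d) * (1ℚ + # 2 * d′) + r * (1ℚ + # 2 * d′) * (1ℚ + # 2 * d) ≡ (p + r) * (1ℚ + # 2 * (d + d′ + # 2 * (d * d′)))
    e = solve-∀ ℚ-ring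

  Z₂-* : ∀ {p r} → Z₂ p → Z₂ r → Z₂ (p * r)
  Z₂-* {p} {r} (mkZ₂ d id ip) (mkZ₂ d′ id′ ir) =
    mkZ₂ (d + d′ + # 2 * (d * d′)) (Int-+ (Int-+ id id′) (Int-* (Int-# 2) (Int-* id id′))) (subst Int (e p r d d′) (Int-* ip ir))
    where
    e : ∀ p r d d′ → p * (1ℚ + # 2 * d) * (r * (1ℚ + # 2 * d′)) ≡ (p * r) * (1ℚ + # 2 * (d + d′ + # 2 * (d * d′)))
    e = solve-∀ ℚ-ring

  Z₂-neg : ∀ {p} → Z₂ p → Z₂ (- p)
  Z₂-neg {p} (mkZ₂ d id ip) = mkZ₂ d id (subst Int (e p d) (Int-neg ip))
    where
    e : ∀ p d → - (p * (1ℚ + # 2 * d)) ≡ - p * (1ℚ + # 2 * d)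
    e = solve-∀ ℚ-ring

  Z₂-# : ∀ n → Z₂ (# n)
  Z₂-# n = Int⇒Z₂ (Int-# n)

opaque
  Unit⇒Z₂ : ∀ {p} → Unit p → Z₂ p
  Unit⇒Z₂ (mkUnit h zh refl) = Z₂-+ (Z₂-# 1) (Z₂-* (Z₂-# 2) zh)

  Even⇒Z₂ : ∀ {p} → Even p → Z₂ p
  Even⇒Z₂ (mkEven h zh refl) = Z₂-* (Z₂-# 2) zh

  Even-2* : ∀ {p} → Z₂ p → Even (# 2 * p)
  Even-2* {p} zp = mkEven p zp refl

  Even-+ : ∀ {p r} → Even p → Even r → Even (p + r)
  Even-+ (mkEven h zh refl) (mkEven k zk refl) = mkEven (h + k) (Z₂-+ zh zk) (solve (h ∷ k ∷ []) ℚ-ring)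

  Even-*ʳ : ∀ {p r} → Even p → Z₂ r → Even (p * r)
  Even-*ʳ {_} {r} (mkEven h zh refl) zr = mkEven (h * r) (Z₂-* zh zr) (solve (h ∷ r ∷ []) ℚ-ring)

  Even-*ˡ : ∀ {p r} → Z₂ p → Even r → Even (p * r)
  Even-*ˡ {p} zp (mkEven h zh refl) = mkEven (p * h) (Z₂-* zp zh) (solve (p ∷ h ∷ []) ℚ-ring)

  Even-neg : ∀ {p} → Even p → Even (- p)
  Even-neg (mkEven h zh refl) = mkEven (- h) (Z₂-neg zh) (solve (h ∷ []) ℚ-ring)

  Unit-+ : ∀ {p r} → Unit p → Even r → Unit (p + r)
  Unit-+ (mkUnit h zh refl) (mkEven k zk refl) = mkUnit (h + k) (Z₂-+ zh zk) (solve (h ∷ k ∷ []) ℚ-ring)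

  Unit-* : ∀ {p r} → Unit p → Unit r → Unit (p * r)
  Unit-* (mkUnit h zh refl) (mkUnit k zk refl) = mkUnit (h + k + # 2 * (h * k)) (Z₂-+ (Z₂-+ zh zk) (Z₂-* (Z₂-# 2) (Z₂-* zh zk))) (solve (h ∷ k ∷ []) ℚ-ring)

  Unit-neg : ∀ {p} → Unit p → Unit (- p)
  Unit-neg (mkUnit h zh refl) = mkUnit (- h - 1ℚ) (Z₂-+ (Z₂-neg zh) (Z₂-neg (Z₂-# 1))) (solve (h ∷ []) ℚ-ring)

  Unit-odd : ∀ n → Unit (1ℚ + # 2 * # n)
  Unit-odd n = mkUnit (# n) (Z₂-# n) refl

  Unit-inverse : ∀ {p i} → Unit p → p * i ≡ 1ℚ → Unit i
  Unit-inverse {_} {i} (mkUnit h (mkZ₂ d id ie) refl) pi≡1 =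
    -- From (1 + 2 h) i = 1 follows i = 1 - 2 h i. If the odd integer 1 + 2 d clears h, then (1 + 2
    -- d) (1 + 2 h) is again an odd integer, and it clears h i.
    mkUnit (- (h * i))
      (mkZ₂ (d + h * (1ℚ + # 2 * d)) (Int-+ id ie) (subst Int e (Int-neg ie)))
      (combine₁ 1ℚ pi≡1 (solve (h ∷ i ∷ []) ℚ-ring))
    where
    e : - (h * (1ℚ + # 2 * d)) ≡ - (h * i) * (1ℚ + # 2 * (d + h * (1ℚ + # 2 * d)))
    e = combine₁ (h * (1ℚ + # 2 * d)) pi≡1 (solve (h ∷ i ∷ d ∷ []) ℚ-ring)

  -- A common value would put 1/2 into `Z₂`, and clearing its odd denominator would make an even
  -- integer odd.
  even∧unit⇒⊥ : ∀ {p} → Even p → Unit p → ⊥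
  even∧unit⇒⊥ {p} (mkEven h zh e) (mkUnit k zk e′) = half∉ (Z₂-+ zh (Z₂-neg zk)) (combine₂ (- 1ℚ) 1ℚ e e′ (solve (p ∷ h ∷ k ∷ []) ℚ-ring))
    where
    half∉ : ∀ {g} → Z₂ g → # 2 * g ≢ 1ℚ
    half∉ {g} (mkZ₂ _ (n , refl) (m , e)) 2g≡1 = Descent.even∧odd⇒⊥ {+ 2 ℤ.* m} (m , refl) (n , ι-injective (trans (ι-* (+ 2) m)
      (trans (trans (cong (# 2 *_) (sym e)) double) (trans (cong (λ x → 1ℚ + x) (sym (ι-* (+ 2) n))) (sym (ι-+ (+ 1) (+ 2 ℤ.* n)))))))
      where
      double′ : ∀ d → # 2 * (g * (1ℚ + # 2 * d)) ≡ 1ℚ + # 2 * d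
      double′ d = combine₁ (1ℚ + # 2 * d) 2g≡1 (solve (g ∷ d ∷ []) ℚ-ring)
      double : # 2 * (g * (1ℚ + # 2 * ι n)) ≡ 1ℚ + # 2 * ι n
      double = double′ (ι n)

data TwoAdic (p : ℚ) : Set where
  even : Even p → TwoAdic p
  unit : Unit p → TwoAdic p
  pole : ∀ e → p * e ≡ 1ℚ → Even e → TwoAdic p

opaque
  twoAdic : ∀ p → TwoAdic p
  twoAdic p@(mkℚ n d c) = cases (Descent.parity n) (Descent.parity (+ suc d))
    where
    ½ : ℚ
    ½ = + 1 / 2
    ι-odd : ∀ k → ι (+ 1 ℤ.+ + 2 ℤ.* k) ≡ 1ℚ + # 2 * ι k
    ι-odd k = trans (ι-+ (+ 1) (+ 2 ℤ.* k)) (cong (λ x → 1ℚ + x) (ι-* (+ 2) k))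
    h-even : ∀ p j k → p * (1ℚ + # 2 * j) ≡ # 2 * k → k ≡ (½ * p) * (1ℚ + # 2 * j)
    h-even p j k e = combine₁ (- ½) e (solve (p ∷ j ∷ k ∷ []) ℚ-ring)
    h-odd : ∀ p j k → p * (1ℚ + # 2 * j) ≡ 1ℚ + # 2 * k → k - j ≡ (½ * (p - 1ℚ)) * (1ℚ + # 2 * j)
    h-odd p j k e = combine₁ (- ½) e (solve (p ∷ j ∷ k ∷ []) ℚ-ring)
    h-pole : ∀ p i j k → p * (# 2 * j) ≡ 1ℚ + # 2 * k → p * i ≡ 1ℚ → j ≡ (½ * i) * (1ℚ + # 2 * k)
    h-pole p i j k e pi≡1 = combine₂ (½ * i) (- j) e pi≡1 (solve (p ∷ i ∷ j ∷ k ∷ []) ℚ-ring)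
    2½ : ∀ p → p ≡ # 2 * (½ * p)
    2½ = solve-∀ ℚ-ring
    2½′ : ∀ p → p ≡ 1ℚ + # 2 * (½ * (p - 1ℚ))
    2½′ = solve-∀ ℚ-ring
    odd-denominator : ∀ {j v} → + suc d ≡ + 1 ℤ.+ + 2 ℤ.* j → ι n ≡ v → p * (1ℚ + # 2 * ι j) ≡ v
    odd-denominator {j} hd hn = trans (cong (p *_) (trans (sym (ι-odd j)) (cong ι (sym hd)))) (trans (p*↧p≡↥p p) hn)
    even-denominator : ∀ {j v} → + suc d ≡ + 2 ℤ.* j → ι n ≡ v → p * (# 2 * ι j) ≡ v
    even-denominator {j} hd hn = trans (cong (p *_) (trans (sym (ι-* (+ 2) j)) (cong ι (sym hd)))) (trans (p*↧p≡↥p p) hn)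
    cases : Descent.Even n ⊎ Descent.Odd n → Descent.Even (+ suc d) ⊎ Descent.Odd (+ suc d) → TwoAdic p
    cases (inj₁ (k , hn)) (inj₂ (j , hd)) = even (mkEven (½ * p) (mkZ₂ (ι j) (j , refl) (k , sym (h-even p (ι j) (ι k) (odd-denominator {j} hd (trans (cong ι hn) (ι-* (+ 2) k)))))) (2½ p))
    cases (inj₂ (k , hn)) (inj₂ (j , hd)) = unit (mkUnit (½ * (p - 1ℚ)) (mkZ₂ (ι j) (j , refl)
      (subst Int (h-odd p (ι j) (ι k) (odd-denominator {j} hd (trans (cong ι hn) (ι-odd k)))) (Int-+ (k , refl) (Int-neg (j , refl))))) (2½′ p))
    cases (inj₂ (k , hn)) (inj₁ (j , hd)) = from-inverse (invertible p≢0)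
      where
      p≢0 : p ≢ 0ℚ
      p≢0 p≡0 = Descent.even∧odd⇒⊥ {+ 0} (+ 0 , refl) (k , trans (sym (cong ↥_ p≡0)) hn)
      from-inverse : (∃ λ i → p * i ≡ 1ℚ) → TwoAdic p
      from-inverse (i , pi≡1) = pole i pi≡1 (mkEven (½ * i) (mkZ₂ (ι k) (k , refl) (j , sym (h-pole p i (ι j) (ι k) (even-denominator {j} hd (trans (cong ι hn) (ι-odd k))) pi≡1))) (2½ i))
    cases (inj₁ (k , hn)) (inj₁ (j , hd)) = ⊥-elim-irr (absurd (c (two∣ k hn , two∣ j hd)))
      where
      two∣ : ∀ {x} k → x ≡ + 2 ℤ.* k → 2 ℕ.∣ ℤ.∣ x ∣
      two∣ k refl = ℕ.divides ℤ.∣ k ∣ (trans (ℤ.abs-* (+ 2) k) (ℕ.*-comm 2 ℤ.∣ k ∣))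
      absurd : 2 ≢ 1
      absurd ()

-- Growth under doubling and infinite order

infixr 8 4^_
4^_ : ℕ → ℚ
4^ zero = 1ℚ
4^ suc k = # 4 * 4^ k

2^_ : ℕ → ℕ
2^ zero = 1
2^ suc k = 2^ k ℕ.+ 2^ k

opaque
  Z₂-4^ : ∀ k → Z₂ (4^ k)
  Z₂-4^ zero = Z₂-# 1
  Z₂-4^ (suc k) = Z₂-* (Z₂-# 4) (Z₂-4^ k)

  -- Passing from i to j multiplies the unit by a positive power of 4, so the exponent is determined
  -- by `w`.
  4^-level-≮ : ∀ {i j w} → i ℕ.< j → Unit (4^ i * w) → ¬ Unit (4^ j * w)
  4^-level-≮ {i} {j} {w} i<j ui uj with ℕ.m≤n⇒∃[o]m+o≡n i<j
  ... | k , refl = even∧unit⇒⊥ (subst Even (e k) (Even-*ˡ (Z₂-4^ k) (Even-*ʳ (mkEven (# 2) (Z₂-# 2) refl) (Unit⇒Z₂ ui)))) uj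
    where
    4^-+ : ∀ i k → 4^ (i ℕ.+ k) ≡ 4^ k * 4^ i
    4^-+ zero k = sym (one (4^ k))
      where
      one : ∀ x → x * 1ℚ ≡ x
      one = solve-∀ ℚ-ring
    4^-+ (suc i) k = trans (cong (# 4 *_) (4^-+ i k)) (swap (4^ k) (4^ i))
      where
      swap : ∀ x y → # 4 * (x * y) ≡ x * (# 4 * y)
      swap = solve-∀ ℚ-ring
    e : ∀ k → 4^ k * (# 4 * (4^ i * w)) ≡ 4^ (suc i ℕ.+ k) * w
    e k = trans (assoc (4^ k) (4^ i) w) (cong (_* w) (sym (4^-+ (suc i) k)))
      where
      assoc : ∀ x y w → x * (# 4 * (y * w)) ≡ x * (# 4 * y) * w
      assoc = solve-∀ ℚ-ring

-- Close to the origin in the 2-adic sense, duplication multiplies the x-coordinate by a unit divided by 4. The factor K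
-- scales x to a unit; the coefficients are then even in the scaled model.
module _ {A B : ℚ} where

  Near : ℚ → ℚ → Set
  Near c x = Even (A * (c * c)) × Even (B * (c * c * c)) × Unit (c * x)

  opaque
    cubic-unit : ∀ {c x} → Near c x → Unit (c * c * c * (x * x * x + A * x + B))
    cubic-unit {c} {x} (a , b , u) = subst Unit (e c x A B) (Unit-+ (Unit-+ (Unit-* (Unit-* u u) u) (Even-*ʳ a (Unit⇒Z₂ u))) b)
      where
      e : ∀ c x A B → c * x * (c * x) * (c * x) + A * (c * c) * (c * x) + B * (c * c * c) ≡ c * c * c * (x * x * x + A * x + B)
      e = solve-∀ ℚ-ring

    near⇒y≢0 : ∀ {c x y} → Near c x → OnCurve A B (aff x y) → y ≢ 0ℚ
    near⇒y≢0 {c} {x} {y} near on refl = even∧unit⇒⊥ (subst Even (e c) (mkEven 0ℚ (Z₂-# 0) refl)) (subst (λ z → Unit (c * c * c * z)) (sym on) (cubic-unit {c} {x} near))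
      where
      e : ∀ c → 0ℚ ≡ c * c * c * (0ℚ * 0ℚ)
      e = solve-∀ ℚ-ring

    -- With X = c x and D = c³ y², the duplication formula reads 4 c x₃ = ((3 X² + A c²)² - 8 X D) /
    -- D. Both numerator and denominator are units.
    near-double : ∀ {c x y l} → Near c x → OnCurve A B (aff x y) → Line A x y x y l → Near (# 4 * c) (l * l - x - x)
    near-double {c} {x} {y} {l} near@(a , b , u) on ln =
      subst Even (eA A c) (Even-*ˡ (Z₂-# 16) a) , subst Even (eB B c) (Even-*ˡ (Z₂-# 64) b) , from-inverse (invertible c³y²≢0)
      where
      eA : ∀ A c → # 16 * (A * (c * c)) ≡ A * (# 4 * c * (# 4 * c))
      eA = solve-∀ ℚ-ring
      eB : ∀ B c → # 64 * (B * (c * c * c)) ≡ B * (# 4 * c * (# 4 * c) * (# 4 * c))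
      eB = solve-∀ ℚ-ring
      D : ℚ
      D = c * c * c * (y * y)
      uD : Unit D
      uD = subst (λ z → Unit (c * c * c * z)) (sym on) (cubic-unit {c} {x} near)
      c³y²≢0 : D ≢ 0ℚ
      c³y²≢0 h = even∧unit⇒⊥ (mkEven 0ℚ (Z₂-# 0) h) uD
      t : ℚ
      t = # 3 * (c * x * (c * x)) + A * (c * c)
      ut : Unit t
      ut = Unit-+ (Unit-* (Unit-odd 1) (Unit-* u u)) a
      N : ℚ
      N = t * t + - (# 2 * (# 4 * (c * x * D)))
      uN : Unit N
      uN = Unit-+ (Unit-* ut ut) (Even-neg (Even-2* (Z₂-* (Z₂-# 4) (Z₂-* (Unit⇒Z₂ u) (Unit⇒Z₂ uD)))))
      tangent : l * (# 2 * y) ≡ # 3 * (x * x) + A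
      tangent = combine₁ 1ℚ (Line.tangent ln) (solve (x ∷ y ∷ l ∷ A ∷ []) ℚ-ring)
      ident : ∀ i → c * c * c * (y * y) * i ≡ 1ℚ →
        ((# 3 * (c * x * (c * x)) + A * (c * c)) * (# 3 * (c * x * (c * x)) + A * (c * c)) + - (# 2 * (# 4 * (c * x * (c * c * c * (y * y)))))) * i ≡ # 4 * c * (l * l - x - x)
      ident i h = combine₂ (- (i * (c * c * c * c) * (l * (# 2 * y) + (# 3 * (x * x) + A)))) (# 4 * c * (l * l - x - x)) tangent h
        (solve (x ∷ y ∷ l ∷ c ∷ i ∷ A ∷ []) ℚ-ring)
      from-inverse : (∃ λ i → D * i ≡ 1ℚ) → Unit (# 4 * c * (l * l - x - x))
      from-inverse (i , h) = subst Unit (ident i h) (Unit-* uN (Unit-inverse uD h))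

module InfiniteOrder (A B : ℚ) (nonsingular : ∀ x → x * x * x + A * x + B ≡ 0ℚ → # 3 * x * x + A ≢ 0ℚ) where
  open GroupLaw A B nonsingular

  opaque
    periodic : ∀ N {P} → suc N · P ≡ O → ∀ m → (m ℕ.% suc N) · P ≡ m · P
    periodic N {P} e m = trans (sym (+-period (m ℕ./ suc N) (m ℕ.% suc N))) (cong (_· P) (sym (ℕ.m≡m%n+[m/n]*n m (suc N))))
      where
      +-period₁ : ∀ m → (m ℕ.+ suc N) · P ≡ m · P
      +-period₁ zero = e
      +-period₁ (suc m) = cong (P ⊕_) (+-period₁ m)
      +-period : ∀ k m → (m ℕ.+ k ℕ.* suc N) · P ≡ m · P
      +-period zero m = cong (_· P) (ℕ.+-identityʳ m)
      +-period (suc k) m = trans (cong (_· P) (sym (ℕ.+-assoc m (suc N) (k ℕ.* suc N))))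
        (trans (+-period k (m ℕ.+ suc N)) (+-period₁ m))

    Level : ℚ → ℕ → Point → Set
    Level K k P = ∃ λ x → ∃ λ y → P ≡ aff x y × Near {A} {B} (4^ k * K) x

    level-double : ∀ {K k P} → On P → Level K k P → Level K (suc k) (P ⊕ P)
    level-double {K} {k} onP (x , y , refl , near) = doubled (sumView {A} {B} {x} {y} {x} {y} onP onP)
      where
      doubled : SumView A x y x y → Level K (suc k) (aff x y ⊕ aff x y)
      doubled (opposite (mkOpposite _ h)) = ⊥-elim (near⇒y≢0 {A} {B} {4^ k * K} {x} {y} near onP (y+y≡0⇒y≡0 h))
      doubled (line l ln ¬opp) = _ , _ , add-line {A} {B} l ln ¬opp refl refl ,
        subst (λ c → Near {A} {B} c (l * l - x - x)) (assoc (4^ k) K) (near-double {A} {B} {4^ k * K} {x} {y} near onP ln)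
        where
        assoc : ∀ u v → # 4 * (u * v) ≡ # 4 * u * v
        assoc = solve-∀ ℚ-ring

    level-2^ : ∀ {K P} → On P → Level K 0 P → ∀ k → Level K k (2^ k · P)
    level-2^ {K} {P} onP lv zero = subst (Level K 0) (sym (add-O {A} {B} P)) lv
    level-2^ {K} {P} onP lv (suc k) = subst (Level K (suc k)) (sym (·-double (2^ k) {P} onP)) (level-double {K} {k} {2^ k · P} (·-closed (2^ k) {P} onP) (level-2^ {K} {P} onP lv k))

    level-unique : ∀ {K i j P Q} → i ℕ.< j → Level K i P → Level K j Q → P ≢ Q
    level-unique {K} {i} {j} i<j (x , y , refl , (_ , _ , ui)) (_ , _ , refl , (_ , _ , uj)) refl =
      4^-level-≮ i<j (subst Unit (assoc (4^ i) K x) ui) (subst Unit (assoc (4^ j) K x) uj)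
      where
      assoc : ∀ u v w → u * v * w ≡ u * (v * w)
      assoc = solve-∀ ℚ-ring

    -- If (N + 1) P = O, multiples of P depend only on residues modulo N + 1. Among the N + 2 powers
    -- 2⁰, ..., 2ᴺ⁺¹ two share a residue, yet their multiples lie at different levels.
    near⇒infinite-order : ∀ {K x y} → OnCurve A B (aff x y) → Near {A} {B} K x → ∀ N → suc N · aff x y ≢ O
    near⇒infinite-order {K} {x} {y} on near N e =
      repeat (Fin.pigeonhole {suc N} (ℕ.n<1+n (suc N)) residue)
      where
      P : Point
      P = aff x y
      residue : Fin (suc (suc N)) → Fin (suc N)
      residue k = fromℕ< (ℕ.m%n<n (2^ (toℕ k)) (suc N))
      level₀ : Level K 0 P
      level₀ = x , y , refl , subst (λ c → Near {A} {B} c x) (one K) near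
        where
        one : ∀ K → K ≡ 1ℚ * K
        one = solve-∀ ℚ-ring
      repeat : (∃ λ i → ∃ λ j → i Fin.< j × residue i ≡ residue j) → ⊥
      repeat (i , j , i<j , eq) = level-unique {K} i<j (level-2^ {K} {P} on level₀ (toℕ i)) (level-2^ {K} {P} on level₀ (toℕ j))
        (trans (sym (periodic N {P} e (2^ (toℕ i)))) (trans (cong (_· P) same) (periodic N {P} e (2^ (toℕ j)))))
        where
        same : 2^ (toℕ i) ℕ.% suc N ≡ 2^ (toℕ j) ℕ.% suc N
        same = trans (sym (Fin.toℕ-fromℕ< _)) (trans (cong toℕ eq) (Fin.toℕ-fromℕ< _))

-- With t = b² / (a c), the curve E₁ is the twist by a c of y² = x³ + Aₜ x + Bₜ, which the substitution x = 9 r - 3 t, y = 27 z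
-- turns into z² = r³ - t r² + t r.
Aₜ Bₜ : ℚ → ℚ
Aₜ t = # 27 * t * (# 3 - t)
Bₜ t = # 27 * t * t * (# 9 - # 2 * t)

-- The family in `t`: nonsingularity and positive rank

opaque
  -- A multiple root x forces A = -3 x² and B = 2 x³, where the discriminant vanishes identically.
  discriminant≢0⇒nonsingular : ∀ {A B} → # 4 * A * A * A + # 27 * B * B ≢ 0ℚ → ∀ x → x * x * x + A * x + B ≡ 0ℚ → # 3 * x * x + A ≢ 0ℚ
  discriminant≢0⇒nonsingular {A} {B} Δ≢0 x f g = Δ≢0 (trans (cong₂ (λ A B → # 4 * A * A * A + # 27 * B * B) A≡ B≡) (vanish x))
    where
    A≡ : A ≡ - (# 3 * x * x)
    A≡ = combine₁ 1ℚ g (solve (x ∷ A ∷ []) ℚ-ring)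
    B≡ : B ≡ # 2 * x * x * x
    B≡ = combine₂ 1ℚ (- x) f g (solve (x ∷ A ∷ B ∷ []) ℚ-ring)
    vanish : ∀ x → # 4 * - (# 3 * x * x) * - (# 3 * x * x) * - (# 3 * x * x) + # 27 * (# 2 * x * x * x) * (# 2 * x * x * x) ≡ 0ℚ
    vanish = solve-∀ ℚ-ring

  Eₜ-nonsingular : ∀ {t} → t ≢ 0ℚ → # 4 - t ≢ 0ℚ → ∀ x → x * x * x + Aₜ t * x + Bₜ t ≡ 0ℚ → # 3 * x * x + Aₜ t ≢ 0ℚ
  -- Here 531441 = 3¹², and 4 A³ + 27 B² = 3¹² t³ (4 - t).
  Eₜ-nonsingular {t} t≢0 4-t≢0 = discriminant≢0⇒nonsingular {Aₜ t} {Bₜ t} (λ h → *-≢0 (*-≢0 (*-≢0 t≢0 t≢0) t≢0) 4-t≢0 (*-cancelˡ {# 531441} (λ ()) (trans (Δ t) (trans h refl))))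
    where
    Δ : ∀ t → # 531441 * (t * t * t * (# 4 - t)) ≡ # 4 * (# 27 * t * (# 3 - t)) * (# 27 * t * (# 3 - t)) * (# 27 * t * (# 3 - t)) + # 27 * (# 27 * t * t * (# 9 - # 2 * t)) * (# 27 * t * t * (# 9 - # 2 * t))
    Δ = solve-∀ ℚ-ring

  -- The point is r = ν², z = ν ω. `G` clears denominators: with K = 4 G² the scaled abscissa is 9
  -- (2 G ν)² - 12 t G², a unit, while A K² and B K³ are even because G² and t G² lie in `Z₂`.
  integral-multiple⇒positive-rank : ∀ {t ν ω G} → t ≢ 0ℚ → # 4 - t ≢ 0ℚ →
    ω * ω ≡ ν * ν * ν * ν - t * ν * ν + t → Z₂ G → Z₂ (t * (G * G)) → Unit (# 2 * (G * ν)) → PositiveRank (Aₜ t) (Bₜ t)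
  integral-multiple⇒positive-rank {t} {ν} {ω} {G} t≢0 4-t≢0 ω² zG ztG u =
    aff (# 9 * (ν * ν) - # 3 * t) (# 27 * (ν * ω)) , on ,
    InfiniteOrder.near⇒infinite-order (Aₜ t) (Bₜ t) (Eₜ-nonsingular t≢0 4-t≢0) {# 4 * (G * G)} on
      (subst Even (eA t G) (Even-2* (Z₂-* (Z₂-# 216) (Z₂-* ztG (Z₂-+ (Z₂-* (Z₂-# 3) (Z₂-* zG zG)) (Z₂-neg ztG))))) ,
       subst Even (eB t G) (Even-2* (Z₂-* (Z₂-# 864) (Z₂-* (Z₂-* ztG ztG) (Z₂-+ (Z₂-* (Z₂-# 9) (Z₂-* zG zG)) (Z₂-neg (Z₂-* (Z₂-# 2) ztG)))))) ,
       subst Unit (eU t G ν) (Unit-+ (Unit-* (Unit-odd 4) (Unit-* u u)) (Even-neg (Even-2* (Z₂-* (Z₂-# 6) ztG)))))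
    where
    on : OnCurve (Aₜ t) (Bₜ t) (aff (# 9 * (ν * ν) - # 3 * t) (# 27 * (ν * ω)))
    on = combine₁ (# 729 * (ν * ν)) ω² (e t ν ω)
      where
      e : ∀ t ν ω → # 27 * (ν * ω) * (# 27 * (ν * ω)) - ((# 9 * (ν * ν) - # 3 * t) * (# 9 * (ν * ν) - # 3 * t) * (# 9 * (ν * ν) - # 3 * t) + # 27 * t * (# 3 - t) * (# 9 * (ν * ν) - # 3 * t) + # 27 * t * t * (# 9 - # 2 * t)) ≡ # 729 * (ν * ν) * (ω * ω - (ν * ν * ν * ν - t * ν * ν + t))
      e = solve-∀ ℚ-ring
    eA : ∀ t G → # 2 * (# 216 * (t * (G * G) * (# 3 * (G * G) + - (t * (G * G))))) ≡ # 27 * t * (# 3 - t) * (# 4 * (G * G) * (# 4 * (G * G)))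
    eA = solve-∀ ℚ-ring
    eB : ∀ t G → # 2 * (# 864 * (t * (G * G) * (t * (G * G)) * (# 9 * (G * G) + - (# 2 * (t * (G * G)))))) ≡ # 27 * t * t * (# 9 - # 2 * t) * (# 4 * (G * G) * (# 4 * (G * G)) * (# 4 * (G * G)))
    eB = solve-∀ ℚ-ring
    eU : ∀ t G ν → # 9 * (# 2 * (G * ν) * (# 2 * (G * ν))) + - (# 2 * (# 6 * (t * (G * G)))) ≡ # 4 * (G * G) * (# 9 * (ν * ν) - # 3 * t)
    eU = solve-∀ ℚ-ring

  v≡ : ∀ s → - (1ℚ + # 2 * 0ℚ) + (s * s + s) ≡ s * s + s - 1ℚ
  v≡ = solve-∀ ℚ-ring

  N≡ : ∀ s → - (1ℚ + # 2 * 0ℚ) + (s * s * (s * s) + # 2 * s) ≡ s * s * (s * s) - (1ℚ - # 2 * s)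
  N≡ = solve-∀ ℚ-ring

  -- For 2P, with t = 1 - 2 s: here ν = s and ω = s² + s - 1.
  square-double : ∀ s → (s * s + s - 1ℚ) * (s * s + s - 1ℚ) ≡ s * s * (s * s) - (1ℚ - # 2 * s) * (s * s) + (1ℚ - # 2 * s)
  square-double = solve-∀ ℚ-ring

  -- For the double of a general point (r , z): ν = (r² - t) / (2 z), and the squared polynomial is
  -- the numerator of ω over 4 z² = 4 r (r² - t r + t).
  square-quadruple : ∀ r t → (r * r * (r * r) - # 2 * (t * (r * r * r)) + # 6 * (t * (r * r)) - # 2 * (t * (t * r)) + t * t) * (r * r * (r * r) - # 2 * (t * (r * r * r)) + # 6 * (t * (r * r)) - # 2 * (t * (t * r)) + t * t) ≡
    (r * r - t) * (r * r - t) * ((r * r - t) * (r * r - t)) - t * ((r * r - t) * (r * r - t)) * (# 4 * r * (r * r - t * r + t)) + t * (# 4 * r * (r * r - t * r + t)) * (# 4 * r * (r * r - t * r + t))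
  square-quadruple = solve-∀ ℚ-ring

  -- For 3P, with t = 1 - 2 s: here ν = (s² + 2 s - 1) / (s² - 1), and the squared polynomial is the
  -- numerator of ω over (s² - 1)².
  square-triple : ∀ s → (# 3 * (s * s * s * s) + # 2 * (s * s * s) - # 2 * (s * s) + # 2 * s - 1ℚ) * (# 3 * (s * s * s * s) + # 2 * (s * s * s) - # 2 * (s * s) + # 2 * s - 1ℚ) ≡
    (s * s + # 2 * s - 1ℚ) * (s * s + # 2 * s - 1ℚ) * ((s * s + # 2 * s - 1ℚ) * (s * s + # 2 * s - 1ℚ)) - (1ℚ - # 2 * s) * ((s * s + # 2 * s - 1ℚ) * (s * s + # 2 * s - 1ℚ)) * ((s * s - 1ℚ) * (s * s - 1ℚ)) + (1ℚ - # 2 * s) * ((s * s - 1ℚ) * (s * s - 1ℚ)) * ((s * s - 1ℚ) * (s * s - 1ℚ))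
  square-triple = solve-∀ ℚ-ring

  4r·v² : ∀ s v → # 2 * s * v * (# 2 * s * v) ≡ # 4 * (s * s) * (v * v)
  4r·v² = solve-∀ ℚ-ring

  2svij≡1 : ∀ s v i j → # 2 * s * i ≡ 1ℚ → v * j ≡ 1ℚ → # 2 * s * v * (i * j) ≡ 1ℚ
  2svij≡1 s v i j hi hj = combine₂ (v * j) 1ℚ hi hj (solve (s ∷ v ∷ i ∷ j ∷ []) ℚ-ring)

  2sNij≡Nj : ∀ s N i j → # 2 * s * i ≡ 1ℚ → # 2 * (s * (N * (i * j))) ≡ N * j
  2sNij≡Nj s N i j hi = combine₁ (N * j) hi (solve (s ∷ N ∷ i ∷ j ∷ []) ℚ-ring)

  2Gν≡ : ∀ g i → # 4 * (g * (1ℚ + g)) * i ≡ 1ℚ → # 2 * (g * (1ℚ + g) * ((- (1ℚ + # 2 * g) * - (1ℚ + # 2 * g) + # 2 * - (1ℚ + # 2 * g) - 1ℚ) * i)) ≡ - (1ℚ + # 2 * 0ℚ) + # 2 * (g * g)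
  2Gν≡ g i h = combine₁ (# 2 * (g * g) - 1ℚ) h (solve (g ∷ i ∷ []) ℚ-ring)

  ω²-homogeneous : ∀ N W M t i → M * i ≡ 1ℚ → W * W ≡ N * N * (N * N) - t * (N * N) * (M * M) + t * (M * M) * (M * M) →
    W * i * i * (W * i * i) ≡ N * i * (N * i) * (N * i) * (N * i) - t * (N * i) * (N * i) + t
  ω²-homogeneous N W M t i h hW = combine₂ (i * i * i * i) ((M * i + 1ℚ) * (t * (M * i * (M * i) + 1ℚ) - t * (N * i) * (N * i))) hW h (solve (N ∷ W ∷ M ∷ t ∷ i ∷ []) ℚ-ring)

  -- In the four cases the point used is 2P, 2P, 4P and 3P for P = (1 , 1) on z² = r³ - t r² + t r.
  Eₜ-positive-rank : ∀ {t} → t ≢ 0ℚ → # 4 - t ≢ 0ℚ → t ≢ - 1ℚ → t ≢ 1ℚ → t ≢ # 3 → PositiveRank (Aₜ t) (Bₜ t)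
  Eₜ-positive-rank {t} t≢0 4-t≢0 t≢-1 t≢1 t≢3 = cases (twoAdic t)
    where
    ½ : ℚ
    ½ = + 1 / 2

    ω²-double : ∀ t → (½ * (1ℚ - t) * (½ * (1ℚ - t)) + ½ * (1ℚ - t) - 1ℚ) * (½ * (1ℚ - t) * (½ * (1ℚ - t)) + ½ * (1ℚ - t) - 1ℚ) ≡
         ½ * (1ℚ - t) * (½ * (1ℚ - t)) * (½ * (1ℚ - t)) * (½ * (1ℚ - t)) - t * (½ * (1ℚ - t)) * (½ * (1ℚ - t)) + t
    ω²-double = solve-∀ ℚ-ring

    from-double : ∀ {G} → Z₂ G → Z₂ (t * (G * G)) → Unit (G + - (t * G)) → PositiveRank (Aₜ t) (Bₜ t)
    from-double {G} zG ztG u = integral-multiple⇒positive-rank {t} {½ * (1ℚ - t)} {½ * (1ℚ - t) * (½ * (1ℚ - t)) + ½ * (1ℚ - t) - 1ℚ} {G} t≢0 4-t≢0 (ω²-double t) zG ztG (subst Unit (e t G) u)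
      where
      e : ∀ t G → G + - (t * G) ≡ # 2 * (G * (½ * (1ℚ - t)))
      e = solve-∀ ℚ-ring

    -- ν = (r² - t) / 2z at the double (r , z) = (s² , s (s² + s - 1)) of P, where s = (1 - t) / 2
    from-quadruple : ∀ {s} → Even s → s ≢ 0ℚ → t ≡ 1ℚ - # 2 * s → PositiveRank (Aₜ t) (Bₜ t)
    from-quadruple {s} es s≢0 t≡ = from-inverses (invertible (*-≢0 {# 2} (λ ()) s≢0)) (invertible v≢0)
      where
      zs : Z₂ s
      zs = Even⇒Z₂ es
      v : ℚ
      v = s * s + s - 1ℚ
      uv : Unit v
      uv = subst Unit (v≡ s) (Unit-+ (Unit-neg (Unit-odd 0)) (Even-+ (Even-*ˡ zs es) es))
      v≢0 : v ≢ 0ℚ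
      v≢0 h = even∧unit⇒⊥ (mkEven 0ℚ (Z₂-# 0) h) uv
      zt : Z₂ t
      zt = subst Z₂ (sym t≡) (Z₂-+ (Z₂-# 1) (Z₂-neg (Z₂-* (Z₂-# 2) zs)))
      N : ℚ
      N = s * s * (s * s) - t
      uN : Unit N
      uN = subst (λ t → Unit (s * s * (s * s) - t)) (sym t≡) (subst Unit (N≡ s) (Unit-+ (Unit-neg (Unit-odd 0)) (Even-+ (Even-*ˡ (Z₂-* zs zs) (Even-*ˡ zs es)) (Even-2* zs))))
      from-inverses : (∃ λ i → # 2 * s * i ≡ 1ℚ) → (∃ λ j → v * j ≡ 1ℚ) → PositiveRank (Aₜ t) (Bₜ t)
      -- The choice G = s cancels the factor 2 s of the denominator: 2 G ν = N / v, a quotient of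
      -- units.
      from-inverses (i , hi) (j , hj) = integral-multiple⇒positive-rank {t} {N * (i * j)} {W * (i * j) * (i * j)} {s} t≢0 4-t≢0
          (ω²-homogeneous N W (# 2 * s * v) t (i * j) (2svij≡1 s v i j hi hj) W²) zs (Z₂-* zt (Z₂-* zs zs))
          (subst Unit (sym (2sNij≡Nj s N i j hi)) (Unit-* uN (Unit-inverse uv hj)))
        where
        W : ℚ
        W = s * s * (s * s) * (s * s * (s * s)) - # 2 * (t * (s * s * (s * s) * (s * s))) + # 6 * (t * (s * s * (s * s))) - # 2 * (t * (t * (s * s))) + t * t
        v² : v * v ≡ s * s * (s * s) - t * (s * s) + t
        v² = trans (square-double s) (cong (λ t → s * s * (s * s) - t * (s * s) + t) (sym t≡))
        W² : W * W ≡ N * N * (N * N) - t * (N * N) * (# 2 * s * v * (# 2 * s * v)) + t * (# 2 * s * v * (# 2 * s * v)) * (# 2 * s * v * (# 2 * s * v))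
        W² = trans (square-quadruple (s * s) t) (cong (λ m → N * N * (N * N) - t * (N * N) * m + t * m * m) (sym (trans (4r·v² s v) (cong (# 4 * (s * s) *_) v²))))

    -- the coordinates of 3P, again with s = (1 - t) / 2
    from-triple : ∀ {g} → Z₂ g → g ≢ 0ℚ → 1ℚ + g ≢ 0ℚ → t ≡ # 3 + # 4 * g → PositiveRank (Aₜ t) (Bₜ t)
    from-triple {g} zg g≢0 1+g≢0 t≡ = from-inverse (invertible (*-≢0 {# 4} (λ ()) (*-≢0 g≢0 1+g≢0)))
      where
      zt : Z₂ t
      zt = subst Z₂ (sym t≡) (Z₂-+ (Z₂-# 3) (Z₂-* (Z₂-# 4) zg))
      s N W : ℚ
      s = - (1ℚ + # 2 * g)
      N = s * s + # 2 * s - 1ℚ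
      W = # 3 * (s * s * s * s) + # 2 * (s * s * s) - # 2 * (s * s) + # 2 * s - 1ℚ
      from-inverse : (∃ λ i → # 4 * (g * (1ℚ + g)) * i ≡ 1ℚ) → PositiveRank (Aₜ t) (Bₜ t)
      -- As s² - 1 = 4 g (1 + g), the choice G = g (1 + g) gives 2 G ν = N / 2 = 2 g² - 1. The
      -- denominator vanishes only for g = 0 and g = -1, that is t = 3 and t = -1.
      from-inverse (i , hi) = integral-multiple⇒positive-rank {t} {N * i} {W * i * i} {g * (1ℚ + g)} t≢0 4-t≢0 (ω²-homogeneous N W M t i Mi W²) zG (Z₂-* zt (Z₂-* zG zG))
          (subst Unit (sym (2Gν≡ g i hi)) (Unit-+ (Unit-neg (Unit-odd 0)) (Even-2* (Z₂-* zg zg))))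
        where
        zG : Z₂ (g * (1ℚ + g))
        zG = Z₂-* zg (Z₂-+ (Z₂-# 1) zg)
        M : ℚ
        M = s * s - 1ℚ
        Mi : M * i ≡ 1ℚ
        Mi = trans (cong (_* i) (e₁ g)) hi
          where
          e₁ : ∀ g → - (1ℚ + # 2 * g) * - (1ℚ + # 2 * g) - 1ℚ ≡ # 4 * (g * (1ℚ + g))
          e₁ = solve-∀ ℚ-ring
        t≡′ : t ≡ 1ℚ - # 2 * s
        t≡′ = trans t≡ (e₁ g)
          where
          e₁ : ∀ g → # 3 + # 4 * g ≡ 1ℚ - # 2 * - (1ℚ + # 2 * g)
          e₁ = solve-∀ ℚ-ring
        W² : W * W ≡ N * N * (N * N) - t * (N * N) * (M * M) + t * (M * M) * (M * M)
        W² = trans (square-triple s) (cong (λ t → N * N * (N * N) - t * (N * N) * (M * M) + t * (M * M) * (M * M)) (sym t≡′))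

    cases : TwoAdic t → PositiveRank (Aₜ t) (Bₜ t)
    cases (even et) = from-double {1ℚ} (Z₂-# 1) (Z₂-* (Even⇒Z₂ et) (Z₂-* (Z₂-# 1) (Z₂-# 1))) (Unit-+ (Unit-odd 0) (Even-neg (Even-*ʳ et (Z₂-# 1))))
    -- With G = e = 1 / t, t G² is e and 2 G ν is e - 1.
    cases (pole e te≡1 ee) = from-double {e} (Even⇒Z₂ ee) (subst Z₂ (sym tee≡e) (Even⇒Z₂ ee)) (subst Unit e-1≡ (Unit-+ (Unit-neg (Unit-odd 0)) ee))
      where
      tee≡e : t * (e * e) ≡ e
      tee≡e = combine₁ e te≡1 (solve (t ∷ e ∷ []) ℚ-ring)
      e-1≡ : - (1ℚ + # 2 * 0ℚ) + e ≡ e + - (t * e)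
      e-1≡ = combine₁ 1ℚ te≡1 (solve (t ∷ e ∷ []) ℚ-ring)
    cases (unit (mkUnit h zh t≡)) = half (twoAdic h)
      where
      half : TwoAdic h → PositiveRank (Aₜ t) (Bₜ t)
      half (even eh) = from-quadruple { - h} (Even-neg eh) -h≢0 (trans t≡ (e h))
        where
        e : ∀ h → 1ℚ + # 2 * h ≡ 1ℚ - # 2 * - h
        e = solve-∀ ℚ-ring
        -h≢0 : - h ≢ 0ℚ
        -h≢0 -h≡0 = t≢1 (combine₂ 1ℚ (- # 2) t≡ -h≡0 (solve (t ∷ h ∷ []) ℚ-ring))
      half (unit (mkUnit g zg h≡)) = from-triple {g} zg g≢0 1+g≢0 t≡3+4g
        where
        t≡3+4g : t ≡ # 3 + # 4 * g
        t≡3+4g = combine₂ 1ℚ (# 2) t≡ h≡ (solve (t ∷ h ∷ g ∷ []) ℚ-ring)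
        g≢0 : g ≢ 0ℚ
        g≢0 g≡0 = t≢3 (combine₂ 1ℚ (# 4) t≡3+4g g≡0 (solve (t ∷ g ∷ []) ℚ-ring))
        1+g≢0 : 1ℚ + g ≢ 0ℚ
        1+g≢0 e = t≢-1 (combine₂ 1ℚ (# 4) t≡3+4g e (solve (t ∷ g ∷ []) ℚ-ring))
      half (pole e he≡1 ee) = ⊥-elim (even∧unit⇒⊥ (Even-*ˡ zh ee) (subst Unit (sym he≡1) (Unit-odd 0)))

-- The rational points for t = 1, -1 and 3

opaque
  numerator-coprime : ∀ r → Descent.Coprime (↥ r) (↧ r)
  numerator-coprime (mkℚ m d c) {p} pp p∣m p∣d = ⊥-elim-irr (¬prime[1] (subst Prime (c (Descent.∣ᶻ⇒∣ p∣m , Descent.∣ᶻ⇒∣ p∣d)) pp))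

  ι≢0 : ∀ {k} → ι (+ suc k) ≢ 0ℚ
  ι≢0 {k} h with () ← ι-injective {+ suc k} {+ 0} h

  -- A prime divisor of the denominator would divide p², hence the numerator, against lowest terms.
  square-integer-root : ∀ z K → z * z ≡ ι K → ∃ λ Z → K ≡ Z ℤ.* Z
  square-integer-root z@(mkℚ p e c) K h = go (suc e ℕ.≟ 1)
    where
    p²≡ : p ℤ.* p ≡ K ℤ.* (+ suc e ℤ.* + suc e)
    p²≡ = ι-injective (trans (ι-* p p) (trans (cong₂ _*_ (sym (p*↧p≡↥p z)) (sym (p*↧p≡↥p z)))
      (trans (rearrange z (ι (+ suc e))) (trans (cong₂ _*_ h (sym (ι-* (+ suc e) (+ suc e)))) (sym (ι-* K (+ suc e ℤ.* + suc e)))))))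
      where
      rearrange : ∀ z d → z * d * (z * d) ≡ z * z * (d * d)
      rearrange = solve-∀ ℚ-ring
    go : Dec (suc e ≡ 1) → ∃ λ Z → K ≡ Z ℤ.* Z
    go (yes 1+e≡1) = p , sym (trans p²≡ (trans (cong (λ d → K ℤ.* (+ d ℤ.* + d)) 1+e≡1) (ℤ.*-identityʳ K)))
    go (no 1+e≢1) = ⊥-elim (from-prime (Descent.prime-divisor (suc e) 1+e≢1))
      where
      from-prime : (∃ λ q → Prime q × q ℕ.∣ suc e) → ⊥
      from-prime (q , pq , q∣e) = numerator-coprime z pq (Descent.prime∣ᶻsquare pq p (subst (q Descent.∣ᶻ_) (sym p²≡) (Descent.∣ᶻ-*ˡ K (Descent.∣ᶻ-*ˡ {x = + suc e} (+ suc e) (Descent.∣⇒∣ᶻ q∣e))))) (Descent.∣⇒∣ᶻ q∣e)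

  ι-form : ∀ T m n → ι (n ℤ.* (m ℤ.* Descent.Form T m n)) ≡ ι n * (ι m * (ι m * ι m - ι T * (ι m * ι n) + ι T * (ι n * ι n)))
  ι-form T m n = trans (ι-* n _) (cong (ι n *_) (trans (ι-* m _) (cong (ι m *_)
    (trans (ι-+ (m ℤ.* m ℤ.- T ℤ.* (m ℤ.* n)) (T ℤ.* (n ℤ.* n))) (cong₂ _+_
      (trans (ι-+ (m ℤ.* m) _) (cong₂ _+_ (ι-* m m) (trans (ι-neg (T ℤ.* (m ℤ.* n))) (cong -_ (scaled m n)))))
      (scaled n n))))))
    where
    scaled : ∀ i j → ι (T ℤ.* (i ℤ.* j)) ≡ ι T * (ι i * ι j)
    scaled i j = trans (ι-* T (i ℤ.* j)) (cong (ι T *_) (ι-* i j))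

  clear-denominators : ∀ T r z → z * z ≡ r * r * r - ι T * r * r + ι T * r → ∃ λ Z → ↧ r ℤ.* (↥ r ℤ.* Descent.Form T (↥ r) (↧ r)) ≡ Z ℤ.* Z
  clear-denominators T r z h = square-integer-root (z * (ι (↧ r) * ι (↧ r))) _
    (trans (ident (ι T) r z (ι (↥ r)) (ι (↧ r)) (p*↧p≡↥p r) h) (sym (ι-form T (↥ r) (↧ r))))
    where
    ident : ∀ t r z m n → r * n ≡ m → z * z ≡ r * r * r - t * r * r + t * r → z * (n * n) * (z * (n * n)) ≡ n * (m * (m * m - t * (m * n) + t * (n * n)))
    ident t r z _ n refl h = combine₁ (n * n * n * n) h (solve (t ∷ r ∷ z ∷ n ∷ []) ℚ-ring)

  multiple-of-denominator : ∀ r T → ↥ r ≡ T ℤ.* ↧ r → r ≡ ι T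
  multiple-of-denominator r@(mkℚ _ d _) T h = *-cancelˡ {ι (↧ r)} {r} {ι T} (ι≢0 {d}) (trans (swap (ι (↧ r)) r) (trans (p*↧p≡↥p r) (trans (cong ι h) (trans (ι-* T (↧ r)) (swap (ι T) (ι (↧ r)))))))
    where
    swap : ∀ x y → x * y ≡ y * x
    swap = solve-∀ ℚ-ring

  solutions₁ : ∀ {r z} → z * z ≡ r * r * r - # 1 * r * r + # 1 * r → r ≡ ι (+ 0) ⊎ r ≡ ι (+ 1)
  solutions₁ {r@(mkℚ m d _)} {z} h = from-root (clear-denominators (+ 1) r z h)
    where
    from-root : (∃ λ Z → ↧ r ℤ.* (↥ r ℤ.* Descent.Form (+ 1) (↥ r) (↧ r)) ≡ Z ℤ.* Z) → r ≡ ι (+ 0) ⊎ r ≡ ι (+ 1)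
    from-root (Z , e) = [ (λ h → inj₁ (multiple-of-denominator r (+ 0) h)) , (λ h → inj₂ (multiple-of-denominator r (+ 1) (trans h (sym (ℤ.*-identityˡ (+ suc d)))))) ]′
      (Descent.fractions₁ m d Z (numerator-coprime r) e)

  solutions₋₁ : ∀ {r z} → z * z ≡ r * r * r - - # 1 * r * r + - # 1 * r → r ≡ ι (+ 0) ⊎ r ≡ ι (+ 1) ⊎ r ≡ ι (ℤ.- + 1)
  solutions₋₁ {r@(mkℚ m d _)} {z} h = from-root (clear-denominators (ℤ.- + 1) r z h)
    where
    from-root : (∃ λ Z → ↧ r ℤ.* (↥ r ℤ.* Descent.Form (ℤ.- + 1) (↥ r) (↧ r)) ≡ Z ℤ.* Z) → r ≡ ι (+ 0) ⊎ r ≡ ι (+ 1) ⊎ r ≡ ι (ℤ.- + 1)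
    from-root (Z , e) = [ (λ h → inj₁ (multiple-of-denominator r (+ 0) h)) ,
      [ (λ h → inj₂ (inj₁ (multiple-of-denominator r (+ 1) (trans h (sym (ℤ.*-identityˡ (+ suc d))))))) , (λ h → inj₂ (inj₂ (multiple-of-denominator r (ℤ.- + 1) (trans h (sym (ℤ.-1*i≡-i (+ suc d))))))) ]′ ]′
      (Descent.fractions₋₁ m d Z (numerator-coprime r) e)

  solutions₃ : ∀ {r z} → z * z ≡ r * r * r - # 3 * r * r + # 3 * r → r ≡ ι (+ 0) ⊎ r ≡ ι (+ 1) ⊎ r ≡ ι (+ 3)
  solutions₃ {r@(mkℚ m d _)} {z} h = from-root (clear-denominators (+ 3) r z h)
    where
    from-root : (∃ λ Z → ↧ r ℤ.* (↥ r ℤ.* Descent.Form (+ 3) (↥ r) (↧ r)) ≡ Z ℤ.* Z) → r ≡ ι (+ 0) ⊎ r ≡ ι (+ 1) ⊎ r ≡ ι (+ 3)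
    from-root (Z , e) = [ (λ h → inj₁ (multiple-of-denominator r (+ 0) h)) ,
      [ (λ h → inj₂ (inj₁ (multiple-of-denominator r (+ 1) (trans h (sym (ℤ.*-identityˡ (+ suc d))))))) , (λ h → inj₂ (inj₂ (multiple-of-denominator r (+ 3) h))) ]′ ]′
      (Descent.fractions₃ m d Z (numerator-coprime r) e)

opaque
  -- The point (x , y) of the curve Eₜ in the coordinates r = (x + 3 t) / 9 and z = y / 27
  reduced-equation : ∀ t x y → y * y ≡ x * x * x + # 27 * t * (# 3 - t) * x + # 27 * t * t * (# 9 - # 2 * t) →
    let r = + 1 / 9 * (x + # 3 * t) ; z = + 1 / 27 * y in z * z ≡ r * r * r - t * r * r + t * r
  reduced-equation t x y h = combine₁ (+ 1 / 729) h (solve (t ∷ x ∷ y ∷ []) ℚ-ring)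

  x-from-r : ∀ t r x → + 1 / 9 * (x + # 3 * t) ≡ r → x ≡ # 9 * r - # 3 * t
  x-from-r t r x h = combine₁ (# 9) h (solve (t ∷ r ∷ x ∷ []) ℚ-ring)

  y-from-square : ∀ y v → y * y ≡ v * v → y ≡ v ⊎ y ≡ - v
  y-from-square y v h = [ inj₁ , (λ e → inj₂ (y≡-v e)) ]′ (x*x≡y*y⇒x≡y∨x+y≡0 {y} {v} h)
    where
    y≡-v : y + v ≡ 0ℚ → y ≡ - v
    y≡-v e = combine₁ 1ℚ e (solve (y ∷ v ∷ []) ℚ-ring)

  -- The abscissa fixes y up to sign, so finite order has to be checked only at the two explicit
  -- points with ordinates v and -v.
  torsion : ∀ {A B} x₀ v → v * v ≡ x₀ * x₀ * x₀ + A * x₀ + B → (∃ λ n → smul A B (suc n) (aff x₀ v) ≡ O) → (∃ λ n → smul A B (suc n) (aff x₀ (- v)) ≡ O) →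
    ∀ {x y} → y * y ≡ x * x * x + A * x + B → x ≡ x₀ → ∃ λ n → smul A B (suc n) (aff x y) ≡ O
  torsion {A} {B} x₀ v hv h₊ h₋ {_} {y} on refl = [ (λ e → subst (λ y → ∃ λ n → smul A B (suc n) (aff x₀ y) ≡ O) (sym e) h₊) , (λ e → subst (λ y → ∃ λ n → smul A B (suc n) (aff x₀ y) ≡ O) (sym e) h₋) ]′
    (y-from-square y v (trans on (sym hv)))

-- In all three cases the numerals are orders minus one and `refl` evaluates the multiple. For t = 1
-- the points with r = 0, 1 have orders 2, 4. For t = -1 and t = 3 the orders are 2 at r = 0, 3 at r
-- = 1, and 6 at r = -1 or r = 3 respectively.
rank-zero₁ : RankZero (Aₜ 1ℚ) (Bₜ 1ℚ)
rank-zero₁ O _ = 0 , refl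
rank-zero₁ (aff x y) on =
  [ (λ e → torsion (- # 3) 0ℚ refl (1 , refl) (1 , refl) on (x-from-r 1ℚ 0ℚ x e))
  , (λ e → torsion (# 6) (# 27) refl (3 , refl) (3 , refl) on (x-from-r 1ℚ 1ℚ x e)) ]′
  (solutions₁ {z = + 1 / 27 * y} (reduced-equation 1ℚ x y on))

rank-zero₋₁ : RankZero (Aₜ (- 1ℚ)) (Bₜ (- 1ℚ))
rank-zero₋₁ O _ = 0 , refl
rank-zero₋₁ (aff x y) on =
  [ (λ e → torsion (# 3) 0ℚ refl (1 , refl) (1 , refl) on (x-from-r (- 1ℚ) 0ℚ x e))
  , [ (λ e → torsion (# 12) (# 27) refl (2 , refl) (2 , refl) on (x-from-r (- 1ℚ) 1ℚ x e))
    , (λ e → torsion (- # 6) (# 27) refl (5 , refl) (5 , refl) on (x-from-r (- 1ℚ) (- 1ℚ) x e)) ]′ ]′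
  (solutions₋₁ {z = + 1 / 27 * y} (reduced-equation (- 1ℚ) x y on))

rank-zero₃ : RankZero (Aₜ (# 3)) (Bₜ (# 3))
rank-zero₃ O _ = 0 , refl
rank-zero₃ (aff x y) on =
  [ (λ e → torsion (- # 9) 0ℚ refl (1 , refl) (1 , refl) on (x-from-r (# 3) 0ℚ x e))
  , [ (λ e → torsion 0ℚ (# 27) refl (2 , refl) (2 , refl) on (x-from-r (# 3) 1ℚ x e))
    , (λ e → torsion (# 18) (# 81) refl (5 , refl) (5 , refl) on (x-from-r (# 3) (# 3) x e)) ]′ ]′
  (solutions₃ {z = + 1 / 27 * y} (reduced-equation (# 3) x y on))

-- Rescaling to the given curve

opaque
  cancel² : ∀ u i x → u * i ≡ 1ℚ → u * u * (i * i * x) ≡ x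
  cancel² u i x h = combine₁ (x * (u * i + 1ℚ)) h (solve (u ∷ i ∷ x ∷ []) ℚ-ring)

  cancel³ : ∀ u i y → u * i ≡ 1ℚ → u * u * u * (i * i * i * y) ≡ y
  cancel³ u i y h = combine₁ (y * (u * i * (u * i) + u * i + 1ℚ)) h (solve (u ∷ i ∷ y ∷ []) ℚ-ring)

  cancel⁴ : ∀ u i A → u * i ≡ 1ℚ → i * i * i * i * (u * u * u * u * A) ≡ A
  cancel⁴ u i A h = trans (rearrange u i A) (trans (cong (i * i *_) (cancel² u i (u * u * A) h)) (trans (rearrange′ u i A) (cancel² u i A h)))
    where
    rearrange : ∀ u i A → i * i * i * i * (u * u * u * u * A) ≡ i * i * (u * u * (i * i * (u * u * A)))
    rearrange = solve-∀ ℚ-ring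
    rearrange′ : ∀ u i A → i * i * (u * u * A) ≡ u * u * (i * i * A)
    rearrange′ = solve-∀ ℚ-ring

  cancel⁶ : ∀ u i B → u * i ≡ 1ℚ → i * i * i * i * i * i * (u * u * u * u * u * u * B) ≡ B
  cancel⁶ u i B h = trans (rearrange u i B) (trans (cong (λ x → u * u * u * (i * i * i * x)) (cancel³ u i B h)) (cancel³ u i B h))
    where
    rearrange : ∀ u i B → i * i * i * i * i * i * (u * u * u * u * u * u * B) ≡ u * u * u * (i * i * i * (u * u * u * (i * i * i * B)))
    rearrange = solve-∀ ℚ-ring

  unscale-equation : ∀ u i x y A B → u * i ≡ 1ℚ → y * y ≡ x * x * x + u * u * u * u * A * x + u * u * u * u * u * u * B →
    i * i * i * y * (i * i * i * y) ≡ i * i * x * (i * i * x) * (i * i * x) + A * (i * i * x) + B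
  unscale-equation u i x y A B h on = trans (homogeneous i x y _ _ on) (cong₂ (λ A B → i * i * x * (i * i * x) * (i * i * x) + A * (i * i * x) + B) (cancel⁴ u i A h) (cancel⁶ u i B h))
    where
    homogeneous : ∀ i x y A B → y * y ≡ x * x * x + A * x + B →
      i * i * i * y * (i * i * i * y) ≡ i * i * x * (i * i * x) * (i * i * x) + i * i * i * i * A * (i * i * x) + i * i * i * i * i * i * B
    homogeneous i x y A B on = combine₁ (i * i * i * i * i * i) on (solve (i ∷ x ∷ y ∷ A ∷ B ∷ []) ℚ-ring)

  scale-equation : ∀ u x y A B → y * y ≡ x * x * x + A * x + B →
    u * u * u * y * (u * u * u * y) ≡ u * u * x * (u * u * x) * (u * u * x) + u * u * u * u * A * (u * u * x) + u * u * u * u * u * u * B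
  scale-equation u x y A B on = combine₁ (u * u * u * u * u * u) on (solve (u ∷ x ∷ y ∷ A ∷ B ∷ []) ℚ-ring)

  line-scale : ∀ u {A x₁ y₁ x₂ y₂ l} → Line A x₁ y₁ x₂ y₂ l → Line (u * u * u * u * A) (u * u * x₁) (u * u * u * y₁) (u * u * x₂) (u * u * u * y₂) (u * l)
  line-scale u {A} {x₁} {y₁} {x₂} {y₂} {l} (mkLine ch tg) = mkLine
    (combine₁ (u * u * u) ch (solve (u ∷ x₁ ∷ y₁ ∷ x₂ ∷ y₂ ∷ l ∷ []) ℚ-ring))
    (combine₁ (u * u * u * u) tg (solve (u ∷ x₁ ∷ y₁ ∷ x₂ ∷ y₂ ∷ l ∷ A ∷ []) ℚ-ring))

  scale-x₃ : ∀ u x₁ x₂ l → u * u * (l * l - x₁ - x₂) ≡ u * l * (u * l) - u * u * x₁ - u * u * x₂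
  scale-x₃ = solve-∀ ℚ-ring

  scale-y₃ : ∀ u x₁ y₁ x₂ l → u * u * u * (l * (x₁ - (l * l - x₁ - x₂)) - y₁) ≡ u * l * (u * u * x₁ - u * u * (l * l - x₁ - x₂)) - u * u * u * y₁
  scale-y₃ = solve-∀ ℚ-ring

scale : ℚ → Point → Point
scale u O = O
scale u (aff x y) = aff (u * u * x) (u * u * u * y)

module Scaling (A B : ℚ) (nonsingular : ∀ x → x * x * x + A * x + B ≡ 0ℚ → # 3 * x * x + A ≢ 0ℚ) (u : ℚ) (u≢0 : u ≢ 0ℚ) where
  open GroupLaw A B nonsingular

  A′ B′ : ℚ
  A′ = u * u * u * u * A
  B′ = u * u * u * u * u * u * B

  scale-closed : ∀ P → On P → OnCurve A′ B′ (scale u P)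
  scale-closed O _ = tt
  scale-closed (aff x y) on = scale-equation u x y A B on

  opaque
    -- Scaling multiplies slopes by u, so lines correspond to lines; u ≠ 0 ensures that points which
    -- are not opposite stay so.
    scale-⊕ : ∀ P Q → On P → On Q → add A′ B′ (scale u P) (scale u Q) ≡ scale u (P ⊕ Q)
    scale-⊕ O Q _ _ = refl
    scale-⊕ (aff _ _) O _ _ = refl
    scale-⊕ (aff x₁ y₁) (aff x₂ y₂) onP onQ = view (sumView {A} {B} {x₁} {y₁} {x₂} {y₂} onP onQ)
      where
      view : SumView A x₁ y₁ x₂ y₂ → add A′ B′ (scale u (aff x₁ y₁)) (scale u (aff x₂ y₂)) ≡ scale u (aff x₁ y₁ ⊕ aff x₂ y₂)
      view (opposite opp@(mkOpposite x₁≡x₂ h)) = trans (add-opposite {A′} {B′} opp′) (cong (scale u) (sym (add-opposite {A} {B} opp)))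
        where
        opp′ : Opposite (u * u * x₁) (u * u * u * y₁) (u * u * x₂) (u * u * u * y₂)
        opp′ = mkOpposite (cong (λ x → u * u * x) x₁≡x₂) (trans (sym (*-distribˡ-+ (u * u * u) y₁ y₂)) (trans (cong (u * u * u *_) h) (*-zeroʳ (u * u * u))))
      view (line l ln ¬opp) = trans (add-line {A′} {B′} (u * l) ln′ ¬opp′ (scale-x₃ u x₁ x₂ l) (scale-y₃ u x₁ y₁ x₂ l)) (cong (scale u) (sym (add-line {A} {B} l ln ¬opp refl refl)))
        where
        ln′ : Line A′ (u * u * x₁) (u * u * u * y₁) (u * u * x₂) (u * u * u * y₂) (u * l)
        ln′ = line-scale u ln
        ¬opp′ : ¬ Opposite (u * u * x₁) (u * u * u * y₁) (u * u * x₂) (u * u * u * y₂)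
        ¬opp′ (mkOpposite e h) = ¬opp (mkOpposite (*-cancelˡ {u * u} (*-≢0 u≢0 u≢0) e)
          (*-cancelˡ {u * u * u} (*-≢0 (*-≢0 u≢0 u≢0) u≢0) (trans (*-distribˡ-+ (u * u * u) y₁ y₂) (trans h (sym (*-zeroʳ (u * u * u)))))))

  scale-· : ∀ n P → On P → smul A′ B′ n (scale u P) ≡ scale u (n · P)
  scale-· zero P _ = refl
  scale-· (suc n) P on = trans (cong (add A′ B′ (scale u P)) (scale-· n P on)) (scale-⊕ P (n · P) on (·-closed n {P} on))

  scale≡O⇒≡O : ∀ P → scale u P ≡ O → P ≡ O
  scale≡O⇒≡O O _ = refl

  positive-rank : PositiveRank A B → PositiveRank A′ B′
  positive-rank (P , on , infinite) = scale u P , scale-closed P on ,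
    λ n e → infinite n (scale≡O⇒≡O (suc n · P) (trans (sym (scale-· (suc n) P on)) e))

  opaque
    unscale : ∀ P → OnCurve A′ B′ P → ∃ λ Q → On Q × scale u Q ≡ P
    unscale O _ = O , tt , refl
    unscale (aff x y) on = from-inverse (invertible u≢0)
      where
      from-inverse : (∃ λ i → u * i ≡ 1ℚ) → ∃ λ Q → On Q × scale u Q ≡ aff x y
      from-inverse (i , h) = aff (i * i * x) (i * i * i * y) , onQ , cong₂ aff (cancel² u i x h) (cancel³ u i y h)
        where
        onQ : On (aff (i * i * x) (i * i * i * y))
        onQ = unscale-equation u i x y A B h on

  rank-zero : RankZero A B → RankZero A′ B′
  rank-zero torsion P onP with unscale P onP
  ... | Q , onQ , refl with torsion Q onQ
  ...   | n , e = n , trans (scale-· (suc n) Q onQ) (cong (scale u) e)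

opaque
  E₁A-scaled : ∀ a b c t → t * (a * c) ≡ b * b → a * c * (a * c) * (a * c) * (a * c) * (# 27 * t * (# 3 - t)) ≡ # 27 * (a * a) * (b * b) * (c * c) * (# 3 * a * c - b * b)
  E₁A-scaled a b c t h = combine₁ (# 27 * (a * c * (a * c)) * (# 3 * (a * c) - b * b - t * (a * c))) h (solve (a ∷ b ∷ c ∷ t ∷ []) ℚ-ring)

  E₁B-scaled : ∀ a b c t → t * (a * c) ≡ b * b → a * c * (a * c) * (a * c) * (a * c) * (a * c) * (a * c) * (# 27 * t * t * (# 9 - # 2 * t)) ≡
    # 27 * (a * a * a) * (b * b * b * b) * (c * c * c) * (# 9 * a * c - # 2 * (b * b))
  E₁B-scaled a b c t h = combine₁ (# 27 * (a * c * (a * c) * (a * c)) * (# 9 * (a * c) * (b * b + t * (a * c)) - # 2 * (b * b * (b * b) + b * b * (t * (a * c)) + t * (a * c) * (t * (a * c))))) h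
    (solve (a ∷ b ∷ c ∷ t ∷ []) ℚ-ring)

theorem2p2 : (a b c : ℚ) → a * b * c ≢ 0ℚ → q 4 * a * c - b * b ≢ 0ℚ →
    ((b * b ≢ - (a * c) → b * b ≢ a * c → b * b ≢ q 3 * (a * c) → PositiveRank (E₁A a b c) (E₁B a b c))
    × ((b * b ≡ - (a * c) ⊎ b * b ≡ a * c ⊎ b * b ≡ q 3 * (a * c)) → RankZero (E₁A a b c) (E₁B a b c)))
theorem2p2 a b c abc≢0 Δ≢0 = from-inverse (invertible ac≢0)
  where
  ac≢0 : a * c ≢ 0ℚ
  ac≢0 h = abc≢0 (combine₁ b h (solve (a ∷ b ∷ c ∷ []) ℚ-ring))
  b≢0 : b ≢ 0ℚ
  b≢0 h = abc≢0 (combine₁ (a * c) h (solve (a ∷ b ∷ c ∷ []) ℚ-ring))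
  Goal : Set
  Goal = (b * b ≢ - (a * c) → b * b ≢ a * c → b * b ≢ # 3 * (a * c) → PositiveRank (E₁A a b c) (E₁B a b c))
    × ((b * b ≡ - (a * c) ⊎ b * b ≡ a * c ⊎ b * b ≡ # 3 * (a * c)) → RankZero (E₁A a b c) (E₁B a b c))
  -- Only the defining equation of `t` is passed on, so no inverse enters the identities below.
  with-t : ∀ t → t * (a * c) ≡ b * b → Goal
  with-t t h = subst₂ Claim (E₁A-scaled a b c t h) (E₁B-scaled a b c t h) (positive , zero-rank)
    where
    Claim : ℚ → ℚ → Set
    Claim A B = (b * b ≢ - (a * c) → b * b ≢ a * c → b * b ≢ # 3 * (a * c) → PositiveRank A B)
      × ((b * b ≡ - (a * c) ⊎ b * b ≡ a * c ⊎ b * b ≡ # 3 * (a * c)) → RankZero A B)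
    t≢0 : t ≢ 0ℚ
    t≢0 e = *-≢0 b≢0 b≢0 (combine₂ (- 1ℚ) (a * c) h e (solve (a ∷ b ∷ c ∷ t ∷ []) ℚ-ring))
    -- The hypothesis transfers because 4 a c - b² = (4 - t) a c.
    4-t≢0 : # 4 - t ≢ 0ℚ
    4-t≢0 e = Δ≢0 (combine₂ 1ℚ (a * c) h e (solve (a ∷ b ∷ c ∷ t ∷ []) ℚ-ring))
    module S = Scaling (Aₜ t) (Bₜ t) (Eₜ-nonsingular t≢0 4-t≢0) (a * c) ac≢0
    b²≡ : ∀ {k} → t ≡ k → b * b ≡ k * (a * c)
    b²≡ e = trans (sym h) (cong (_* (a * c)) e)
    t≡ : ∀ k → b * b ≡ k * (a * c) → t ≡ k
    t≡ k e = *-cancelˡ ac≢0 (combine₂ 1ℚ 1ℚ h e (solve (a ∷ b ∷ c ∷ t ∷ k ∷ []) ℚ-ring))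
    neg-one : ∀ x → - 1ℚ * x ≡ - x
    neg-one = solve-∀ ℚ-ring
    one : ∀ x → 1ℚ * x ≡ x
    one = solve-∀ ℚ-ring
    rank-zero-at : ∀ k → RankZero (Aₜ k) (Bₜ k) → t ≡ k → RankZero (Aₜ t) (Bₜ t)
    rank-zero-at k r e = subst (λ k → RankZero (Aₜ k) (Bₜ k)) (sym e) r
    positive : b * b ≢ - (a * c) → b * b ≢ a * c → b * b ≢ # 3 * (a * c) → PositiveRank S.A′ S.B′
    positive ≢-1 ≢1 ≢3 = S.positive-rank (Eₜ-positive-rank t≢0 4-t≢0 (λ e → ≢-1 (trans (b²≡ e) (neg-one (a * c)))) (λ e → ≢1 (trans (b²≡ e) (one (a * c)))) (λ e → ≢3 (b²≡ e)))
    zero-rank : b * b ≡ - (a * c) ⊎ b * b ≡ a * c ⊎ b * b ≡ # 3 * (a * c) → RankZero S.A′ S.B′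
    zero-rank (inj₁ e) = S.rank-zero (rank-zero-at (- 1ℚ) rank-zero₋₁ (t≡ (- 1ℚ) (trans e (sym (neg-one (a * c))))))
    zero-rank (inj₂ (inj₁ e)) = S.rank-zero (rank-zero-at 1ℚ rank-zero₁ (t≡ 1ℚ (trans e (sym (one (a * c))))))
    zero-rank (inj₂ (inj₂ e)) = S.rank-zero (rank-zero-at (# 3) rank-zero₃ (t≡ (# 3) e))
  from-inverse : (∃ λ i → a * c * i ≡ 1ℚ) → Goal
  from-inverse (i , h) = with-t (b * b * i) (combine₁ (b * b) h (solve (a ∷ b ∷ c ∷ i ∷ []) ℚ-ring))
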